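{- For every integer $n\ge 0$, the multipath complex $X(\mathtt{BL}_n)$ of the bidirectional linear digraph $\mathtt{BL}_n$ on $n+1$ vertices is homotopy equivalent to the sphere $S^{\lfloor \frac{n-1}{2}\rfloor}$.
   Context: A digraph has at most one edge $(v,w)$ from $v$ to $w$ for each ordered pair of vertices. For an edge $e=(v,w)$, $s(e)=v$ is its source and $t(e)=w$ its target. A simple path in a digraph is a sequence of edges $e_1,\dots,e_k$ with $s(e_{i+1})=t(e_i)$ for all $i<k$, such that $s(e_i)=s(e_j)$ or $t(e_i)=t(e_j)$ implies $i=j$, and which is not a cycle, i.e. $s(e_1)\neq t(e_k)$. A multipath of a digraph $G$ is a spanning subgraph each of whose connected components is either a single vertex or a simple path. The multipath complex $X(G)$ is the (abstract) simplicial complex whose simplices are the nonempty edge sets of multipaths of $G$ (the empty simplex corresponds to the multipath with no edges); topological statements refer to its geometric realization. For $n\ge 0$, the bidirectional linear digraph $\mathtt{BL}_n$ has $n+1$ vertices $v_0,\dots,v_n$ and the $2n$ edges $(v_i,v_{i+1})$ and $(v_{i+1},v_i)$ for $0\le i\le n-1$; in particular $\mathtt{BL}_0$ is a single vertex with no edges. Convention: $S^{ -1}=\emptyset$ (relevant for $n=0$, where the multipath complex is empty). -}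

module Defs where

open import Algebra.Bundles using (CommutativeMonoid)
open import Algebra.Bundles.Raw using (RawMonoid)
import Algebra.Definitions.RawMonoid as RawMonoidDefinitions
import Algebra.Properties.AbelianGroup as AbelianGroupProperties
import Algebra.Properties.CommutativeSemigroup as CommutativeSemigroupProperties
open import Data.Fin using (Fin; zero; suc; toℕ; fromℕ; inject₁; splitAt; join)
open import Data.Fin.Properties
  using (suc-injective; toℕ-inject₁; join-splitAt)
open import Data.Fin.Subset using (Subset; _∈_; Nonempty)
open import Data.Integer.Base using (ℤ; +_; -[1+_])
open import Data.Nat.Base as ℕ using (ℕ)
import Data.Nat.Properties as ℕ
open import Data.Product using (Σ; ∃-syntax; _×_; _,_; proj₁; proj₂)
open import Data.Rational as ℚ using (ℚ; 0ℚ; 1ℚ; ½)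
import Data.Rational.Properties as ℚ
open import Data.Sum using (_⊎_; inj₁; inj₂; [_,_]′)
open import Function using (_∘_; _⇔_; Injective)
open import Level using (0ℓ)
open import Relation.Binary.Construct.Closure.Equivalence using (EqClosure)
open import Relation.Binary.PropositionalEquality
open import Relation.Nullary using (¬_; contradiction)

Eventually : (ℕ → Set) → Set
Eventually P = ∃[ N ] ∀ n → N ℕ.≤ n → P n

IsCauchy : (ℕ → ℚ) → Set
IsCauchy f = ∀ ε → 0ℚ ℚ.< ε →
  ∃[ N ] ∀ m n → N ℕ.≤ m → N ℕ.≤ n → ℚ.∣ f m ℚ.- f n ∣ ℚ.< ε

record ℝ : Set where
  constructor cauchy
  field
    seq      : ℕ → ℚ
    isCauchy : IsCauchy seq

open ℝ public

infix  4 _≈_ _<_ _≤_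
infixl 6 _+_ _-_
infixl 7 _*_
infix  8 -_

_≈_ : ℝ → ℝ → Set
x ≈ y = ∀ ε → 0ℚ ℚ.< ε → Eventually λ n → ℚ.∣ seq x n ℚ.- seq y n ∣ ℚ.< ε

_<_ : ℝ → ℝ → Set
x < y = ∃[ ε ] 0ℚ ℚ.< ε × Eventually λ n → seq x n ℚ.+ ε ℚ.≤ seq y n

_≤_ : ℝ → ℝ → Set
x ≤ y = ∀ ε → 0ℚ ℚ.< ε → Eventually λ n → seq x n ℚ.≤ seq y n ℚ.+ ε

fromℚ : ℚ → ℝ
fromℚ q = cauchy (λ _ → q) λ ε ε>0 → 0 , λ _ _ _ _ →
  subst (ℚ._< ε) (sym (cong ℚ.∣_∣ (ℚ.+-inverseʳ q))) ε>0

0ℝ 1ℝ : ℝ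
0ℝ = fromℚ 0ℚ
1ℝ = fromℚ 1ℚ

module CauchyLemmas where
  open AbelianGroupProperties ℚ.+-0-abelianGroup using (xyx⁻¹≈y; ⁻¹-involutive)
  open CommutativeSemigroupProperties
    (CommutativeMonoid.commutativeSemigroup ℚ.+-0-commutativeMonoid)
    using (interchange)

  half>0 : ∀ {ε} → 0ℚ ℚ.< ε → 0ℚ ℚ.< ½ ℚ.* ε
  half>0 {ε} ε>0 = subst (ℚ._< ½ ℚ.* ε) (ℚ.*-zeroʳ ½) (ℚ.*-monoʳ-<-pos ½ ε>0)

  half+half : ∀ ε → ½ ℚ.* ε ℚ.+ ½ ℚ.* ε ≡ ε
  half+half ε = trans (sym (ℚ.*-distribʳ-+ ε ½ ½)) (ℚ.*-identityˡ ε)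

  +-rearrange : ∀ a b c d →
    (a ℚ.+ b) ℚ.- (c ℚ.+ d) ≡ (a ℚ.- c) ℚ.+ (b ℚ.- d)
  +-rearrange a b c d = trans
    (cong (a ℚ.+ b ℚ.+_) (ℚ.neg-distrib-+ c d))
    (interchange a b (ℚ.- c) (ℚ.- d))

  neg-rearrange : ∀ a b → (ℚ.- a) ℚ.- (ℚ.- b) ≡ ℚ.- (a ℚ.- b)
  neg-rearrange a b = sym (ℚ.neg-distrib-+ a (ℚ.- b))

  sub-flip : ∀ a b → ℚ.- (a ℚ.- b) ≡ b ℚ.- a
  sub-flip a b = begin
      ℚ.- (a ℚ.- b)          ≡⟨ ℚ.neg-distrib-+ a (ℚ.- b) ⟩
      ℚ.- a ℚ.- ℚ.- b        ≡⟨ cong (ℚ.- a ℚ.+_) (⁻¹-involutive b) ⟩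
      ℚ.- a ℚ.+ b            ≡⟨ ℚ.+-comm (ℚ.- a) b ⟩
      b ℚ.- a                ∎
    where open ≡-Reasoning

  split-difference : ∀ a b → a ≡ b ℚ.+ (a ℚ.- b)
  split-difference a b = trans (sym (xyx⁻¹≈y b a)) (ℚ.+-assoc b a (ℚ.- b))

  *-rearrange : ∀ a b c d →
    a ℚ.* b ℚ.- c ℚ.* d ≡ a ℚ.* (b ℚ.- d) ℚ.+ (a ℚ.- c) ℚ.* d
  *-rearrange a b c d = begin
      a ℚ.* b ℚ.- c ℚ.* d
        ≡⟨ cong (ℚ._- c ℚ.* d) (split-difference (a ℚ.* b) (a ℚ.* d)) ⟩
      a ℚ.* d ℚ.+ (a ℚ.* b ℚ.- a ℚ.* d) ℚ.- c ℚ.* d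
        ≡⟨ cong (ℚ._- c ℚ.* d) (ℚ.+-comm (a ℚ.* d) (a ℚ.* b ℚ.- a ℚ.* d)) ⟩
      a ℚ.* b ℚ.- a ℚ.* d ℚ.+ a ℚ.* d ℚ.- c ℚ.* d
        ≡⟨ ℚ.+-assoc (a ℚ.* b ℚ.- a ℚ.* d) (a ℚ.* d) (ℚ.- (c ℚ.* d)) ⟩
      (a ℚ.* b ℚ.- a ℚ.* d) ℚ.+ (a ℚ.* d ℚ.- c ℚ.* d)
        ≡⟨ cong₂ (λ p q → (a ℚ.* b ℚ.+ p) ℚ.+ (a ℚ.* d ℚ.+ q))
                 (ℚ.neg-distribʳ-* a d) (ℚ.neg-distribˡ-* c d) ⟩
      (a ℚ.* b ℚ.+ a ℚ.* (ℚ.- d)) ℚ.+ (a ℚ.* d ℚ.+ (ℚ.- c) ℚ.* d)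
        ≡⟨ cong₂ ℚ._+_ (ℚ.*-distribˡ-+ a b (ℚ.- d)) (ℚ.*-distribʳ-+ d a (ℚ.- c)) ⟨
      a ℚ.* (b ℚ.- d) ℚ.+ (a ℚ.- c) ℚ.* d ∎
    where open ≡-Reasoning

  abs-sub : ∀ a b → ℚ.∣ a ∣ ℚ.- ℚ.∣ b ∣ ℚ.≤ ℚ.∣ a ℚ.- b ∣
  abs-sub a b = begin
      ℚ.∣ a ∣ ℚ.- ℚ.∣ b ∣
        ≡⟨ cong (λ z → ℚ.∣ z ∣ ℚ.- ℚ.∣ b ∣) (split-difference a b) ⟩
      ℚ.∣ b ℚ.+ (a ℚ.- b) ∣ ℚ.- ℚ.∣ b ∣
        ≤⟨ ℚ.+-monoˡ-≤ (ℚ.- ℚ.∣ b ∣) (ℚ.∣p+q∣≤∣p∣+∣q∣ b (a ℚ.- b)) ⟩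
      ℚ.∣ b ∣ ℚ.+ ℚ.∣ a ℚ.- b ∣ ℚ.- ℚ.∣ b ∣
        ≡⟨ xyx⁻¹≈y ℚ.∣ b ∣ ℚ.∣ a ℚ.- b ∣ ⟩
      ℚ.∣ a ℚ.- b ∣ ∎
    where open ℚ.≤-Reasoning

  abs-difference : ∀ a b → ℚ.∣ ℚ.∣ a ∣ ℚ.- ℚ.∣ b ∣ ∣ ℚ.≤ ℚ.∣ a ℚ.- b ∣
  abs-difference a b with ℚ.∣p∣≡p∨∣p∣≡-p (ℚ.∣ a ∣ ℚ.- ℚ.∣ b ∣)
  ... | inj₁ eq = subst (ℚ._≤ ℚ.∣ a ℚ.- b ∣) (sym eq) (abs-sub a b)
  ... | inj₂ eq = begin
      ℚ.∣ ℚ.∣ a ∣ ℚ.- ℚ.∣ b ∣ ∣     ≡⟨ eq ⟩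
      ℚ.- (ℚ.∣ a ∣ ℚ.- ℚ.∣ b ∣)     ≡⟨ sub-flip ℚ.∣ a ∣ ℚ.∣ b ∣ ⟩
      ℚ.∣ b ∣ ℚ.- ℚ.∣ a ∣           ≤⟨ abs-sub b a ⟩
      ℚ.∣ b ℚ.- a ∣                 ≡⟨ cong ℚ.∣_∣ (sub-flip a b) ⟨
      ℚ.∣ ℚ.- (a ℚ.- b) ∣           ≡⟨ ℚ.∣-p∣≡∣p∣ (a ℚ.- b) ⟩
      ℚ.∣ a ℚ.- b ∣ ∎
    where open ℚ.≤-Reasoning

  eventually-bounded : (x : ℝ) → ∃[ B ] 0ℚ ℚ.< B ×
    Eventually λ n → ℚ.∣ seq x n ∣ ℚ.≤ B
  eventually-bounded (cauchy f c) with c 1ℚ (ℚ.positive⁻¹ 1ℚ)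
  ... | N , close = ℚ.∣ f N ∣ ℚ.+ 1ℚ
      , ℚ.+-mono-≤-< (ℚ.0≤∣p∣ (f N)) (ℚ.positive⁻¹ 1ℚ)
      , N , bound
    where
    open ℚ.≤-Reasoning
    bound : ∀ n → N ℕ.≤ n → ℚ.∣ f n ∣ ℚ.≤ ℚ.∣ f N ∣ ℚ.+ 1ℚ
    bound n N≤n = begin
      ℚ.∣ f n ∣                          ≡⟨ cong ℚ.∣_∣ (split-difference (f n) (f N)) ⟩
      ℚ.∣ f N ℚ.+ (f n ℚ.- f N) ∣        ≤⟨ ℚ.∣p+q∣≤∣p∣+∣q∣ (f N) (f n ℚ.- f N) ⟩
      ℚ.∣ f N ∣ ℚ.+ ℚ.∣ f n ℚ.- f N ∣
        ≤⟨ ℚ.+-monoʳ-≤ ℚ.∣ f N ∣ (ℚ.<⇒≤ (close n N N≤n ℕ.≤-refl)) ⟩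
      ℚ.∣ f N ∣ ℚ.+ 1ℚ ∎

  divide : ∀ B ε → 0ℚ ℚ.< B → 0ℚ ℚ.< ε → ∃[ δ ] 0ℚ ℚ.< δ × B ℚ.* δ ≡ ε
  divide B ε B>0 ε>0 = B⁻¹ ℚ.* ε , δ>0 , (begin
      B ℚ.* (B⁻¹ ℚ.* ε)  ≡⟨ ℚ.*-assoc B B⁻¹ ε ⟨
      B ℚ.* B⁻¹ ℚ.* ε    ≡⟨ cong (ℚ._* ε) (ℚ.*-inverseʳ B) ⟩
      1ℚ ℚ.* ε           ≡⟨ ℚ.*-identityˡ ε ⟩
      ε                  ∎)
    where
    open ≡-Reasoning
    instance
      B-pos : ℚ.Positive B
      B-pos = ℚ.positive B>0
      B-nonZero : ℚ.NonZero B
      B-nonZero = ℚ.pos⇒nonZero B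
    B⁻¹ : ℚ
    B⁻¹ = ℚ.1/ B
    δ>0 : 0ℚ ℚ.< B⁻¹ ℚ.* ε
    δ>0 = subst (ℚ._< B⁻¹ ℚ.* ε) (ℚ.*-zeroʳ B⁻¹)
      (ℚ.*-monoʳ-<-pos B⁻¹ {{ℚ.1/pos⇒pos B}} ε>0)

  *-mono-abs : ∀ p q {B δ} → ℚ.∣ p ∣ ℚ.≤ B → ℚ.∣ q ∣ ℚ.< δ → 0ℚ ℚ.< B →
               ℚ.∣ p ℚ.* q ∣ ℚ.< B ℚ.* δ
  *-mono-abs p q {B} {δ} p≤B q<δ B>0 = begin-strict
      ℚ.∣ p ℚ.* q ∣           ≡⟨ ℚ.∣p*q∣≡∣p∣*∣q∣ p q ⟩
      ℚ.∣ p ∣ ℚ.* ℚ.∣ q ∣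
        ≤⟨ ℚ.*-monoʳ-≤-nonNeg ℚ.∣ q ∣ {{ℚ.nonNegative (ℚ.0≤∣p∣ q)}} p≤B ⟩
      B ℚ.* ℚ.∣ q ∣           <⟨ ℚ.*-monoʳ-<-pos B {{ℚ.positive B>0}} q<δ ⟩
      B ℚ.* δ ∎
    where open ℚ.≤-Reasoning

  +-isCauchy : ∀ x y → IsCauchy λ n → seq x n ℚ.+ seq y n
  +-isCauchy (cauchy f cf) (cauchy g cg) ε ε>0
    with cf (½ ℚ.* ε) (half>0 ε>0) | cg (½ ℚ.* ε) (half>0 ε>0)
  ... | M , closeF | N , closeG = M ℕ.⊔ N , λ m n ≤m ≤n → begin-strict
      ℚ.∣ (f m ℚ.+ g m) ℚ.- (f n ℚ.+ g n) ∣
        ≡⟨ cong ℚ.∣_∣ (+-rearrange (f m) (g m) (f n) (g n)) ⟩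
      ℚ.∣ (f m ℚ.- f n) ℚ.+ (g m ℚ.- g n) ∣
        ≤⟨ ℚ.∣p+q∣≤∣p∣+∣q∣ (f m ℚ.- f n) (g m ℚ.- g n) ⟩
      ℚ.∣ f m ℚ.- f n ∣ ℚ.+ ℚ.∣ g m ℚ.- g n ∣
        <⟨ ℚ.+-mono-< (closeF m n (ℕ.m⊔n≤o⇒m≤o M N ≤m) (ℕ.m⊔n≤o⇒m≤o M N ≤n))
                      (closeG m n (ℕ.m⊔n≤o⇒n≤o M N ≤m) (ℕ.m⊔n≤o⇒n≤o M N ≤n)) ⟩
      ½ ℚ.* ε ℚ.+ ½ ℚ.* ε
        ≡⟨ half+half ε ⟩
      ε ∎
    where open ℚ.≤-Reasoning

  neg-isCauchy : ∀ x → IsCauchy λ n → ℚ.- seq x n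
  neg-isCauchy (cauchy f cf) ε ε>0 with cf ε ε>0
  ... | N , close = N , λ m n ≤m ≤n → subst (ℚ._< ε)
    (sym (trans (cong ℚ.∣_∣ (neg-rearrange (f m) (f n))) (ℚ.∣-p∣≡∣p∣ (f m ℚ.- f n))))
    (close m n ≤m ≤n)

  *-isCauchy : ∀ x y → IsCauchy λ n → seq x n ℚ.* seq y n
  *-isCauchy x@(cauchy f cf) y@(cauchy g cg) ε ε>0
    with eventually-bounded x | eventually-bounded y
  ... | B , B>0 , K , boundF | C , C>0 , L , boundG
    with divide B (½ ℚ.* ε) B>0 (half>0 ε>0) | divide C (½ ℚ.* ε) C>0 (half>0 ε>0)
  ... | δ , δ>0 , Bδ | γ , γ>0 , Cγ with cg δ δ>0 | cf γ γ>0
  ... | M , closeG | N , closeF = (K ℕ.⊔ L) ℕ.⊔ (M ℕ.⊔ N) , λ m n ≤m ≤n →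
    let
      KL≤n = ℕ.m⊔n≤o⇒m≤o (K ℕ.⊔ L) (M ℕ.⊔ N) ≤n
      KL≤m = ℕ.m⊔n≤o⇒m≤o (K ℕ.⊔ L) (M ℕ.⊔ N) ≤m
      MN≤n = ℕ.m⊔n≤o⇒n≤o (K ℕ.⊔ L) (M ℕ.⊔ N) ≤n
      MN≤m = ℕ.m⊔n≤o⇒n≤o (K ℕ.⊔ L) (M ℕ.⊔ N) ≤m
    in begin-strict
      ℚ.∣ f m ℚ.* g m ℚ.- f n ℚ.* g n ∣
        ≡⟨ cong ℚ.∣_∣ (*-rearrange (f m) (g m) (f n) (g n)) ⟩
      ℚ.∣ f m ℚ.* (g m ℚ.- g n) ℚ.+ (f m ℚ.- f n) ℚ.* g n ∣
        ≤⟨ ℚ.∣p+q∣≤∣p∣+∣q∣ (f m ℚ.* (g m ℚ.- g n)) ((f m ℚ.- f n) ℚ.* g n) ⟩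
      ℚ.∣ f m ℚ.* (g m ℚ.- g n) ∣ ℚ.+ ℚ.∣ (f m ℚ.- f n) ℚ.* g n ∣
        ≡⟨ cong (λ z → ℚ.∣ f m ℚ.* (g m ℚ.- g n) ∣ ℚ.+ ℚ.∣ z ∣)
                (ℚ.*-comm (f m ℚ.- f n) (g n)) ⟩
      ℚ.∣ f m ℚ.* (g m ℚ.- g n) ∣ ℚ.+ ℚ.∣ g n ℚ.* (f m ℚ.- f n) ∣
        <⟨ ℚ.+-mono-<
             (*-mono-abs (f m) (g m ℚ.- g n) (boundF m (ℕ.m⊔n≤o⇒m≤o K L KL≤m))
               (closeG m n (ℕ.m⊔n≤o⇒m≤o M N MN≤m) (ℕ.m⊔n≤o⇒m≤o M N MN≤n)) B>0)
             (*-mono-abs (g n) (f m ℚ.- f n) (boundG n (ℕ.m⊔n≤o⇒n≤o K L KL≤n))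
               (closeF m n (ℕ.m⊔n≤o⇒n≤o M N MN≤m) (ℕ.m⊔n≤o⇒n≤o M N MN≤n)) C>0) ⟩
      B ℚ.* δ ℚ.+ C ℚ.* γ
        ≡⟨ cong₂ ℚ._+_ Bδ Cγ ⟩
      ½ ℚ.* ε ℚ.+ ½ ℚ.* ε
        ≡⟨ half+half ε ⟩
      ε ∎
    where open ℚ.≤-Reasoning

  abs-isCauchy : ∀ x → IsCauchy λ n → ℚ.∣ seq x n ∣
  abs-isCauchy (cauchy f cf) ε ε>0 with cf ε ε>0
  ... | N , close = N , λ m n ≤m ≤n →
    ℚ.≤-<-trans (abs-difference (f m) (f n)) (close m n ≤m ≤n)

open CauchyLemmas

_+_ : ℝ → ℝ → ℝ
x + y = cauchy (λ n → seq x n ℚ.+ seq y n) (+-isCauchy x y)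

_*_ : ℝ → ℝ → ℝ
x * y = cauchy (λ n → seq x n ℚ.* seq y n) (*-isCauchy x y)

-_ : ℝ → ℝ
- x = cauchy (λ n → ℚ.- seq x n) (neg-isCauchy x)

_-_ : ℝ → ℝ → ℝ
x - y = x + (- y)

∣_∣ : ℝ → ℝ
∣ x ∣ = cauchy (λ n → ℚ.∣ seq x n ∣) (abs-isCauchy x)

+-0-rawMonoid : RawMonoid 0ℓ 0ℓ
+-0-rawMonoid = record { Carrier = ℝ ; _≈_ = _≈_ ; _∙_ = _+_ ; ε = 0ℝ }

open RawMonoidDefinitions +-0-rawMonoid public using (sum)

record Space : Set₁ where
  field
    dim : ℕ
    _∋_ : (Fin dim → ℝ) → Set

  Point : Set
  Point = Σ (Fin dim → ℝ) _∋_

  coord : Point → Fin dim → ℝ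
  coord = proj₁

  infix 4 _≋_
  _≋_ : Point → Point → Set
  p ≋ q = ∀ i → coord p i ≈ coord q i

  -- Sup-distance less than δ; this metric induces the Euclidean topology.
  Near : ℚ → Point → Point → Set
  Near δ p q = ∀ i → ∣ coord p i - coord q i ∣ < fromℚ δ

open Space using (Point; Near)

-- Points that agree up to _≋_ are within every δ of each other, so a
-- continuous map automatically respects _≋_ (and in particular ignores the
-- proof of membership carried by a point).
Continuous : (X Y : Space) → (Point X → Point Y) → Set
Continuous X Y f = ∀ p ε → 0ℚ ℚ.< ε →
  ∃[ δ ] 0ℚ ℚ.< δ × (∀ q → Near X δ p q → Near Y ε (f p) (f q))

Interval : Set
Interval = Σ ℝ λ t → 0ℝ ≤ t × t ≤ 1ℝ

-- Continuity on X × [0,1] with the product topology.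
JointlyContinuous : (X Y : Space) → (Point X → Interval → Point Y) → Set
JointlyContinuous X Y H = ∀ p s ε → 0ℚ ℚ.< ε →
  ∃[ δ ] 0ℚ ℚ.< δ × (∀ q t → Near X δ p q → ∣ proj₁ s - proj₁ t ∣ < fromℚ δ →
                      Near Y ε (H p s) (H q t))

record Homotopy (X Y : Space) (f g : Point X → Point Y) : Set where
  open Space Y using (_≋_)
  field
    map        : Point X → Interval → Point Y
    continuous : JointlyContinuous X Y map
    at-0       : ∀ p t → proj₁ t ≈ 0ℝ → map p t ≋ f p
    at-1       : ∀ p t → proj₁ t ≈ 1ℝ → map p t ≋ g p

infix 4 _≃_
record _≃_ (X Y : Space) : Set where
  field
    to              : Point X → Point Y
    from            : Point Y → Point X
    to-continuous   : Continuous X Y to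
    from-continuous : Continuous Y X from
    from∘to         : Homotopy X X (from ∘ to) (λ p → p)
    to∘from         : Homotopy Y Y (to ∘ from) (λ p → p)

-- The unit sphere of ℝ^k.
unitSphere : ℕ → Space
unitSphere k = record
  { dim = k
  ; _∋_ = λ x → sum (λ i → x i * x i) ≈ 1ℝ
  }

-- S^d is the unit sphere of ℝ^(d+1).  At d = -1 this is empty, an empty sum
-- not being 1; dimensions below -1 are given the same value.
Sphere : ℤ → Space
Sphere (+ d)    = unitSphere (ℕ.suc d)
Sphere -[1+ _ ] = unitSphere 0

IsSupport : ∀ {m} → Subset m → (Fin m → ℝ) → Set
IsSupport A t = ∀ i → i ∈ A ⇔ 0ℝ < t i

-- Barycentric coordinates on the vertex set Fin m, where K is the family of
-- simplices of the complex.  The complex is finite, so the subspace topology is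
-- the usual one.  Since 0 < t i is not decidable, "the support
-- of t is a simplex" is phrased for any A that is the support of t; such an A
-- is unique, and classically always exists.
∣_∣ᴳ : ∀ {m} → (Subset m → Set) → Space
∣_∣ᴳ {m} K = record
  { dim = m
  ; _∋_ = λ t → (∀ i → 0ℝ ≤ t i) × sum t ≈ 1ℝ × (∀ A → IsSupport A t → K A)
  }

record Digraph : Set where
  field
    order size    : ℕ
    source target : Fin size → Fin order
    simple        : ∀ e f → source e ≡ source f → target e ≡ target f → e ≡ f

  Vertex Edge : Set
  Vertex = Fin order
  Edge   = Fin size

module _ (G : Digraph) where
  open Digraph G

  record SimplePath : Set where
    field
      len-1      : ℕ
      edge       : Fin (ℕ.suc len-1) → Edge
      composable : ∀ i → source (edge (suc i)) ≡ target (edge (inject₁ i))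
      source-inj : Injective _≡_ _≡_ (source ∘ edge)
      target-inj : Injective _≡_ _≡_ (target ∘ edge)
      not-cycle  : source (edge zero) ≢ target (edge (fromℕ len-1))

    HasEdge : Edge → Set
    HasEdge e = ∃[ i ] edge i ≡ e

    HasVertex : Vertex → Set
    HasVertex v = ∃[ i ] (source (edge i) ≡ v ⊎ target (edge i) ≡ v)

  -- A set A of edges stands for the spanning subgraph with edge set A.
  module _ (A : Subset size) where

    Adjacent : Vertex → Vertex → Set
    Adjacent v w = ∃[ e ] e ∈ A × source e ≡ v × target e ≡ w

    Connected : Vertex → Vertex → Set
    Connected = EqClosure Adjacent

    -- Edges of the component of v; its vertices are those w with Connected v w.
    ComponentEdge : Vertex → Edge → Set
    ComponentEdge v e = e ∈ A × Connected v (source e)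

    ComponentIsVertex : Vertex → Set
    ComponentIsVertex v = (∀ w → Connected v w → w ≡ v) × (∀ e → ¬ ComponentEdge v e)

    ComponentIsSimplePath : Vertex → Set
    ComponentIsSimplePath v = ∃[ p ]
      (∀ w → Connected v w ⇔ SimplePath.HasVertex p w) ×
      (∀ e → ComponentEdge v e ⇔ SimplePath.HasEdge p e)

    IsMultipath : Set
    IsMultipath = ∀ v → ComponentIsVertex v ⊎ ComponentIsSimplePath v

  MultipathComplex : Subset size → Set
  MultipathComplex A = Nonempty A × IsMultipath A

-- Edges 0,…,n-1 are (v_i , v_{i+1}); edges n,…,2n-1 are (v_{i+1} , v_i).
BL : ℕ → Digraph
BL n = record
  { order  = ℕ.suc n
  ; size   = n ℕ.+ n
  ; source = src ∘ splitAt n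
  ; target = tgt ∘ splitAt n
  ; simple = λ e f s≡ t≡ → begin
      e                       ≡⟨ join-splitAt n n e ⟨
      join n n (splitAt n e)  ≡⟨ cong (join n n) (inj (splitAt n e) (splitAt n f) s≡ t≡) ⟩
      join n n (splitAt n f)  ≡⟨ join-splitAt n n f ⟩
      f                       ∎
  }
  where
  open ≡-Reasoning

  src tgt : Fin n ⊎ Fin n → Fin (ℕ.suc n)
  src = [ inject₁ , suc ]′
  tgt = [ suc , inject₁ ]′

  opposite : ∀ (i j : Fin n) → inject₁ i ≡ suc j → suc i ≢ inject₁ j
  opposite i j p q = ℕ.<-asym i<j j<i
    where
    i<j : toℕ i ℕ.< toℕ j
    i<j = ℕ.≤-reflexive (trans (cong toℕ q) (toℕ-inject₁ j))
    j<i : toℕ j ℕ.< toℕ i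
    j<i = ℕ.≤-reflexive (trans (sym (cong toℕ p)) (toℕ-inject₁ i))

  inj : ∀ x y → src x ≡ src y → tgt x ≡ tgt y → x ≡ y
  inj (inj₁ i) (inj₁ j) s≡ t≡ = cong inj₁ (suc-injective t≡)
  inj (inj₂ i) (inj₂ j) s≡ t≡ = cong inj₂ (suc-injective s≡)
  inj (inj₁ i) (inj₂ j) s≡ t≡ = contradiction t≡ (opposite i j s≡)
  inj (inj₂ i) (inj₁ j) s≡ t≡ = contradiction s≡ (opposite i j t≡)

{-# OPTIONS --safe #-}
module Submission where

-- Write a_i = (v_i , v_{i+1}) and b_i = (v_{i+1} , v_i).  An edge set is a multipath exactly when it
-- contains no a_i and b_j with |i - j| ≤ 1.  Hence the even edges a_{2j}, b_{2j} span the boundary of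
-- a cross-polytope, which is a sphere: on it, x ↦ (t (a_{2j}) , t (b_{2j})) = ((x_j)₊² , (x_j)₋²) is a
-- homeomorphism from the unit sphere.  The complex retracts onto this subcomplex by moving the mass
-- of a_{2j+1} to a_{2j} and that of b_{2j+1} to b_{2j}.  This has to be done for one j after the other:
-- a_{2j} and b_{2j-1} conflict, so before mass arrives at a_{2j} none may be left at b_{2j-1}.

open import Defs using (BL; MultipathComplex; ∣_∣ᴳ; Sphere; _≃_)
open import Data.Bool.Base using (Bool; true; false; not)
open import Data.Fin using (Fin; zero; suc; toℕ; fromℕ<; splitAt; _↑ˡ_; _↑ʳ_)
open import Data.Fin.Properties using (toℕ<n; toℕ-fromℕ<; splitAt-↑ˡ; splitAt-↑ʳ)
open import Data.Fin.Subset using (Subset; _∈_; Nonempty)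
open import Data.Nat.Base as ℕ using (ℕ; zero; suc; s≤s; z≤n)
import Data.Nat.DivMod as ℕ
import Data.Nat.Properties as ℕ
open import Data.Product using (Σ; ∃-syntax; _×_; _,_; proj₁; proj₂)
open import Data.Sum using (_⊎_; inj₁; inj₂; [_,_]′)
open import Function using (_∘_; mk⇔; Equivalence)
open import Relation.Binary.Definitions using (tri<; tri≈; tri>)
open import Relation.Binary.PropositionalEquality
open import Relation.Nullary using (¬_; Dec; yes; no; does; contradiction)

-- The reals are Cauchy sequences whose order is undecidable, so no map can be defined by cases on a
-- sign, and the support of a point cannot be computed. Every map is therefore a closed formula in
-- `pos`, `∣_∣` and `sqrt`, and its continuity follows from closure rules. On the other hand `_≤_`,
-- `_≈_` and the relation of not being both positive are stable under double negation, so case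
-- distinctions, and even the support of a point, are available when proving them. The order in
-- which the blocks fold is carried by a single formula: at time `s` at most max (k (1 - s) - j, 0)
-- of the mass at 2j+1 has moved. Consecutive thresholds differ by 1 and no mass exceeds 1, so a
-- block starts to move only when the previous one is done. Time 0 is the folded end and time 1 the
-- identity. Coordinates are indexed by ℕ and vanish from n on. This treats both parities of n
-- alike, although for odd n the last block has an even edge but no odd one.

module Combinatorics where
  open import Defs using (Digraph; SimplePath; Connected; ComponentEdge; ComponentIsVertex;
    ComponentIsSimplePath; IsMultipath)
  import Data.Bool as Bool
  open import Data.Bool.Properties using (¬-not)
  open import Data.Fin using (fromℕ; inject₁; opposite)
  open import Data.Fin.Properties using (toℕ-injective; toℕ-inject₁; toℕ-fromℕ; toℕ≤pred[n];
    splitAt⁻¹-↑ˡ; splitAt⁻¹-↑ʳ; opposite-prop; opposite-involutive; any?)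
  open import Data.Fin.Relation.Unary.Top using (view; ‵fromℕ; ‵inject₁)
  open import Data.Fin.Subset.Properties using (_∈?_)
  open import Data.Nat.Base using (_+_; _∸_; _≤_; _<_)
  import Relation.Binary.Construct.Closure.Equivalence as EqClosure
  open import Relation.Binary.Construct.Closure.ReflexiveTransitive using (ε; _◅_; _◅◅_)
  open import Relation.Binary.Construct.Closure.Symmetric using (fwd; bwd)
  open import Relation.Nullary.Decidable using (_×-dec_)

  -- Edge pairs that a multipath excludes

  Close : ℕ → ℕ → Set
  Close i j = i ≤ suc j × j ≤ suc i

  module _ (G : Digraph) where
    open Digraph G

    module _ (p : SimplePath G) where
      open SimplePath p

      -- If `j` is a successor, target injectivity identifies `i` with its predecessor. If `j` is
      -- `zero`, a last `i` would close a cycle, and after any other `i` the next edge would have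
      -- the same source as the first one.
      consecutive : ∀ i j → target (edge i) ≡ source (edge j) → toℕ j ≡ suc (toℕ i)
      consecutive i (suc j) eq = cong suc (trans (sym (toℕ-inject₁ j))
        (cong toℕ (sym (target-inj (trans eq (composable j))))))
      consecutive i zero eq with view i
      ... | ‵fromℕ    = contradiction (sym eq) not-cycle
      ... | ‵inject₁ k = contradiction (source-inj (trans (composable k) eq)) λ ()

      no-2-cycle-in-path : ∀ i j → target (edge i) ≡ source (edge j) → target (edge j) ≢ source (edge i)
      no-2-cycle-in-path i j p q =
        ℕ.<-asym (ℕ.≤-reflexive (sym (consecutive i j p))) (ℕ.≤-reflexive (sym (consecutive j i q)))

    module _ (A : Subset size) (multipath : IsMultipath G A) where

      -- Injectivity of sources and targets is known only along one path. The component of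
      -- `source e` contains the edge `e`, so it is not a single vertex, and the path that it is
      -- contains `f` as well.
      common-path : ∀ {e f} → e ∈ A → f ∈ A → Connected G A (source e) (source f) →
        Σ (SimplePath G) λ p → SimplePath.HasEdge p e × SimplePath.HasEdge p f
      common-path {e} {f} e∈A f∈A c with multipath (source e)
      ... | inj₁ (_ , none)      = contradiction (e∈A , ε) (none e)
      ... | inj₂ (p , _ , edges) =
        p , Equivalence.to (edges e) (e∈A , ε) , Equivalence.to (edges f) (f∈A , c)

      source-unique : ∀ {e f} → e ∈ A → f ∈ A → source e ≡ source f → e ≡ f
      source-unique {e} e∈A f∈A eq with common-path e∈A f∈A (subst (Connected G A (source e)) eq ε)
      ... | p , (i , refl) , (j , refl) = cong (SimplePath.edge p) (SimplePath.source-inj p eq)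

      target-unique : ∀ {e f} → e ∈ A → f ∈ A → target e ≡ target f → e ≡ f
      target-unique {e} {f} e∈A f∈A eq
        with common-path e∈A f∈A (fwd (e , e∈A , refl , refl) ◅ bwd (f , f∈A , refl , sym eq) ◅ ε)
      ... | p , (i , refl) , (j , refl) = cong (SimplePath.edge p) (SimplePath.target-inj p eq)

      no-2-cycle : ∀ {e f} → e ∈ A → f ∈ A → target e ≡ source f → target f ≢ source e
      no-2-cycle {e} {f} e∈A f∈A p q
        with common-path e∈A f∈A (fwd (e , e∈A , refl , p) ◅ ε)
      ... | path , (i , refl) , (j , refl) = no-2-cycle-in-path path i j p q

  module BidirectionalLinear (n : ℕ) where
    open Digraph (BL n)

    -- The edges of BL n of index i: (v_i , v_{i+1}) for true, (v_{i+1} , v_i) for false.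
    edgeOf : Bool → Fin n → Edge
    edgeOf true  i = i ↑ˡ n
    edgeOf false i = n ↑ʳ i

    -- An edge of index `m` joins positions `m` and `m + 1`. Reversing the direction swaps tail and
    -- head, which lets later arguments treat both directions at once.
    tailPosition headPosition : Bool → ℕ → ℕ
    tailPosition true  m = m
    tailPosition false m = suc m
    headPosition b m = tailPosition (not b) m

    toℕ-source : ∀ b i → toℕ (source (edgeOf b i)) ≡ tailPosition b (toℕ i)
    toℕ-source true  i = trans (cong (toℕ ∘ [ inject₁ , suc ]′) (splitAt-↑ˡ n i n)) (toℕ-inject₁ i)
    toℕ-source false i = cong (toℕ ∘ [ inject₁ , suc ]′) (splitAt-↑ʳ n n i)

    toℕ-target : ∀ b i → toℕ (target (edgeOf b i)) ≡ headPosition b (toℕ i)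
    toℕ-target true  i = cong (toℕ ∘ [ suc , inject₁ ]′) (splitAt-↑ˡ n i n)
    toℕ-target false i = trans (cong (toℕ ∘ [ suc , inject₁ ]′) (splitAt-↑ʳ n n i)) (toℕ-inject₁ i)

    edgeOf-surjective : ∀ e → ∃[ b ] ∃[ i ] edgeOf b i ≡ e
    edgeOf-surjective e with splitAt n e in eq
    ... | inj₁ i = true  , i , splitAt⁻¹-↑ˡ eq
    ... | inj₂ i = false , i , splitAt⁻¹-↑ʳ eq

    forward≢backward : ∀ i j → edgeOf true i ≢ edgeOf false j
    forward≢backward i j eq with trans (sym (splitAt-↑ˡ n i n)) (trans (cong (splitAt n) eq) (splitAt-↑ʳ n n j))
    ... | ()

    ConflictFree : Subset size → Set
    ConflictFree A = ∀ i j → edgeOf true i ∈ A → edgeOf false j ∈ A → ¬ Close (toℕ i) (toℕ j)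

    -- Indices with j = i + 1 give a common target, i = j + 1 a common source, and i = j a 2-cycle.
    multipath⇒conflictFree : ∀ A → IsMultipath (BL n) A → ConflictFree A
    multipath⇒conflictFree A multipath i j i∈A j∈A (i≤1+j , j≤1+i) with ℕ.<-cmp (toℕ i) (toℕ j)
    ... | tri< i<j _ _ = forward≢backward i j (target-unique (BL n) A multipath i∈A j∈A
            (toℕ-injective (trans (toℕ-target true i)
              (trans (ℕ.≤-antisym i<j j≤1+i) (sym (toℕ-target false j))))))
    ... | tri> _ _ j<i = forward≢backward i j (source-unique (BL n) A multipath i∈A j∈A
            (toℕ-injective (trans (toℕ-source true i)
              (trans (ℕ.≤-antisym i≤1+j j<i) (sym (toℕ-source false j))))))
    ... | tri≈ _ i≡j _ = no-2-cycle (BL n) A multipath i∈A j∈A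
            (toℕ-injective (trans (toℕ-target true i) (trans (cong suc i≡j) (sym (toℕ-source false j)))))
            (toℕ-injective (trans (toℕ-target false j) (trans (sym i≡j) (sym (toℕ-source true i)))))

  -- Maximal runs of a decidable predicate on ℕ

  record Run (M : ℕ → Set) (p : ℕ) : Set where
    field
      -- In the application `p` is a vertex and `M m` speaks of the edge between `m` and `m + 1`.
      -- The run then has the edges from `left` to `right` - 1 and the vertices from `left` to
      -- `right`; it has no edge exactly when both ends equal `p`.
      left right : ℕ
      left≤      : left ≤ p
      ≤right     : p ≤ right
      inside     : ∀ m → left ≤ m → m < right → M m
      no-left    : ∀ m → suc m ≡ left → ¬ M m
      no-right   : ¬ M right

  module _ {M : ℕ → Set} (M? : ∀ m → Dec (M m)) where

    extendLeft : ∀ p → ∃[ l ] l ≤ p × (∀ m → l ≤ m → m < p → M m) × (∀ m → suc m ≡ l → ¬ M m)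
    extendLeft zero = zero , z≤n , (λ _ _ ()) , λ _ ()
    extendLeft (suc p) with M? p
    ... | no ¬Mp = suc p , ℕ.≤-refl , (λ m p<m m<1+p → contradiction m<1+p (ℕ.<⇒≱ (s≤s p<m)))
                 , λ { _ refl → ¬Mp }
    ... | yes Mp with extendLeft p
    ... | l , l≤p , inside , end = l , ℕ.m≤n⇒m≤1+n l≤p , inside′ , end
      where
      inside′ : ∀ m → l ≤ m → m < suc p → M m
      inside′ m l≤m m<1+p with ℕ.m≤n⇒m<n∨m≡n (ℕ.≤-pred m<1+p)
      ... | inj₁ m<p  = inside m l≤m m<p
      ... | inj₂ refl = Mp

    module _ (n : ℕ) (bound : ∀ m → M m → m < n) where

      -- `k` is fuel: `n ≤ k + p` is kept throughout, and when the fuel is used up `p` has reached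
      -- the bound `n`, where `M` fails.
      extendRight : ∀ k p → n ≤ k + p → ∃[ r ] p ≤ r × (∀ m → p ≤ m → m < r → M m) × ¬ M r
      extendRight zero    p n≤p = p , ℕ.≤-refl , (λ m p≤m m<p → contradiction m<p (ℕ.≤⇒≯ p≤m))
                                    , λ Mp → ℕ.<⇒≱ (bound p Mp) n≤p
      extendRight (suc k) p n≤ with M? p
      ... | no ¬Mp = p , ℕ.≤-refl , (λ m p≤m m<p → contradiction m<p (ℕ.≤⇒≯ p≤m)) , ¬Mp
      ... | yes Mp with extendRight k (suc p) (subst (n ≤_) (sym (ℕ.+-suc k p)) n≤)
      ... | r , p<r , inside , end = r , ℕ.<⇒≤ p<r , inside′ , end
        where
        inside′ : ∀ m → p ≤ m → m < r → M m
        inside′ m p≤m m<r with ℕ.m≤n⇒m<n∨m≡n p≤m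
        ... | inj₁ p<m  = inside m p<m m<r
        ... | inj₂ refl = Mp

      run : ∀ p → Run M p
      run p =
        let l , l≤p , insideL , noL = extendLeft p
            r , p≤r , insideR , noR = extendRight n p (ℕ.m≤m+n n p)
        in record
          { left = l ; right = r ; left≤ = l≤p ; ≤right = p≤r
          ; inside = λ m l≤m m<r → [ insideL m l≤m , (λ p≤m → insideR m p≤m m<r) ]′ (ℕ.<-≤-connex m p)
          ; no-left = noL ; no-right = noR }

  -- Components of a conflict-free edge set

  module Components (n : ℕ) (A : Subset (n + n)) (free : BidirectionalLinear.ConflictFree n A) where
    open Digraph (BL n)
    open BidirectionalLinear n

    Has : Bool → ℕ → Set
    Has b m = ∃[ i ] toℕ i ≡ m × edgeOf b i ∈ A

    has? : ∀ b m → Dec (Has b m)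
    has? b m = any? λ i → (toℕ i ℕ.≟ m) ×-dec (edgeOf b i ∈? A)

    has-bound : ∀ b m → Has b m → m < n
    has-bound b _ (i , refl , _) = toℕ<n i

    has-free : ∀ b {m m′} → Has b m → Has (not b) m′ → m ≤ suc m′ → m′ ≤ suc m → ∀ {X : Set} → X
    has-free true  (i , refl , i∈A) (j , refl , j∈A) p q = contradiction (p , q) (free i j i∈A j∈A)
    has-free false (i , refl , i∈A) (j , refl , j∈A) p q = contradiction (q , p) (free j i j∈A i∈A)

    -- Edges of either direction join neighbouring positions and `Connected` ignores orientation, so
    -- a `Q` that is closed under both steps spreads over a whole component.
    invariant : (Q : ℕ → Set) → (∀ b m → Has b m → Q m → Q (suc m)) → (∀ b m → Has b m → Q (suc m) → Q m) →
      ∀ {v w} → Connected (BL n) A v w → Q (toℕ v) → Q (toℕ w)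
    invariant Q up down = go
      where
      along : ∀ b i → edgeOf b i ∈ A →
        (Q (toℕ (source (edgeOf b i))) → Q (toℕ (target (edgeOf b i)))) ×
        (Q (toℕ (target (edgeOf b i))) → Q (toℕ (source (edgeOf b i))))
      along true i i∈A rewrite toℕ-source true i | toℕ-target true i =
        up true (toℕ i) (i , refl , i∈A) , down true (toℕ i) (i , refl , i∈A)
      along false i i∈A rewrite toℕ-source false i | toℕ-target false i =
        down false (toℕ i) (i , refl , i∈A) , up false (toℕ i) (i , refl , i∈A)

      go : ∀ {v w} → Connected (BL n) A v w → Q (toℕ v) → Q (toℕ w)
      go ε q = q
      go (fwd (e , e∈A , refl , refl) ◅ c) q with edgeOf-surjective e
      ... | b , i , refl = go c (proj₁ (along b i e∈A) q)
      go (bwd (e , e∈A , refl , refl) ◅ c) q with edgeOf-surjective e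
      ... | b , i , refl = go c (proj₂ (along b i e∈A) q)

    isolated : ∀ v → (∀ b → ¬ Has b (toℕ v)) → (∀ b m → suc m ≡ toℕ v → ¬ Has b m) →
      ComponentIsVertex (BL n) A v
    isolated v none-right none-left = only , none
      where
      only : ∀ w → Connected (BL n) A v w → w ≡ v
      only w c = toℕ-injective (invariant (_≡ toℕ v)
        (λ { b m h refl → contradiction h (none-right b) })
        (λ b m h eq → contradiction h (none-left b m eq)) c refl)

      none : ∀ e → ¬ ComponentEdge (BL n) A v e
      none e (e∈A , c) with edgeOf-surjective e
      ... | true  , i , refl = none-right true (i , trans (sym (toℕ-source true i)) (cong toℕ (only _ c)) , e∈A)
      ... | false , i , refl = none-left false (toℕ i) (trans (sym (toℕ-source false i)) (cong toℕ (only _ c))) (i , refl , e∈A)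

    link : ∀ b {m} {v w : Vertex} → Has b m → toℕ v ≡ m → toℕ w ≡ suc m → Connected (BL n) A v w
    link true (i , refl , i∈A) v≡ w≡ = fwd (edgeOf true i , i∈A ,
      toℕ-injective (trans (toℕ-source true i) (sym v≡)) , toℕ-injective (trans (toℕ-target true i) (sym w≡))) ◅ ε
    link false (i , refl , i∈A) v≡ w≡ = bwd (edgeOf false i , i∈A ,
      toℕ-injective (trans (toℕ-source false i) (sym w≡)) , toℕ-injective (trans (toℕ-target false i) (sym v≡))) ◅ ε

    -- Writing the right end as `suc (l + d)` makes the run nonempty, so that its `suc d` edges can
    -- form a simple path.
    module Interval (b : Bool) (l d : ℕ)
      (inside : ∀ m → l ≤ m → m < suc (l + d) → Has b m)
      (no-left : ∀ m → suc m ≡ l → ¬ Has b m) (no-right : ¬ Has b (suc (l + d))) where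

      InRange : ℕ → Set
      InRange m = l ≤ m × m ≤ suc (l + d)

      -- Every edge meeting the interval lies in it: one of the opposite direction would conflict.
      edge-range : ∀ c m → Has c m → InRange m ⊎ InRange (suc m) → c ≡ b × l ≤ m × m < suc (l + d)
      edge-range c m h range with c Bool.≟ b
      ... | no c≢b = conflict
        where
        l≤1+m : l ≤ suc m
        l≤1+m = [ ℕ.m≤n⇒m≤1+n ∘ proj₁ , proj₁ ]′ range
        m≤r : m ≤ suc (l + d)
        m≤r = [ proj₂ , ℕ.≤-trans (ℕ.n≤1+n m) ∘ proj₂ ]′ range
        h′ : Has (not b) m
        h′ = subst (λ c → Has c m) (¬-not c≢b) h
        conflict : ∀ {X : Set} → X
        conflict with l ℕ.≤? m | m ℕ.<? suc (l + d)
        ... | yes l≤m | yes m<r = has-free b (inside m l≤m m<r) h′ (ℕ.n≤1+n m) (ℕ.n≤1+n m)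
        ... | no  l≰m | _       = has-free b (inside l ℕ.≤-refl (s≤s (ℕ.m≤m+n l d))) h′ l≤1+m
                                    (ℕ.m≤n⇒m≤1+n (ℕ.<⇒≤ (ℕ.≰⇒> l≰m)))
        ... | yes _   | no m≮r  = has-free b (inside (l + d) (ℕ.m≤m+n l d) ℕ.≤-refl) h′
                                    (ℕ.m≤n⇒m≤1+n (ℕ.≤-trans (ℕ.n≤1+n _) (ℕ.≮⇒≥ m≮r))) m≤r
      ... | yes refl = refl , l≤m , m<r
        where
        l≤m : l ≤ m
        l≤m with ℕ.m≤n⇒m<n∨m≡n ([ ℕ.m≤n⇒m≤1+n ∘ proj₁ , proj₁ ]′ range)
        ... | inj₁ l<1+m = ℕ.≤-pred l<1+m
        ... | inj₂ l≡1+m = contradiction h (no-left m (sym l≡1+m))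
        m<r : m < suc (l + d)
        m<r with ℕ.m≤n⇒m<n∨m≡n ([ proj₂ , ℕ.≤-trans (ℕ.n≤1+n m) ∘ proj₂ ]′ range)
        ... | inj₁ m<r  = m<r
        ... | inj₂ refl = contradiction h no-right

      range-closed : ∀ {v w} → Connected (BL n) A v w → InRange (toℕ v) → InRange (toℕ w)
      range-closed = invariant InRange
        (λ c m h q → let _ , l≤m , m<r = edge-range c m h (inj₁ q) in ℕ.m≤n⇒m≤1+n l≤m , m<r)
        (λ c m h q → let _ , l≤m , m<r = edge-range c m h (inj₂ q) in l≤m , ℕ.<⇒≤ m<r)

      connected-from-left : ∀ m → l ≤ m → m ≤ suc (l + d) →
        ∀ u w → toℕ u ≡ l → toℕ w ≡ m → Connected (BL n) A u w
      connected-from-left m l≤m m≤r u w u≡l w≡m with ℕ.m≤n⇒m<n∨m≡n l≤m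
      ... | inj₂ refl = subst (Connected (BL n) A u) (toℕ-injective (trans u≡l (sym w≡m))) ε
      connected-from-left (suc m) _ m<r u w u≡l w≡m | inj₁ (s≤s l≤m) with inside m l≤m m<r
      ... | h@(i , i≡m , _) =
        connected-from-left m l≤m (ℕ.<⇒≤ m<r) u (inject₁ i) u≡l (trans (toℕ-inject₁ i) i≡m)
        ◅◅ link b h (trans (toℕ-inject₁ i) i≡m) w≡m

      connected : ∀ v w → InRange (toℕ v) → InRange (toℕ w) → Connected (BL n) A v w
      connected v w (l≤v , v≤r) (l≤w , w≤r) =
        EqClosure.symmetric _ (connected-from-left (toℕ v) l≤v v≤r left v left≡ refl)
        ◅◅ connected-from-left (toℕ w) l≤w w≤r left w left≡ refl
        where
        left : Vertex
        left = fromℕ< (ℕ.≤-<-trans l≤v (toℕ<n v))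
        left≡ : toℕ left ≡ l
        left≡ = toℕ-fromℕ< (ℕ.≤-<-trans l≤v (toℕ<n v))

      index : ∀ (k : Fin (suc d)) → Has b (l + toℕ k)
      index k = inside (l + toℕ k) (ℕ.m≤m+n l (toℕ k)) (s≤s (ℕ.+-monoʳ-≤ l (toℕ≤pred[n] k)))

      -- A path of backward edges runs through the indices in decreasing order.
      arrange : Bool → Fin (suc d) → Fin (suc d)
      arrange true  k = k
      arrange false k = opposite k

      arrange-involutive : ∀ c k → arrange c (arrange c k) ≡ k
      arrange-involutive true  k = refl
      arrange-involutive false k = opposite-involutive k

      pathEdge : Fin (suc d) → Edge
      pathEdge k = edgeOf b (proj₁ (index (arrange b k)))

      pathEdge-index : ∀ k → toℕ (proj₁ (index k)) ≡ l + toℕ k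
      pathEdge-index k = proj₁ (proj₂ (index k))

      pathEdge-tail : ∀ k → toℕ (source (pathEdge k)) ≡ tailPosition b (l + toℕ (arrange b k))
      pathEdge-tail k = trans (toℕ-source b _) (cong (tailPosition b) (pathEdge-index (arrange b k)))

      pathEdge-head : ∀ k → toℕ (target (pathEdge k)) ≡ headPosition b (l + toℕ (arrange b k))
      pathEdge-head k = trans (toℕ-target b _) (cong (headPosition b) (pathEdge-index (arrange b k)))

      tailPosition-injective : ∀ c {i j} → tailPosition c i ≡ tailPosition c j → i ≡ j
      tailPosition-injective true  eq = eq
      tailPosition-injective false eq = ℕ.suc-injective eq

      arrange-injective : ∀ c i j → l + toℕ (arrange c i) ≡ l + toℕ (arrange c j) → i ≡ j
      arrange-injective c i j eq = begin
        i                      ≡⟨ arrange-involutive c i ⟨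
        arrange c (arrange c i)  ≡⟨ cong (arrange c) (toℕ-injective (ℕ.+-cancelˡ-≡ l _ _ eq)) ⟩
        arrange c (arrange c j)  ≡⟨ arrange-involutive c j ⟩
        j                      ∎
        where open ≡-Reasoning

      positions-composable : ∀ c i →
        tailPosition c (l + toℕ (arrange c (suc i))) ≡ headPosition c (l + toℕ (arrange c (inject₁ i)))
      positions-composable true i = trans (ℕ.+-suc l (toℕ i)) (cong (λ m → suc (l + m)) (sym (toℕ-inject₁ i)))
      positions-composable false i = begin
        suc (l + toℕ (opposite (suc i)))   ≡⟨ cong (λ m → suc (l + m)) (opposite-prop (suc i)) ⟩
        suc (l + (d ∸ suc (toℕ i)))        ≡⟨ ℕ.+-suc l _ ⟨
        l + suc (d ∸ suc (toℕ i))          ≡⟨ cong (l +_) (ℕ.+-∸-assoc 1 (toℕ<n i)) ⟨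
        l + (d ∸ toℕ i)                    ≡⟨ cong (λ m → l + (d ∸ m)) (toℕ-inject₁ i) ⟨
        l + (d ∸ toℕ (inject₁ i))          ≡⟨ cong (l +_) (opposite-prop (inject₁ i)) ⟨
        l + toℕ (opposite (inject₁ i))     ∎
        where open ≡-Reasoning

      positions-not-cycle : ∀ c →
        tailPosition c (l + toℕ (arrange c zero)) ≢ headPosition c (l + toℕ (arrange c (fromℕ d)))
      positions-not-cycle true eq = ℕ.<-irrefl eq (s≤s (ℕ.+-monoʳ-≤ l z≤n))
      positions-not-cycle false eq = ℕ.<-irrefl (sym eq) (s≤s (ℕ.+-monoʳ-≤ l
        (subst (_≤ toℕ (opposite {suc d} zero)) (sym (trans (opposite-prop (fromℕ d))
          (trans (cong (d ∸_) (toℕ-fromℕ d)) (ℕ.n∸n≡0 d)))) z≤n)))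

      path : SimplePath (BL n)
      path = record
        { len-1 = d
        ; edge = pathEdge
        ; composable = λ i → toℕ-injective (trans (pathEdge-tail (suc i))
            (trans (positions-composable b i) (sym (pathEdge-head (inject₁ i)))))
        ; source-inj = λ {i} {j} eq → arrange-injective b i j (tailPosition-injective b
            (trans (sym (pathEdge-tail i)) (trans (cong toℕ eq) (pathEdge-tail j))))
        ; target-inj = λ {i} {j} eq → arrange-injective b i j (tailPosition-injective (not b)
            (trans (sym (pathEdge-head i)) (trans (cong toℕ eq) (pathEdge-head j))))
        ; not-cycle = λ eq → positions-not-cycle b
            (trans (sym (pathEdge-tail zero)) (trans (cong toℕ eq) (pathEdge-head (fromℕ d))))
        }

      open SimplePath path using (HasEdge; HasVertex)

      offset : ∀ m → l ≤ m → m < suc (l + d) → ∃[ k ] l + toℕ (arrange b k) ≡ m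
      offset m l≤m (s≤s m≤l+d) = arrange b k , (begin
        l + toℕ (arrange b (arrange b k))  ≡⟨ cong ((l +_) ∘ toℕ) (arrange-involutive b k) ⟩
        l + toℕ k                        ≡⟨ cong (l +_) (toℕ-fromℕ< k<) ⟩
        l + (m ∸ l)                      ≡⟨ ℕ.m+[n∸m]≡n l≤m ⟩
        m                                ∎)
        where
        open ≡-Reasoning
        k< : m ∸ l < suc d
        k< = s≤s (ℕ.m≤n+o⇒m∸n≤o m l m≤l+d)
        k : Fin (suc d)
        k = fromℕ< k<

      hasEdge : ∀ m → (h : Has b m) → l ≤ m → m < suc (l + d) → HasEdge (edgeOf b (proj₁ h))
      hasEdge m (i , i≡m , _) l≤m m<r = let k , eq = offset m l≤m m<r in
        k , cong (edgeOf b) (toℕ-injective (trans (pathEdge-index (arrange b k)) (trans eq (sym i≡m))))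

      tail-range : ∀ c m → l ≤ m → m < suc (l + d) → InRange (tailPosition c m)
      tail-range true  m l≤m m<r = l≤m , ℕ.<⇒≤ m<r
      tail-range false m l≤m m<r = ℕ.m≤n⇒m≤1+n l≤m , m<r

      arrange-range : ∀ k → l ≤ l + toℕ (arrange b k) × l + toℕ (arrange b k) < suc (l + d)
      arrange-range k = ℕ.m≤m+n l _ , s≤s (ℕ.+-monoʳ-≤ l (toℕ≤pred[n] (arrange b k)))

      source-range : ∀ k → InRange (toℕ (source (pathEdge k)))
      source-range k rewrite pathEdge-tail k =
        tail-range b _ (proj₁ (arrange-range k)) (proj₂ (arrange-range k))

      target-range : ∀ k → InRange (toℕ (target (pathEdge k)))
      target-range k rewrite pathEdge-head k =
        tail-range (not b) _ (proj₁ (arrange-range k)) (proj₂ (arrange-range k))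

      vertex-range : ∀ w → HasVertex w → InRange (toℕ w)
      vertex-range w (k , inj₁ refl) = source-range k
      vertex-range w (k , inj₂ refl) = target-range k

      endpoint : ∀ c m → (m ≡ tailPosition c m ⊎ m ≡ headPosition c m)
                       × (suc m ≡ tailPosition c m ⊎ suc m ≡ headPosition c m)
      endpoint true  m = inj₁ refl , inj₂ refl
      endpoint false m = inj₂ refl , inj₁ refl

      hasVertex : ∀ w → InRange (toℕ w) → HasVertex w
      hasVertex w (l≤w , w≤r) with ℕ.m≤n⇒m<n∨m≡n w≤r
      ... | inj₁ w<r = let k , eq = offset (toℕ w) l≤w w<r in k ,
        [ (λ p → inj₁ (toℕ-injective (trans (pathEdge-tail k) (trans (cong (tailPosition b) eq) (sym p)))))
        , (λ p → inj₂ (toℕ-injective (trans (pathEdge-head k) (trans (cong (headPosition b) eq) (sym p)))))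
        ]′ (proj₁ (endpoint b (toℕ w)))
      -- The last position is not the index of an edge of the interval; it is reached as the far end
      -- of the edge of index `l + d`.
      ... | inj₂ w≡r = let k , eq = offset (l + d) (ℕ.m≤m+n l d) ℕ.≤-refl in k ,
        [ (λ p → inj₁ (toℕ-injective (trans (pathEdge-tail k) (trans (cong (tailPosition b) eq) (trans (sym p) (sym w≡r))))))
        , (λ p → inj₂ (toℕ-injective (trans (pathEdge-head k) (trans (cong (headPosition b) eq) (trans (sym p) (sym w≡r))))))
        ]′ (proj₂ (endpoint b (l + d)))

      position : ∀ c m → InRange (tailPosition c m) → InRange m ⊎ InRange (suc m)
      position true  m = inj₁
      position false m = inj₂

      component : ∀ v → InRange (toℕ v) → ComponentIsSimplePath (BL n) A v
      component v v∈ = path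
        , (λ w → mk⇔ (λ c → hasVertex w (range-closed c v∈)) (λ h → connected v w v∈ (vertex-range w h)))
        , λ e → mk⇔ (edge⇒ e) λ { (k , refl) → proj₂ (proj₂ (index (arrange b k)))
                                              , connected v _ v∈ (source-range k) }
        where
        edge⇒ : ∀ e → ComponentEdge (BL n) A v e → HasEdge e
        edge⇒ e (e∈A , c) with edgeOf-surjective e
        ... | c′ , i , refl with edge-range c′ (toℕ i) (i , refl , e∈A)
          (position c′ (toℕ i) (subst InRange (toℕ-source c′ i) (range-closed c v∈)))
        ... | refl , l≤i , i<r = hasEdge (toℕ i) (i , refl , e∈A) l≤i i<r

    has-run : ∀ b p → Run (Has b) p
    has-run b = run (has? b) n (has-bound b)

    open Run

    run-component : ∀ b v (ρ : Run (Has b) (toℕ v)) → left ρ < right ρ → ComponentIsSimplePath (BL n) A v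
    run-component b v ρ l<r with ℕ.m≤n⇒∃[o]m+o≡n l<r
    ... | d , eq = Interval.component b (left ρ) d
        (λ m l≤m m<r → inside ρ m l≤m (subst (m <_) eq m<r)) (no-left ρ)
        (subst (λ r → ¬ Has b r) (sym eq) (no-right ρ))
        v (left≤ ρ , subst (toℕ v ≤_) (sym eq) (≤right ρ))

    -- A vertex with a nonempty run in some direction lies on the path of that run. If both runs are
    -- empty, their ends collapse to the position of `v`, and maximality says that no edge of `A`
    -- meets `v`.
    component : ∀ v → ComponentIsVertex (BL n) A v ⊎ ComponentIsSimplePath (BL n) A v
    component v with left (has-run true (toℕ v)) ℕ.<? right (has-run true (toℕ v))
                   | left (has-run false (toℕ v)) ℕ.<? right (has-run false (toℕ v))
    ... | yes l<r | _       = inj₂ (run-component true v (has-run true (toℕ v)) l<r)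
    ... | no _    | yes l<r = inj₂ (run-component false v (has-run false (toℕ v)) l<r)
    ... | no l≮r  | no l′≮r′ = inj₁ (isolated v
        (λ { true → empty-right true l≮r ; false → empty-right false l′≮r′ })
        (λ { true → empty-left true l≮r ; false → empty-left false l′≮r′ }))
      where
      p = toℕ v
      empty-right : ∀ b → ¬ left (has-run b p) < right (has-run b p) → ¬ Has b p
      empty-right b l≮r = subst (λ m → ¬ Has b m)
        (ℕ.≤-antisym (ℕ.≤-trans (ℕ.≮⇒≥ l≮r) (left≤ (has-run b p))) (≤right (has-run b p)))
        (no-right (has-run b p))
      empty-left : ∀ b → ¬ left (has-run b p) < right (has-run b p) → ∀ m → suc m ≡ p → ¬ Has b m
      empty-left b l≮r m 1+m≡p = no-left (has-run b p) m (trans 1+m≡p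
        (ℕ.≤-antisym (ℕ.≤-trans (≤right (has-run b p)) (ℕ.≮⇒≥ l≮r)) (left≤ (has-run b p))))

  conflictFree⇒multipath : ∀ n (A : Subset (n + n)) → BidirectionalLinear.ConflictFree n A → IsMultipath (BL n) A
  conflictFree⇒multipath n A free = Components.component n A free

-- Arithmetic and order of the Cauchy reals

module Reals where
  open import Defs using (Eventually; IsCauchy; ℝ; cauchy; seq; isCauchy; fromℚ; 0ℝ; 1ℝ; module CauchyLemmas)
  import Defs as D
  open import Algebra.Bundles using (CommutativeRing)
  import Algebra.Solver.Ring
  open import Algebra.Solver.Ring.AlmostCommutativeRing using (fromCommutativeRing; _-Raw-AlmostCommutative⟶_)
  open import Data.Empty using (⊥)
  open import Data.Integer.Base as ℤ using (+_; -[1+_])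
  import Data.Integer.Properties as ℤ
  open import Data.Maybe.Base as Maybe using (Maybe)
  open import Data.Nat.Coprimality using (1-coprimeTo) renaming (sym to coprime-sym)
  open import Data.Rational as ℚ using (ℚ; 0ℚ; 1ℚ; ½; mkℚ)
  import Data.Rational.Properties as ℚ
  open import Data.Rational.Solver renaming (module +-*-Solver to ℚ-Solver)
  open import Function using (case_of_)
  open import Level using (0ℓ)
  import Relation.Binary.Reasoning.Base.Triple
  open import Relation.Binary.Structures using (IsPreorder)
  open import Relation.Nullary.Decidable using (dec⇒maybe)

  open CauchyLemmas

  infix  4 _≈_ _<_ _≤_
  infixl 6 _+_
  infixl 7 _*_
  infix  8 -_

  variable
    x y z w u v : ℝ

  eventually-map : {P Q : ℕ → Set} → (∀ {n} → P n → Q n) → Eventually P → Eventually Q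
  eventually-map f (N , p) = N , λ n N≤n → f (p n N≤n)

  eventually-map₂ : {P Q R : ℕ → Set} → (∀ {n} → P n → Q n → R n) →
    Eventually P → Eventually Q → Eventually R
  eventually-map₂ f (M , p) (N , q) = M ℕ.⊔ N , λ n ≤n →
    f (p n (ℕ.m⊔n≤o⇒m≤o M N ≤n)) (q n (ℕ.m⊔n≤o⇒n≤o M N ≤n))

  eventually-absurd : ¬ Eventually (λ _ → ⊥)
  eventually-absurd (N , p) = p N ℕ.≤-refl

  p≤p+q : ∀ p {q} → 0ℚ ℚ.≤ q → p ℚ.≤ p ℚ.+ q
  p≤p+q p {q} 0≤q = subst (ℚ._≤ p ℚ.+ q) (ℚ.+-identityʳ p) (ℚ.+-monoʳ-≤ p 0≤q)

  p<p+q : ∀ p {q} → 0ℚ ℚ.< q → p ℚ.< p ℚ.+ q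
  p<p+q p {q} 0<q = subst (ℚ._< p ℚ.+ q) (ℚ.+-identityʳ p) (ℚ.+-monoʳ-< p 0<q)

  +-cancelʳ-≤ : ∀ r {p q} → p ℚ.+ r ℚ.≤ q ℚ.+ r → p ℚ.≤ q
  +-cancelʳ-≤ r {p} {q} h = subst₂ ℚ._≤_ (cancel p) (cancel q) (ℚ.+-monoˡ-≤ (ℚ.- r) h)
    where
    open ℚ-Solver
    cancel : ∀ p → (p ℚ.+ r) ℚ.+ ℚ.- r ≡ p
    cancel p = solve 2 (λ p r → (p :+ r) :+ :- r := p) refl p r

  p≤∣p∣ : ∀ p → p ℚ.≤ ℚ.∣ p ∣
  p≤∣p∣ p with ℚ.≤-total 0ℚ p
  ... | inj₁ 0≤p = ℚ.≤-reflexive (sym (ℚ.0≤p⇒∣p∣≡p 0≤p))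
  ... | inj₂ p≤0 = ℚ.≤-trans p≤0 (ℚ.0≤∣p∣ p)

  half+half-≤ : ∀ p ε → (p ℚ.+ ½ ℚ.* ε) ℚ.+ ½ ℚ.* ε ≡ p ℚ.+ ε
  half+half-≤ p ε = trans (ℚ.+-assoc p _ _) (cong (p ℚ.+_) (half+half ε))

  half<whole : ∀ {ε} → 0ℚ ℚ.< ε → ½ ℚ.* ε ℚ.< ε
  half<whole {ε} ε>0 = subst (½ ℚ.* ε ℚ.<_) (half+half ε) (p<p+q (½ ℚ.* ε) (half>0 ε>0))

  ∣p-q∣≤ε⇒p≤q+ε : ∀ p q {ε} → ℚ.∣ p ℚ.- q ∣ ℚ.≤ ε → p ℚ.≤ q ℚ.+ ε
  ∣p-q∣≤ε⇒p≤q+ε p q d = subst (ℚ._≤ _) (sym (split-difference p q))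
    (ℚ.+-monoʳ-≤ q (ℚ.≤-trans (p≤∣p∣ (p ℚ.- q)) d))

  p≤q+ε⇒p-q≤ε : ∀ p q {ε} → p ℚ.≤ q ℚ.+ ε → p ℚ.- q ℚ.≤ ε
  p≤q+ε⇒p-q≤ε p q {ε} h = subst (p ℚ.- q ℚ.≤_)
    (solve 2 (λ q ε → (q :+ ε) :- q := ε) refl q ε) (ℚ.+-monoˡ-≤ (ℚ.- q) h)
    where open ℚ-Solver

  ∣p-q∣≤ε : ∀ p q {ε} → p ℚ.≤ q ℚ.+ ε → q ℚ.≤ p ℚ.+ ε → ℚ.∣ p ℚ.- q ∣ ℚ.≤ ε
  ∣p-q∣≤ε p q p≤ q≤ with ℚ.∣p∣≡p∨∣p∣≡-p (p ℚ.- q)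
  ... | inj₁ eq = ℚ.≤-trans (ℚ.≤-reflexive eq) (p≤q+ε⇒p-q≤ε p q p≤)
  ... | inj₂ eq = ℚ.≤-trans (ℚ.≤-reflexive (trans eq (sub-flip p q))) (p≤q+ε⇒p-q≤ε q p q≤)

  *-diff : ∀ a b c → a ℚ.* c ℚ.- b ℚ.* c ≡ c ℚ.* (a ℚ.- b)
  *-diff = solve 3 (λ a b c → a :* c :- b :* c := c :* (a :- b)) refl
    where open ℚ-Solver

  -- Opaque because, unfolded, a relation between x and y does not determine x and y for unification.
  opaque
    _≈_ _<_ _≤_ : ℝ → ℝ → Set
    _≈_ = D._≈_
    _<_ = D._<_
    _≤_ = D._≤_

    _+_ _*_ : ℝ → ℝ → ℝ
    _+_ = D._+_
    _*_ = D._*_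

    -_ ∣_∣ : ℝ → ℝ
    -_ = D.-_
    ∣_∣ = D.∣_∣

    ≤-pointwise : (∀ n → seq x n ℚ.≤ seq y n) → x ≤ y
    ≤-pointwise h ε ε>0 = 0 , λ n _ → ℚ.≤-trans (h n) (p≤p+q _ (ℚ.<⇒≤ ε>0))

    ≈-pointwise : (∀ n → seq x n ≡ seq y n) → x ≈ y
    ≈-pointwise {x} {y} h ε ε>0 = 0 , λ n _ → subst (ℚ._< ε)
      (sym (cong ℚ.∣_∣ (trans (cong (ℚ._- seq y n) (h n)) (ℚ.+-inverseʳ (seq y n))))) ε>0

    ≤-trans : x ≤ y → y ≤ z → x ≤ z
    ≤-trans {z = z} x≤y y≤z ε ε>0 = eventually-map₂
      (λ p q → ℚ.≤-trans p (ℚ.≤-trans (ℚ.+-monoˡ-≤ (½ ℚ.* ε) q)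
                                      (ℚ.≤-reflexive (half+half-≤ (seq z _) ε))))
      (x≤y (½ ℚ.* ε) (half>0 ε>0)) (y≤z (½ ℚ.* ε) (half>0 ε>0))

    ≤-antisym : x ≤ y → y ≤ x → x ≈ y
    ≤-antisym x≤y y≤x ε ε>0 = eventually-map₂
      (λ p q → ℚ.≤-<-trans (∣p-q∣≤ε _ _ p q) (half<whole ε>0))
      (x≤y (½ ℚ.* ε) (half>0 ε>0)) (y≤x (½ ℚ.* ε) (half>0 ε>0))

    ≈⇒≤ : x ≈ y → x ≤ y
    ≈⇒≤ x≈y ε ε>0 = eventually-map (λ d → ∣p-q∣≤ε⇒p≤q+ε _ _ (ℚ.<⇒≤ d)) (x≈y ε ε>0)

    ≈-sym : x ≈ y → y ≈ x
    ≈-sym {x} {y} x≈y ε ε>0 = eventually-map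
      (λ {n} → subst (ℚ._< ε)
        (trans (sym (ℚ.∣-p∣≡∣p∣ _)) (cong ℚ.∣_∣ (sub-flip (seq x n) (seq y n)))))
      (x≈y ε ε>0)

    +-mono-≤ : x ≤ y → u ≤ v → x + u ≤ y + v
    +-mono-≤ {y = y} {v = v} x≤y u≤v ε ε>0 = eventually-map₂
      (λ {n} p q → ℚ.≤-trans (ℚ.+-mono-≤ p q) (ℚ.≤-reflexive (trans
        (solve 3 (λ a b c → (a :+ c) :+ (b :+ c) := (a :+ b) :+ (c :+ c)) refl
          (seq y n) (seq v n) (½ ℚ.* ε))
        (cong (seq y n ℚ.+ seq v n ℚ.+_) (half+half ε)))))
      (x≤y (½ ℚ.* ε) (half>0 ε>0)) (u≤v (½ ℚ.* ε) (half>0 ε>0))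
      where open ℚ-Solver

    neg-mono-≤ : x ≤ y → - y ≤ - x
    neg-mono-≤ {x} {y} x≤y ε ε>0 = eventually-map
      (λ {n} p → subst₂ ℚ._≤_
        (solve 2 (λ a b → a :+ (:- a :+ :- b) := :- b) refl (seq x n) (seq y n))
        (solve 3 (λ a b e → (b :+ e) :+ (:- a :+ :- b) := :- a :+ e) refl (seq x n) (seq y n) ε)
        (ℚ.+-monoˡ-≤ (ℚ.- seq x n ℚ.+ ℚ.- seq y n) p))
      (x≤y ε ε>0)
      where open ℚ-Solver

    *-congʳ : ∀ z → x ≈ y → x * z ≈ y * z
    *-congʳ {x} {y} z x≈y ε ε>0 =
      let B , B>0 , bound = eventually-bounded z
          δ , δ>0 , Bδ    = divide B ε B>0 ε>0
      in eventually-map₂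
        (λ {n} d b → subst₂ ℚ._<_
          (cong ℚ.∣_∣ (sym (*-diff (seq x n) (seq y n) (seq z n)))) Bδ
          (*-mono-abs (seq z n) (seq x n ℚ.- seq y n) b d B>0))
        (x≈y δ δ>0) bound

    +-assoc : ∀ x y z → (x + y) + z ≈ x + (y + z)
    +-assoc x y z = ≈-pointwise {(x + y) + z} {x + (y + z)} λ n → ℚ.+-assoc (seq x n) (seq y n) (seq z n)

    +-comm : ∀ x y → x + y ≈ y + x
    +-comm x y = ≈-pointwise {x + y} {y + x} λ n → ℚ.+-comm (seq x n) (seq y n)

    +-identityˡ : ∀ x → 0ℝ + x ≈ x
    +-identityˡ x = ≈-pointwise {0ℝ + x} {x} λ n → ℚ.+-identityˡ (seq x n)

    +-inverseˡ : ∀ x → - x + x ≈ 0ℝ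
    +-inverseˡ x = ≈-pointwise { - x + x} {0ℝ} λ n → ℚ.+-inverseˡ (seq x n)

    *-assoc : ∀ x y z → (x * y) * z ≈ x * (y * z)
    *-assoc x y z = ≈-pointwise {(x * y) * z} {x * (y * z)} λ n → ℚ.*-assoc (seq x n) (seq y n) (seq z n)

    *-comm : ∀ x y → x * y ≈ y * x
    *-comm x y = ≈-pointwise {x * y} {y * x} λ n → ℚ.*-comm (seq x n) (seq y n)

    *-identityˡ : ∀ x → 1ℝ * x ≈ x
    *-identityˡ x = ≈-pointwise {1ℝ * x} {x} λ n → ℚ.*-identityˡ (seq x n)

    *-distribʳ-+ : ∀ x y z → (y + z) * x ≈ y * x + z * x
    *-distribʳ-+ x y z = ≈-pointwise {(y + z) * x} {y * x + z * x}
      λ n → ℚ.*-distribʳ-+ (seq x n) (seq y n) (seq z n)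

    fromℚ-+ : ∀ p q → fromℚ (p ℚ.+ q) ≈ fromℚ p + fromℚ q
    fromℚ-+ p q = ≈-pointwise {fromℚ (p ℚ.+ q)} {fromℚ p + fromℚ q} λ _ → refl

    fromℚ-* : ∀ p q → fromℚ (p ℚ.* q) ≈ fromℚ p * fromℚ q
    fromℚ-* p q = ≈-pointwise {fromℚ (p ℚ.* q)} {fromℚ p * fromℚ q} λ _ → refl

    fromℚ-neg : ∀ p → fromℚ (ℚ.- p) ≈ - fromℚ p
    fromℚ-neg p = ≈-pointwise {fromℚ (ℚ.- p)} { - fromℚ p} λ _ → refl

    fromℚ-mono-≤ : ∀ {p q} → p ℚ.≤ q → fromℚ p ≤ fromℚ q
    fromℚ-mono-≤ {p} {q} p≤q = ≤-pointwise {fromℚ p} {fromℚ q} λ _ → p≤q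

    fromℚ-mono-< : ∀ {p q} → p ℚ.< q → fromℚ p < fromℚ q
    fromℚ-mono-< {p} {q} p<q = q ℚ.- p
      , subst (ℚ._< q ℚ.- p) (ℚ.+-inverseʳ p) (ℚ.+-monoˡ-< (ℚ.- p) p<q)
      , 0 , λ _ _ → ℚ.≤-reflexive (sym (split-difference q p))

    <⇒≤ : x < y → x ≤ y
    <⇒≤ {y = y} (ε , ε>0 , N , h) δ δ>0 = N , λ n N≤n →
      ℚ.≤-trans (p≤p+q _ (ℚ.<⇒≤ ε>0)) (ℚ.≤-trans (h n N≤n) (p≤p+q (seq y n) (ℚ.<⇒≤ δ>0)))

    ≤-<-trans : x ≤ y → y < z → x < z
    ≤-<-trans {y = y} x≤y (ε , ε>0 , y<z) = ½ ℚ.* ε , half>0 ε>0 , eventually-map₂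
      (λ {n} p q → ℚ.≤-trans (ℚ.+-monoˡ-≤ (½ ℚ.* ε) p)
        (ℚ.≤-trans (ℚ.≤-reflexive (half+half-≤ (seq y n) ε)) q))
      (x≤y (½ ℚ.* ε) (half>0 ε>0)) y<z

    <-≤-trans : x < y → y ≤ z → x < z
    <-≤-trans {x} {y} {z} (ε , ε>0 , x<y) y≤z = ½ ℚ.* ε , half>0 ε>0 , eventually-map₂
      (λ {n} p q → +-cancelʳ-≤ (½ ℚ.* ε) (ℚ.≤-trans
        (ℚ.≤-reflexive (half+half-≤ (seq x n) ε)) (ℚ.≤-trans p q)))
      x<y (y≤z (½ ℚ.* ε) (half>0 ε>0))

    <⇒≱ : x < y → ¬ y ≤ x
    <⇒≱ {x} {y} x<y@(ε , ε>0 , _) y≤x = eventually-absurd (eventually-map₂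
      (λ {n} p q → ℚ.<-irrefl refl (ℚ.<-≤-trans (ℚ.+-monoʳ-< (seq x n) (half<whole ε>0))
        (ℚ.≤-trans p q)))
      (proj₂ (proj₂ x<y)) (y≤x (½ ℚ.* ε) (half>0 ε>0)))

    -- Comparison of rationals is decidable term by term. One late index at which `y` exceeds `x` by
    -- ε would already give x < y: each sequence moves by at most ε/4 afterwards, so a gap of ε/2
    -- persists. All stability under double negation below rests on this.
    ≮⇒≥ : ¬ x < y → y ≤ x
    ≮⇒≥ {x} {y} x≮y ε ε>0
      with isCauchy x (½ ℚ.* (½ ℚ.* ε)) (half>0 (half>0 ε>0))
         | isCauchy y (½ ℚ.* (½ ℚ.* ε)) (half>0 (half>0 ε>0))
    ... | M , closeX | N , closeY = K , λ n K≤n → case (seq x n ℚ.+ ε ℚ.<? seq y n) of λ where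
        (no  ≮) → ℚ.≮⇒≥ ≮
        (yes <) → contradiction (½ ℚ.* ε , half>0 ε>0 , K , λ m K≤m → gap m n K≤m K≤n <) x≮y
      where
      open ℚ-Solver
      K : ℕ
      K = M ℕ.⊔ N
      η : ℚ
      η = ½ ℚ.* (½ ℚ.* ε)
      gap : ∀ m n → K ℕ.≤ m → K ℕ.≤ n → seq x n ℚ.+ ε ℚ.< seq y n → seq x m ℚ.+ ½ ℚ.* ε ℚ.≤ seq y m
      gap m n K≤m K≤n x+ε<y = +-cancelʳ-≤ (½ ℚ.* ε) (begin
        seq x m ℚ.+ ½ ℚ.* ε ℚ.+ ½ ℚ.* ε  ≡⟨ half+half-≤ (seq x m) ε ⟩
        seq x m ℚ.+ ε                    ≤⟨ ℚ.+-monoˡ-≤ ε (∣p-q∣≤ε⇒p≤q+ε (seq x m) (seq x n) (ℚ.<⇒≤ (closeX m n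
                                              (ℕ.m⊔n≤o⇒m≤o M N K≤m) (ℕ.m⊔n≤o⇒m≤o M N K≤n)))) ⟩
        seq x n ℚ.+ η ℚ.+ ε              ≡⟨ solve 3 (λ a b c → a :+ b :+ c := a :+ c :+ b) refl (seq x n) η ε ⟩
        seq x n ℚ.+ ε ℚ.+ η              ≤⟨ ℚ.+-monoˡ-≤ η (ℚ.<⇒≤ x+ε<y) ⟩
        seq y n ℚ.+ η                    ≤⟨ ℚ.+-monoˡ-≤ η (∣p-q∣≤ε⇒p≤q+ε (seq y n) (seq y m) (ℚ.<⇒≤ (closeY n m
                                              (ℕ.m⊔n≤o⇒n≤o M N K≤n) (ℕ.m⊔n≤o⇒n≤o M N K≤m)))) ⟩
        seq y m ℚ.+ η ℚ.+ η              ≡⟨ half+half-≤ (seq y m) (½ ℚ.* ε) ⟩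
        seq y m ℚ.+ ½ ℚ.* ε              ∎)
        where open ℚ.≤-Reasoning

    +-monoˡ-< : ∀ z → x < y → x + z < y + z
    +-monoˡ-< {x} {y} z (ε , ε>0 , x<y) = ε , ε>0 , eventually-map
      (λ {n} p → subst (ℚ._≤ seq y n ℚ.+ seq z n)
        (solve 3 (λ a b c → a :+ b :+ c := a :+ c :+ b) refl (seq x n) ε (seq z n))
        (ℚ.+-monoˡ-≤ (seq z n) p)) x<y
      where open ℚ-Solver

    *-positive : 0ℝ < x → 0ℝ < y → 0ℝ < x * y
    *-positive {x} {y} (δ , δ>0 , x>0) (ε , ε>0 , y>0) = δ ℚ.* ε , δε>0 , eventually-map₂
      (λ {n} p q → begin
        0ℚ ℚ.+ δ ℚ.* ε        ≡⟨ ℚ.+-identityˡ (δ ℚ.* ε) ⟩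
        δ ℚ.* ε               ≤⟨ ℚ.*-monoˡ-≤-nonNeg δ {{ℚ.nonNegative (ℚ.<⇒≤ δ>0)}} (drop-0 ε q) ⟩
        δ ℚ.* seq y n         ≤⟨ ℚ.*-monoʳ-≤-nonNeg (seq y n)
                                   {{ℚ.nonNegative (ℚ.≤-trans (ℚ.<⇒≤ ε>0) (drop-0 ε q))}} (drop-0 δ p) ⟩
        seq x n ℚ.* seq y n   ∎)
      x>0 y>0
      where
      open ℚ.≤-Reasoning
      drop-0 : ∀ p {q} → 0ℚ ℚ.+ p ℚ.≤ q → p ℚ.≤ q
      drop-0 p = subst (ℚ._≤ _) (ℚ.+-identityˡ p)
      δε>0 : 0ℚ ℚ.< δ ℚ.* ε
      δε>0 = subst (ℚ._< δ ℚ.* ε) (ℚ.*-zeroʳ δ) (ℚ.*-monoʳ-<-pos δ {{ℚ.positive δ>0}} ε>0)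

    x≤∣x∣ : ∀ x → x ≤ ∣ x ∣
    x≤∣x∣ x = ≤-pointwise {x} {∣ x ∣} λ n → p≤∣p∣ (seq x n)

    -x≤∣x∣ : ∀ x → - x ≤ ∣ x ∣
    -x≤∣x∣ x = ≤-pointwise { - x} {∣ x ∣} λ n →
      subst (ℚ.- seq x n ℚ.≤_) (ℚ.∣-p∣≡∣p∣ (seq x n)) (p≤∣p∣ (ℚ.- seq x n))

    ∣x∣≤y : x ≤ y → - x ≤ y → ∣ x ∣ ≤ y
    ∣x∣≤y {x} {y} x≤y -x≤y ε ε>0 = eventually-map₂ (λ {n} p q → bound (seq x n) p q)
      (x≤y ε ε>0) (-x≤y ε ε>0)
      where
      bound : ∀ p {q} → p ℚ.≤ q → ℚ.- p ℚ.≤ q → ℚ.∣ p ∣ ℚ.≤ q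
      bound p p≤q -p≤q with ℚ.∣p∣≡p∨∣p∣≡-p p
      ... | inj₁ eq = subst (ℚ._≤ _) (sym eq) p≤q
      ... | inj₂ eq = subst (ℚ._≤ _) (sym eq) -p≤q

    bounded : ∀ x → ∃[ B ] 0ℚ ℚ.< B × ∣ x ∣ ≤ fromℚ B
    bounded x =
      let B , B>0 , N , bound = eventually-bounded x
      in B , B>0 , λ ε ε>0 → N , λ n N≤n → ℚ.≤-trans (bound n N≤n) (p≤p+q B (ℚ.<⇒≤ ε>0))

  -- Square roots by rational approximation

  fromℕ : ℕ → ℚ
  fromℕ n = mkℚ (+ n) 0 (coprime-sym (1-coprimeTo n))

  fromℕ-suc : ∀ n → fromℕ (suc n) ≡ fromℕ n ℚ.+ 1ℚ
  fromℕ-suc n = trans (sym (ℚ.↥p/↧p≡p (fromℕ (suc n)))) (cong (ℚ._/ 1) eq)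
    where
    eq : + suc n ≡ + n ℤ.* + 1 ℤ.+ + 1 ℤ.* + 1
    eq = trans (cong +_ (ℕ.+-comm 1 n)) (cong (ℤ._+ + 1) (sym (ℤ.*-identityʳ (+ n))))

  -- This is 1/(n + 1): `mkℚ` stores the denominator minus one.
  unitFraction : ℕ → ℚ
  unitFraction n = mkℚ (+ 1) n (1-coprimeTo (suc n))

  unitFraction>0 : ∀ n → 0ℚ ℚ.< unitFraction n
  unitFraction>0 n = ℚ.positive⁻¹ (unitFraction n)

  -- A positive ε has numerator at least 1, so its stored denominator `d` can itself serve as the
  -- starting index.
  unitFraction-small : ∀ ε → 0ℚ ℚ.< ε → Eventually λ n → unitFraction n ℚ.≤ ε
  unitFraction-small (mkℚ (+ zero)    d c) (ℚ.*<* (ℤ.+<+ ()))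
  unitFraction-small (mkℚ (-[1+ a ])  d c) (ℚ.*<* ())
  unitFraction-small (mkℚ (+ (suc a)) d c) _ = d , λ n d≤n → ℚ.*≤* (ℤ.+≤+
    (ℕ.≤-trans (ℕ.≤-reflexive (ℕ.*-identityˡ (suc d)))
      (ℕ.≤-trans (ℕ.s≤s d≤n) (ℕ.m≤m+n (suc n) (a ℕ.* suc n)))))

  ≤-fromℕ : ∀ p → 0ℚ ℚ.≤ p → ∃[ n ] p ℚ.≤ fromℕ n
  ≤-fromℕ (mkℚ (+ n)      d c) _ = n , ℚ.*≤* (ℤ.*-monoˡ-≤-nonNeg (+ n) (ℤ.+≤+ (ℕ.s≤s ℕ.z≤n)))
  ≤-fromℕ (mkℚ (-[1+ n ]) d c) (ℚ.*≤* ())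

  *-nonNeg : ∀ {p q} → 0ℚ ℚ.≤ p → 0ℚ ℚ.≤ q → 0ℚ ℚ.≤ p ℚ.* q
  *-nonNeg {p} {q} 0≤p 0≤q = subst (ℚ._≤ p ℚ.* q) (ℚ.*-zeroʳ p)
    (ℚ.*-monoˡ-≤-nonNeg p {{ℚ.nonNegative 0≤p}} 0≤q)

  square-mono-≤ : ∀ {p q} → 0ℚ ℚ.≤ p → p ℚ.≤ q → p ℚ.* p ℚ.≤ q ℚ.* q
  square-mono-≤ {p} {q} 0≤p p≤q = ℚ.≤-trans
    (ℚ.*-monoˡ-≤-nonNeg p {{ℚ.nonNegative 0≤p}} p≤q)
    (ℚ.*-monoʳ-≤-nonNeg q {{ℚ.nonNegative (ℚ.≤-trans 0≤p p≤q)}} p≤q)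

  square-cancel-< : ∀ {p q} → 0ℚ ℚ.≤ q → p ℚ.* p ℚ.< q ℚ.* q → p ℚ.< q
  square-cancel-< {p} {q} 0≤q p²<q² with p ℚ.<? q
  ... | yes p<q = p<q
  ... | no  p≮q = contradiction (ℚ.<-≤-trans p²<q² (square-mono-≤ 0≤q (ℚ.≮⇒≥ p≮q))) (ℚ.<-irrefl refl)

  record ApproxRoot (q ε : ℚ) : Set where
    field
      root   : ℚ
      root≥0 : 0ℚ ℚ.≤ root
      lower  : root ℚ.* root ℚ.≤ q
      upper  : q ℚ.< (root ℚ.+ ε) ℚ.* (root ℚ.+ ε)

  open ApproxRoot

  -- The search descends through the multiples of ε from one that is at least 1 + q, whose square
  -- exceeds `q`. The first multiple with square at most `q` is the root, and the one just above it
  -- gives the upper bound.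
  approxRoot : ∀ q ε → 0ℚ ℚ.≤ q → 0ℚ ℚ.< ε → ApproxRoot q ε
  approxRoot q ε 0≤q 0<ε = search (proj₁ K) (ℚ.<-≤-trans q<[1+q]²
      (square-mono-≤ 0≤1+q (ℚ.≤-trans
        (ℚ.≤-reflexive (trans (sym εδ) (ℚ.*-comm ε δ)))
        (ℚ.*-monoʳ-≤-nonNeg ε {{ℚ.nonNegative (ℚ.<⇒≤ 0<ε)}} (proj₂ K)))))
    where
    1+q>0 : 0ℚ ℚ.< 1ℚ ℚ.+ q
    1+q>0 = ℚ.<-≤-trans (ℚ.positive⁻¹ 1ℚ) (p≤p+q 1ℚ 0≤q)

    0≤1+q : 0ℚ ℚ.≤ 1ℚ ℚ.+ q
    0≤1+q = ℚ.<⇒≤ 1+q>0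

    δ : ℚ
    δ = proj₁ (divide ε (1ℚ ℚ.+ q) 0<ε 1+q>0)

    εδ : ε ℚ.* δ ≡ 1ℚ ℚ.+ q
    εδ = proj₂ (proj₂ (divide ε (1ℚ ℚ.+ q) 0<ε 1+q>0))

    K : ∃[ n ] δ ℚ.≤ fromℕ n
    K = ≤-fromℕ δ (ℚ.<⇒≤ (proj₁ (proj₂ (divide ε (1ℚ ℚ.+ q) 0<ε 1+q>0))))

    q<[1+q]² : q ℚ.< (1ℚ ℚ.+ q) ℚ.* (1ℚ ℚ.+ q)
    q<[1+q]² = ℚ.<-≤-trans (subst (ℚ._< 1ℚ ℚ.+ q) (ℚ.+-identityˡ q)
        (ℚ.+-monoˡ-< q (ℚ.positive⁻¹ 1ℚ)))
      (ℚ.≤-trans (ℚ.≤-reflexive (sym (ℚ.*-identityʳ (1ℚ ℚ.+ q))))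
        (ℚ.*-monoˡ-≤-nonNeg (1ℚ ℚ.+ q) {{ℚ.nonNegative 0≤1+q}} (p≤p+q 1ℚ 0≤q)))

    multiple : ℕ → ℚ
    multiple n = fromℕ n ℚ.* ε

    multiple-suc : ∀ n → multiple (suc n) ≡ multiple n ℚ.+ ε
    multiple-suc n = trans (cong (ℚ._* ε) (fromℕ-suc n))
      (trans (ℚ.*-distribʳ-+ ε (fromℕ n) 1ℚ) (cong (multiple n ℚ.+_) (ℚ.*-identityˡ ε)))

    search : ∀ n → q ℚ.< multiple n ℚ.* multiple n → ApproxRoot q ε
    search zero    q<0 = contradiction
      (ℚ.≤-<-trans 0≤q (subst (λ z → q ℚ.< z ℚ.* z) (ℚ.*-zeroˡ ε) q<0)) (ℚ.<-irrefl refl)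
    search (suc n) q< with multiple n ℚ.* multiple n ℚ.≤? q
    ... | no  ≰ = search n (ℚ.≰⇒> ≰)
    ... | yes ≤ = record
      { root = multiple n
      ; root≥0 = *-nonNeg (ℚ.nonNegative⁻¹ (fromℕ n)) (ℚ.<⇒≤ 0<ε)
      ; lower = ≤
      ; upper = subst (λ z → q ℚ.< z ℚ.* z) (multiple-suc n) q<
      }

  -- With h = ε/2 and b the root of `s`, the square of the root of `r` is at most p ≤ q + h² < (b +
  -- η)² + h² ≤ (b + h)² + h² ≤ (b + 2h)². Half of ε absorbs the precision of `s`, the other half
  -- the change of the radicand.
  approxRoot-close : ∀ {p q δ η ε} (r : ApproxRoot p δ) (s : ApproxRoot q η) →
    0ℚ ℚ.< ε → 0ℚ ℚ.≤ η → η ℚ.≤ ½ ℚ.* ε → p ℚ.≤ q ℚ.+ (½ ℚ.* ε) ℚ.* (½ ℚ.* ε) →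
    root r ℚ.< root s ℚ.+ ε
  approxRoot-close {p} {q} {δ} {η} {ε} r s ε>0 0≤η η≤ p≤ =
    square-cancel-< (ℚ.≤-trans (root≥0 s) (p≤p+q (root s) (ℚ.<⇒≤ ε>0))) (begin-strict
      root r ℚ.* root r                        ≤⟨ lower r ⟩
      p                                        ≤⟨ p≤ ⟩
      q ℚ.+ h ℚ.* h                            <⟨ ℚ.+-monoˡ-< (h ℚ.* h) (upper s) ⟩
      (b ℚ.+ η) ℚ.* (b ℚ.+ η) ℚ.+ h ℚ.* h
        ≤⟨ ℚ.+-monoˡ-≤ (h ℚ.* h) (square-mono-≤ 0≤b+η (ℚ.+-monoʳ-≤ b η≤)) ⟩
      (b ℚ.+ h) ℚ.* (b ℚ.+ h) ℚ.+ h ℚ.* h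
        ≤⟨ p≤p+q _ (*-nonNeg 0≤h (ℚ.≤-trans 0≤b+h (p≤p+q (b ℚ.+ h) 0≤b+h))) ⟩
      (b ℚ.+ h) ℚ.* (b ℚ.+ h) ℚ.+ h ℚ.* h ℚ.+ h ℚ.* ((b ℚ.+ h) ℚ.+ (b ℚ.+ h))
        ≡⟨ solve 2 (λ b h → (b :+ h) :* (b :+ h) :+ h :* h :+ h :* ((b :+ h) :+ (b :+ h))
                         := (b :+ (h :+ h)) :* (b :+ (h :+ h))) refl b h ⟩
      (b ℚ.+ (h ℚ.+ h)) ℚ.* (b ℚ.+ (h ℚ.+ h))
        ≡⟨ cong (λ z → (b ℚ.+ z) ℚ.* (b ℚ.+ z)) (half+half ε) ⟩
      (b ℚ.+ ε) ℚ.* (b ℚ.+ ε)                  ∎)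
    where
    open ℚ.≤-Reasoning
    open ℚ-Solver
    b h : ℚ
    b = root s
    h = ½ ℚ.* ε
    0≤h : 0ℚ ℚ.≤ h
    0≤h = ℚ.<⇒≤ (half>0 ε>0)
    0≤b+h : 0ℚ ℚ.≤ b ℚ.+ h
    0≤b+h = ℚ.≤-trans (root≥0 s) (p≤p+q b 0≤h)
    0≤b+η : 0ℚ ℚ.≤ b ℚ.+ η
    0≤b+η = ℚ.≤-trans (root≥0 s) (p≤p+q b 0≤η)

  -- The absolute value makes every radicand nonnegative: even a real that is ≥ 0 may have negative
  -- terms.
  sqrtApprox : ∀ x n → ApproxRoot ℚ.∣ seq x n ∣ (unitFraction n)
  sqrtApprox x n = approxRoot ℚ.∣ seq x n ∣ (unitFraction n) (ℚ.0≤∣p∣ (seq x n)) (unitFraction>0 n)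

  -- `approxRoot-close` is used with ε/2 in place of ε. It then asks for precision ε/4 and for
  -- radicands within (ε/4)² of each other.
  sqrt-isCauchy : ∀ x → IsCauchy (λ n → root (sqrtApprox x n))
  sqrt-isCauchy x ε ε>0 = N ℕ.⊔ M , λ m n ≤m ≤n →
    let close : ∀ i j → N ℕ.⊔ M ℕ.≤ i → N ℕ.⊔ M ℕ.≤ j →
                root (sqrtApprox x i) ℚ.≤ root (sqrtApprox x j) ℚ.+ h
        close i j ≤i ≤j = ℚ.<⇒≤ (approxRoot-close (sqrtApprox x i) (sqrtApprox x j) h>0
          (ℚ.<⇒≤ (unitFraction>0 j)) (small j (ℕ.m⊔n≤o⇒m≤o N M ≤j))
          (∣p-q∣≤ε⇒p≤q+ε _ _ (ℚ.<⇒≤ (cauchyAbs i j (ℕ.m⊔n≤o⇒n≤o N M ≤i) (ℕ.m⊔n≤o⇒n≤o N M ≤j)))))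
    in ℚ.≤-<-trans (∣p-q∣≤ε _ _ (close m n ≤m ≤n) (close n m ≤n ≤m)) (half<whole ε>0)
    where
    h k : ℚ
    h = ½ ℚ.* ε
    k = ½ ℚ.* h

    h>0 : 0ℚ ℚ.< h
    h>0 = half>0 ε>0

    k²>0 : 0ℚ ℚ.< k ℚ.* k
    k²>0 = subst (ℚ._< k ℚ.* k) (ℚ.*-zeroʳ k)
      (ℚ.*-monoʳ-<-pos k {{ℚ.positive (half>0 h>0)}} (half>0 h>0))

    N : ℕ
    N = proj₁ (unitFraction-small k (half>0 h>0))

    small : ∀ n → N ℕ.≤ n → unitFraction n ℚ.≤ k
    small = proj₂ (unitFraction-small k (half>0 h>0))

    M : ℕ
    M = proj₁ (abs-isCauchy x (k ℚ.* k) k²>0)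

    cauchyAbs : ∀ m n → M ℕ.≤ m → M ℕ.≤ n → ℚ.∣ ℚ.∣ seq x m ∣ ℚ.- ℚ.∣ seq x n ∣ ∣ ℚ.< k ℚ.* k
    cauchyAbs = proj₂ (abs-isCauchy x (k ℚ.* k) k²>0)

  opaque
    unfolding _≈_

    -- For negative x this is √(−x).
    sqrt : ℝ → ℝ
    sqrt x = cauchy (λ n → root (sqrtApprox x n)) (sqrt-isCauchy x)

    sqrt≥0 : ∀ x → 0ℝ ≤ sqrt x
    sqrt≥0 x = ≤-pointwise {0ℝ} {sqrt x} λ n → root≥0 (sqrtApprox x n)

    sqrt² : ∀ x → sqrt x * sqrt x ≈ ∣ x ∣
    sqrt² x = ≤-antisym {sqrt x * sqrt x} {∣ x ∣}
      (≤-pointwise {sqrt x * sqrt x} {∣ x ∣} λ n → lower (sqrtApprox x n))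
      λ ε ε>0 →
        let B , B>0 , N , bound = eventually-bounded (sqrt x)
            -- In (r + e)² = r² + (2r + e) e the factor 2r + e is at most `C` as soon as r ≤ B and e
            -- ≤ 1, and e ≤ δ = ε/C keeps the error below ε.
            C                   = B ℚ.+ B ℚ.+ 1ℚ
            C>0                 = 2B+1>0 B B>0
            δ , δ>0 , Cδ        = divide C ε C>0 ε>0
            M , small           = eventually-map₂ {P = λ n → unitFraction n ℚ.≤ δ} {Q = λ n → unitFraction n ℚ.≤ 1ℚ}
                                    _,_ (unitFraction-small δ δ>0) (unitFraction-small 1ℚ (ℚ.positive⁻¹ 1ℚ))
        in N ℕ.⊔ M , λ n ≤n → let r = root (sqrtApprox x n) ; e = unitFraction n in begin
          ℚ.∣ seq x n ∣                        ≤⟨ ℚ.<⇒≤ (upper (sqrtApprox x n)) ⟩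
          (r ℚ.+ e) ℚ.* (r ℚ.+ e)
            ≡⟨ solve 2 (λ r e → (r :+ e) :* (r :+ e) := r :* r :+ ((r :+ r) :+ e) :* e) refl r e ⟩
          r ℚ.* r ℚ.+ ((r ℚ.+ r) ℚ.+ e) ℚ.* e  ≤⟨ ℚ.+-monoʳ-≤ (r ℚ.* r) (ℚ.≤-trans
              (ℚ.*-monoʳ-≤-nonNeg e {{ℚ.nonNegative (ℚ.<⇒≤ (unitFraction>0 n))}}
                (ℚ.+-mono-≤ (ℚ.+-mono-≤ (r≤B n B (bound n (ℕ.m⊔n≤o⇒m≤o N M ≤n)))
                                        (r≤B n B (bound n (ℕ.m⊔n≤o⇒m≤o N M ≤n))))
                            (proj₂ (small n (ℕ.m⊔n≤o⇒n≤o N M ≤n)))))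
              (ℚ.*-monoˡ-≤-nonNeg C {{ℚ.nonNegative (ℚ.<⇒≤ C>0)}}
                (proj₁ (small n (ℕ.m⊔n≤o⇒n≤o N M ≤n))))) ⟩
          r ℚ.* r ℚ.+ C ℚ.* δ                  ≡⟨ cong (r ℚ.* r ℚ.+_) Cδ ⟩
          r ℚ.* r ℚ.+ ε                        ∎
      where
      open ℚ.≤-Reasoning
      open ℚ-Solver
      2B+1>0 : ∀ B → 0ℚ ℚ.< B → 0ℚ ℚ.< B ℚ.+ B ℚ.+ 1ℚ
      2B+1>0 B B>0 = ℚ.+-mono-≤-< (ℚ.+-mono-≤ (ℚ.<⇒≤ B>0) (ℚ.<⇒≤ B>0)) (ℚ.positive⁻¹ 1ℚ)
      r≤B : ∀ n B → ℚ.∣ root (sqrtApprox x n) ∣ ℚ.≤ B → root (sqrtApprox x n) ℚ.≤ B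
      r≤B n B = ℚ.≤-trans (p≤∣p∣ _)

  -- Ring structure and order, with cases under double negation

  infixl 6 _-_
  _-_ : ℝ → ℝ → ℝ
  x - y = x + - y

  ≈-refl : x ≈ x
  ≈-refl = ≈-pointwise λ _ → refl

  ≤-refl : x ≤ x
  ≤-refl = ≤-pointwise λ _ → ℚ.≤-refl

  ≈⇒≥ : x ≈ y → y ≤ x
  ≈⇒≥ x≈y = ≈⇒≤ (≈-sym x≈y)

  ≈-trans : x ≈ y → y ≈ z → x ≈ z
  ≈-trans x≈y y≈z = ≤-antisym (≤-trans (≈⇒≤ x≈y) (≈⇒≤ y≈z)) (≤-trans (≈⇒≥ y≈z) (≈⇒≥ x≈y))

  +-cong : x ≈ y → u ≈ v → x + u ≈ y + v
  +-cong x≈y u≈v = ≤-antisym (+-mono-≤ (≈⇒≤ x≈y) (≈⇒≤ u≈v)) (+-mono-≤ (≈⇒≥ x≈y) (≈⇒≥ u≈v))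

  neg-cong : x ≈ y → - x ≈ - y
  neg-cong x≈y = ≤-antisym (neg-mono-≤ (≈⇒≥ x≈y)) (neg-mono-≤ (≈⇒≤ x≈y))

  *-cong : x ≈ y → u ≈ v → x * u ≈ y * v
  *-cong {x} {y} {u} {v} x≈y u≈v = ≈-trans (*-congʳ u x≈y)
    (≈-trans (*-comm y u) (≈-trans (*-congʳ y u≈v) (*-comm v y)))

  +-*-commutativeRing : CommutativeRing 0ℓ 0ℓ
  +-*-commutativeRing = record
    { Carrier = ℝ ; _≈_ = _≈_ ; _+_ = _+_ ; _*_ = _*_ ; -_ = -_ ; 0# = 0ℝ ; 1# = 1ℝ
    ; isCommutativeRing = record
      { isRing = record
        { +-isAbelianGroup = record
          { isGroup = record
            { isMonoid = record
              { isSemigroup = record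
                { isMagma = record
                  { isEquivalence = record { refl = ≈-refl ; sym = ≈-sym ; trans = ≈-trans }
                  ; ∙-cong = +-cong }
                ; assoc = +-assoc }
              ; identity = +-identityˡ , λ x → ≈-trans (+-comm x 0ℝ) (+-identityˡ x) }
            ; inverse = +-inverseˡ , λ x → ≈-trans (+-comm x (- x)) (+-inverseˡ x)
            ; ⁻¹-cong = neg-cong }
          ; comm = +-comm }
        ; *-cong = *-cong
        ; *-assoc = *-assoc
        ; *-identity = *-identityˡ , λ x → ≈-trans (*-comm x 1ℝ) (*-identityˡ x)
        ; distrib = (λ x y z → ≈-trans (*-comm x (y + z)) (≈-trans (*-distribʳ-+ x y z)
                                (+-cong (*-comm y x) (*-comm z x)))) , *-distribʳ-+ }
      ; *-comm = *-comm } }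

  module ℝ-Ring = CommutativeRing +-*-commutativeRing

  -- Rational coefficients give the ring solver constants such as ½ whose equality is decidable, as
  -- that of reals is not.
  fromℚ-homomorphism :
    CommutativeRing.rawRing ℚ.+-*-commutativeRing -Raw-AlmostCommutative⟶ fromCommutativeRing +-*-commutativeRing
  fromℚ-homomorphism = record
    { ⟦_⟧ = fromℚ ; +-homo = fromℚ-+ ; *-homo = fromℚ-* ; -‿homo = fromℚ-neg
    ; 0-homo = ≈-refl ; 1-homo = ≈-refl }

  fromℚ≟ : ∀ p q → Maybe (fromℚ p ≈ fromℚ q)
  fromℚ≟ p q = Maybe.map (λ { refl → ≈-refl }) (dec⇒maybe (p ℚ.≟ q))

  module ℝ-Solver = Algebra.Solver.Ring
    (CommutativeRing.rawRing ℚ.+-*-commutativeRing) (fromCommutativeRing +-*-commutativeRing)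
    fromℚ-homomorphism fromℚ≟

  open ℝ-Solver

  <-trans : x < y → y < z → x < z
  <-trans x<y y<z = ≤-<-trans (<⇒≤ x<y) y<z

  <-irrefl : ¬ x < x
  <-irrefl x<x = <⇒≱ x<x ≤-refl

  <-resp-≈ˡ : x ≈ y → x < z → y < z
  <-resp-≈ˡ x≈y = ≤-<-trans (≈⇒≥ x≈y)

  <-resp-≈ʳ : x ≈ y → z < x → z < y
  <-resp-≈ʳ x≈y z<x = <-≤-trans z<x (≈⇒≤ x≈y)

  ≤-resp-≈ : x ≈ y → u ≈ v → x ≤ u → y ≤ v
  ≤-resp-≈ x≈y u≈v x≤u = ≤-trans (≈⇒≥ x≈y) (≤-trans x≤u (≈⇒≤ u≈v))

  ≤-isPreorder : IsPreorder _≈_ _≤_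
  ≤-isPreorder = record { isEquivalence = ℝ-Ring.isEquivalence ; reflexive = ≈⇒≤ ; trans = ≤-trans }

  <-asym : x < y → ¬ y < x
  <-asym x<y y<x = <⇒≱ x<y (<⇒≤ y<x)

  module ≤-Reasoning = Relation.Binary.Reasoning.Base.Triple {_≈_ = _≈_} {_≤_} {_<_}
    ≤-isPreorder <-asym <-trans (<-resp-≈ʳ , <-resp-≈ˡ) <⇒≤ <-≤-trans ≤-<-trans

  -- Stability makes case distinctions on reals available when proving ≤ and ≈.
  ≤-stable : ¬ ¬ x ≤ y → x ≤ y
  ≤-stable ¬¬x≤y = ≮⇒≥ λ y<x → ¬¬x≤y (<⇒≱ y<x)

  ≈-stable : ¬ ¬ x ≈ y → x ≈ y
  ≈-stable ¬¬x≈y = ≤-antisym (≤-stable λ k → ¬¬x≈y (k ∘ ≈⇒≤)) (≤-stable λ k → ¬¬x≈y (k ∘ ≈⇒≥))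

  ≤-total : ∀ x y → ¬ ¬ (x ≤ y ⊎ y ≤ x)
  ≤-total x y k = k (inj₁ (≮⇒≥ λ y<x → k (inj₂ (<⇒≤ y<x))))

  +-monoˡ-≤ : ∀ z → x ≤ y → x + z ≤ y + z
  +-monoˡ-≤ z x≤y = +-mono-≤ x≤y ≤-refl

  +-monoʳ-≤ : ∀ z → x ≤ y → z + x ≤ z + y
  +-monoʳ-≤ z x≤y = +-mono-≤ ≤-refl x≤y

  +-mono-<-≤ : x < y → u ≤ v → x + u < y + v
  +-mono-<-≤ {u = u} x<y u≤v = <-≤-trans (+-monoˡ-< u x<y) (+-monoʳ-≤ _ u≤v)

  +-mono-≤-< : x ≤ y → u < v → x + u < y + v
  +-mono-≤-< {x} {y} {u} {v} x≤y u<v = <-resp-≈ˡ (+-comm u x) (<-resp-≈ʳ (+-comm v y) (+-mono-<-≤ u<v x≤y))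

  x≤y⇒0≤y-x : x ≤ y → 0ℝ ≤ y - x
  x≤y⇒0≤y-x {x} {y} x≤y = ≤-resp-≈ (ℝ-Ring.-‿inverseʳ x) ≈-refl (+-monoˡ-≤ (- x) x≤y)

  0≤y-x⇒x≤y : 0ℝ ≤ y - x → x ≤ y
  0≤y-x⇒x≤y {y} {x} h = ≤-resp-≈ (+-identityˡ x)
    (solve 2 (λ x y → (y :+ :- x) :+ x := y) ≈-refl x y) (+-monoˡ-≤ x h)

  x<y⇒0<y-x : x < y → 0ℝ < y - x
  x<y⇒0<y-x {x} {y} x<y = <-resp-≈ˡ (ℝ-Ring.-‿inverseʳ x) (+-monoˡ-< (- x) x<y)

  +-nonNegative : 0ℝ ≤ x → 0ℝ ≤ y → 0ℝ ≤ x + y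
  +-nonNegative 0≤x 0≤y = ≤-resp-≈ (+-identityˡ 0ℝ) ≈-refl (+-mono-≤ 0≤x 0≤y)

  x≤x+y : 0ℝ ≤ y → x ≤ x + y
  x≤x+y {y} {x} 0≤y = ≤-resp-≈ (ℝ-Ring.+-identityʳ x) ≈-refl (+-monoʳ-≤ x 0≤y)

  y≤x+y : 0ℝ ≤ x → y ≤ x + y
  y≤x+y {x} {y} 0≤x = ≤-resp-≈ (+-identityˡ y) ≈-refl (+-monoˡ-≤ y 0≤x)

  ≮0⇒≈0 : 0ℝ ≤ x → ¬ 0ℝ < x → x ≈ 0ℝ
  ≮0⇒≈0 0≤x 0≮x = ≤-antisym (≮⇒≥ 0≮x) 0≤x

  ≈0-or-positive : 0ℝ ≤ x → ¬ ¬ (x ≈ 0ℝ ⊎ 0ℝ < x)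
  ≈0-or-positive 0≤x k = k (inj₁ (≮0⇒≈0 0≤x (k ∘ inj₂)))

  *-nonNegative : 0ℝ ≤ x → 0ℝ ≤ y → 0ℝ ≤ x * y
  *-nonNegative {x} {y} 0≤x 0≤y = ≤-stable λ k →
    ≈0-or-positive 0≤x λ where
      (inj₁ x≈0) → k (≈⇒≥ (≈-trans (*-cong x≈0 ≈-refl) (ℝ-Ring.zeroˡ y)))
      (inj₂ 0<x) → ≈0-or-positive 0≤y λ where
        (inj₁ y≈0) → k (≈⇒≥ (≈-trans (*-cong ≈-refl y≈0) (ℝ-Ring.zeroʳ x)))
        (inj₂ 0<y) → k (<⇒≤ (*-positive 0<x 0<y))

  *-monoʳ-≤ : 0ℝ ≤ z → x ≤ y → z * x ≤ z * y
  *-monoʳ-≤ {z} {x} {y} 0≤z x≤y = 0≤y-x⇒x≤y (≤-resp-≈ ≈-refl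
    (solve 3 (λ x y z → z :* (y :+ :- x) := z :* y :+ :- (z :* x)) ≈-refl x y z)
    (*-nonNegative 0≤z (x≤y⇒0≤y-x x≤y)))

  *-mono-≤ : 0ℝ ≤ x → x ≤ y → 0ℝ ≤ u → u ≤ v → x * u ≤ y * v
  *-mono-≤ {x} {y} {u} {v} 0≤x x≤y 0≤u u≤v = ≤-trans (*-monoʳ-≤ 0≤x u≤v)
    (≤-resp-≈ (*-comm v x) (*-comm v y) (*-monoʳ-≤ (≤-trans 0≤u u≤v) x≤y))

  square-mono-< : 0ℝ ≤ x → x < y → x * x < y * y
  square-mono-< {x} {y} 0≤x x<y = <-resp-≈ˡ (+-identityˡ (x * x)) (<-resp-≈ʳ
    (solve 2 (λ x y → (y :+ :- x) :* (y :+ x) :+ x :* x := y :* y) ≈-refl x y)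
    (+-monoˡ-< (x * x) (*-positive (x<y⇒0<y-x x<y) (<-≤-trans (≤-<-trans 0≤x x<y) (x≤x+y 0≤x)))))

  square-cancel-≤ : 0ℝ ≤ y → x * x ≤ y * y → x ≤ y
  square-cancel-≤ 0≤y x²≤y² = ≮⇒≥ λ y<x → <⇒≱ (square-mono-< 0≤y y<x) x²≤y²

  square-injective : 0ℝ ≤ x → 0ℝ ≤ y → x * x ≈ y * y → x ≈ y
  square-injective 0≤x 0≤y eq =
    ≤-antisym (square-cancel-≤ 0≤y (≈⇒≤ eq)) (square-cancel-≤ 0≤x (≈⇒≥ eq))

  0≤∣x∣ : ∀ x → 0ℝ ≤ ∣ x ∣
  0≤∣x∣ x = ≤-stable λ k → ≤-total 0ℝ x λ where
    (inj₁ 0≤x) → k (≤-trans 0≤x (x≤∣x∣ x))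
    (inj₂ x≤0) → k (≤-trans (≤-resp-≈ (solve 0 (:- con 0ℚ := con 0ℚ) ≈-refl) ≈-refl (neg-mono-≤ x≤0))
                            (-x≤∣x∣ x))

  neg-involutive : ∀ x → - - x ≈ x
  neg-involutive = solve 1 (λ x → :- :- x := x) ≈-refl

  0≤-x : x ≤ 0ℝ → 0ℝ ≤ - x
  0≤-x x≤0 = ≤-resp-≈ (solve 0 (:- con 0ℚ := con 0ℚ) ≈-refl) ≈-refl (neg-mono-≤ x≤0)

  -x≤0 : 0ℝ ≤ x → - x ≤ 0ℝ
  -x≤0 0≤x = ≤-resp-≈ ≈-refl (solve 0 (:- con 0ℚ := con 0ℚ) ≈-refl) (neg-mono-≤ 0≤x)

  ∣-∣-nonNegative : 0ℝ ≤ x → ∣ x ∣ ≈ x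
  ∣-∣-nonNegative {x} 0≤x = ≤-antisym (∣x∣≤y ≤-refl (≤-trans (-x≤0 0≤x) 0≤x)) (x≤∣x∣ x)

  ∣-∣-nonPositive : x ≤ 0ℝ → ∣ x ∣ ≈ - x
  ∣-∣-nonPositive {x} x≤0 = ≤-antisym (∣x∣≤y (≤-trans x≤0 (0≤-x x≤0)) ≤-refl) (-x≤∣x∣ x)

  ∣-∣-cong : x ≈ y → ∣ x ∣ ≈ ∣ y ∣
  ∣-∣-cong {x} {y} x≈y = ≤-antisym
    (∣x∣≤y (≤-trans (≈⇒≤ x≈y) (x≤∣x∣ y)) (≤-trans (≈⇒≤ (neg-cong x≈y)) (-x≤∣x∣ y)))
    (∣x∣≤y (≤-trans (≈⇒≥ x≈y) (x≤∣x∣ x)) (≤-trans (≈⇒≥ (neg-cong x≈y)) (-x≤∣x∣ x)))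

  ∣-x∣≈∣x∣ : ∀ x → ∣ - x ∣ ≈ ∣ x ∣
  ∣-x∣≈∣x∣ x = ≤-antisym
    (∣x∣≤y (-x≤∣x∣ x) (≤-trans (≈⇒≤ (neg-involutive x)) (x≤∣x∣ x)))
    (∣x∣≤y (≤-trans (≈⇒≥ (neg-involutive x)) (-x≤∣x∣ (- x))) (x≤∣x∣ (- x)))

  ∣x-y∣≈∣y-x∣ : ∀ x y → ∣ x - y ∣ ≈ ∣ y - x ∣
  ∣x-y∣≈∣y-x∣ x y = ≈-trans
    (∣-∣-cong (solve 2 (λ x y → x :+ :- y := :- (y :+ :- x)) ≈-refl x y)) (∣-x∣≈∣x∣ (y - x))

  ∣x+y∣≤∣x∣+∣y∣ : ∀ x y → ∣ x + y ∣ ≤ ∣ x ∣ + ∣ y ∣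
  ∣x+y∣≤∣x∣+∣y∣ x y = ∣x∣≤y (+-mono-≤ (x≤∣x∣ x) (x≤∣x∣ y))
    (≤-resp-≈ (solve 2 (λ x y → :- x :+ :- y := :- (x :+ y)) ≈-refl x y) ≈-refl
      (+-mono-≤ (-x≤∣x∣ x) (-x≤∣x∣ y)))

  ∣x*y∣≤∣x∣*∣y∣ : ∀ x y → ∣ x * y ∣ ≤ ∣ x ∣ * ∣ y ∣
  ∣x*y∣≤∣x∣*∣y∣ x y = ≤-stable λ k →
    ≤-total 0ℝ x λ where
      (inj₁ 0≤x) → ≤-total 0ℝ y λ where
        (inj₁ 0≤y) → k (≈⇒≤ (≈-trans (∣-∣-nonNegative (*-nonNegative 0≤x 0≤y))
          (≈-sym (*-cong (∣-∣-nonNegative 0≤x) (∣-∣-nonNegative 0≤y)))))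
        (inj₂ y≤0) → k (≈⇒≤ (≈-trans (neg-product
            (solve 2 (λ x y → x :* :- y := :- (x :* y)) ≈-refl x y) (*-nonNegative 0≤x (0≤-x y≤0)))
          (≈-sym (*-cong (∣-∣-nonNegative 0≤x) (∣-∣-nonPositive y≤0)))))
      (inj₂ x≤0) → ≤-total 0ℝ y λ where
        (inj₁ 0≤y) → k (≈⇒≤ (≈-trans (neg-product
            (solve 2 (λ x y → :- x :* y := :- (x :* y)) ≈-refl x y) (*-nonNegative (0≤-x x≤0) 0≤y))
          (≈-sym (*-cong (∣-∣-nonPositive x≤0) (∣-∣-nonNegative 0≤y)))))
        (inj₂ y≤0) → k (≈⇒≤ (≈-trans (≈-trans (∣-∣-cong (solve 2 (λ x y → x :* y := :- x :* :- y) ≈-refl x y))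
            (∣-∣-nonNegative (*-nonNegative (0≤-x x≤0) (0≤-x y≤0))))
          (≈-sym (*-cong (∣-∣-nonPositive x≤0) (∣-∣-nonPositive y≤0)))))
    where
    neg-product : u ≈ - v → 0ℝ ≤ u → ∣ v ∣ ≈ u
    neg-product {u} {v} u≈-v 0≤u = ≈-trans (≈-sym (∣-x∣≈∣x∣ v))
      (≈-trans (∣-∣-cong (≈-sym u≈-v)) (∣-∣-nonNegative 0≤u))

  ∣x-y∣≤ε : x ≤ y + z → y ≤ x + z → ∣ x - y ∣ ≤ z
  ∣x-y∣≤ε {x} {y} {z} p q = ∣x∣≤y
    (≤-resp-≈ ≈-refl (solve 2 (λ y z → (y :+ z) :+ :- y := z) ≈-refl y z) (+-monoˡ-≤ (- y) p))
    (≤-resp-≈ (solve 2 (λ x y → y :+ :- x := :- (x :+ :- y)) ≈-refl x y)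
              (solve 2 (λ x z → (x :+ z) :+ :- x := z) ≈-refl x z) (+-monoˡ-≤ (- x) q))

  x≤y+∣x-y∣ : ∀ x y → x ≤ y + ∣ x - y ∣
  x≤y+∣x-y∣ x y = ≤-resp-≈ (solve 2 (λ x y → y :+ (x :+ :- y) := x) ≈-refl x y) ≈-refl
    (+-monoʳ-≤ y (x≤∣x∣ (x - y)))

  ∣∣x∣-∣y∣∣≤∣x-y∣ : ∀ x y → ∣ ∣ x ∣ - ∣ y ∣ ∣ ≤ ∣ x - y ∣
  ∣∣x∣-∣y∣∣≤∣x-y∣ x y = ∣x-y∣≤ε (bound x y)
    (≤-trans (bound y x) (+-monoʳ-≤ _ (≈⇒≤ (∣x-y∣≈∣y-x∣ y x))))
    where
    bound : ∀ x y → ∣ x ∣ ≤ ∣ y ∣ + ∣ x - y ∣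
    bound x y = ≤-trans (≈⇒≤ (∣-∣-cong (solve 2 (λ x y → x := y :+ (x :+ :- y)) ≈-refl x y)))
      (∣x+y∣≤∣x∣+∣y∣ y (x - y))

  -- This is max (x, 0). The closed formula replaces a case distinction on the sign and makes
  -- continuity immediate.
  pos : ℝ → ℝ
  pos x = fromℚ ½ * (x + ∣ x ∣)

  pos-cong : x ≈ y → pos x ≈ pos y
  pos-cong x≈y = *-cong ≈-refl (+-cong x≈y (∣-∣-cong x≈y))

  pos-nonNegative : 0ℝ ≤ x → pos x ≈ x
  pos-nonNegative {x} 0≤x = ≈-trans (*-cong ≈-refl (+-cong ≈-refl (∣-∣-nonNegative 0≤x)))
    (solve 1 (λ x → con ½ :* (x :+ x) := x) ≈-refl x)

  pos-nonPositive : x ≤ 0ℝ → pos x ≈ 0ℝ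
  pos-nonPositive {x} x≤0 = ≈-trans (*-cong ≈-refl (+-cong ≈-refl (∣-∣-nonPositive x≤0)))
    (solve 1 (λ x → con ½ :* (x :+ :- x) := con 0ℚ) ≈-refl x)

  0≤pos : ∀ x → 0ℝ ≤ pos x
  0≤pos x = ≤-stable λ k → ≤-total 0ℝ x λ where
    (inj₁ 0≤x) → k (≤-resp-≈ ≈-refl (≈-sym (pos-nonNegative 0≤x)) 0≤x)
    (inj₂ x≤0) → k (≈⇒≥ (pos-nonPositive x≤0))

  pos-≤ : 0ℝ ≤ y → x ≤ y → pos x ≤ y
  pos-≤ {y} {x} 0≤y x≤y = ≤-stable λ k → ≤-total 0ℝ x λ where
    (inj₁ 0≤x) → k (≤-trans (≈⇒≤ (pos-nonNegative 0≤x)) x≤y)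
    (inj₂ x≤0) → k (≤-trans (≈⇒≤ (pos-nonPositive x≤0)) 0≤y)

  x≤pos : ∀ x → x ≤ pos x
  x≤pos x = ≤-stable λ k → ≤-total 0ℝ x λ where
    (inj₁ 0≤x) → k (≈⇒≥ (pos-nonNegative 0≤x))
    (inj₂ x≤0) → k (≤-trans x≤0 (0≤pos x))

  pos-posneg : ∀ x → pos x - pos (- x) ≈ x
  pos-posneg x = ≈-trans (+-cong ≈-refl (neg-cong (*-cong ≈-refl (+-cong ≈-refl (∣-x∣≈∣x∣ x)))))
    (solve 2 (λ x a → con ½ :* (x :+ a) :+ :- (con ½ :* (:- x :+ a)) := x) ≈-refl x ∣ x ∣)

  pos*posneg : ∀ x → ¬ (0ℝ < pos x × 0ℝ < pos (- x))
  pos*posneg x (p , q) = ≤-total 0ℝ x λ where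
    (inj₁ 0≤x) → <⇒≱ q (≈⇒≤ (pos-nonPositive (-x≤0 0≤x)))
    (inj₂ x≤0) → <⇒≱ p (≈⇒≤ (pos-nonPositive x≤0))

  sqrt-unique : 0ℝ ≤ y → y * y ≈ ∣ x ∣ → sqrt x ≈ y
  sqrt-unique {y} {x} 0≤y y² = square-injective (sqrt≥0 x) 0≤y (≈-trans (sqrt² x) (≈-sym y²))

  sqrt-cong : x ≈ y → sqrt x ≈ sqrt y
  sqrt-cong {x} {y} x≈y = sqrt-unique (sqrt≥0 y) (≈-trans (sqrt² y) (∣-∣-cong (≈-sym x≈y)))

  sqrt-square : 0ℝ ≤ x → sqrt (x * x) ≈ x
  sqrt-square 0≤x = sqrt-unique 0≤x (≈-sym (∣-∣-nonNegative (*-nonNegative 0≤x 0≤x)))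

  square-sqrt : 0ℝ ≤ x → sqrt x * sqrt x ≈ x
  square-sqrt {x} 0≤x = ≈-trans (sqrt² x) (∣-∣-nonNegative 0≤x)

  -- (√u)² = |u| ≤ |v| + z² ≤ (√v + z)². Tolerance z² in the argument suffices for z in the root,
  -- also near 0, where the square root is not Lipschitz.
  sqrt-close : 0ℝ ≤ z → ∣ x - y ∣ ≤ z * z → ∣ sqrt x - sqrt y ∣ ≤ z
  sqrt-close {z} {x} {y} 0≤z d = ∣x-y∣≤ε (bound d) (bound (≤-trans (≈⇒≤ (∣x-y∣≈∣y-x∣ y x)) d))
    where
    open ≤-Reasoning
    bound : ∣ u - v ∣ ≤ z * z → sqrt u ≤ sqrt v + z
    bound {u} {v} d = square-cancel-≤ (+-nonNegative (sqrt≥0 v) 0≤z) (begin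
      sqrt u * sqrt u                                      ≈⟨ sqrt² u ⟩
      ∣ u ∣                                                ≤⟨ x≤y+∣x-y∣ ∣ u ∣ ∣ v ∣ ⟩
      ∣ v ∣ + ∣ ∣ u ∣ - ∣ v ∣ ∣                            ≤⟨ +-monoʳ-≤ ∣ v ∣ (≤-trans (∣∣x∣-∣y∣∣≤∣x-y∣ u v) d) ⟩
      ∣ v ∣ + z * z                                        ≈⟨ +-cong (sqrt² v) ≈-refl ⟨
      sqrt v * sqrt v + z * z                              ≤⟨ x≤x+y (*-nonNegative 0≤z (+-nonNegative (sqrt≥0 v) (sqrt≥0 v))) ⟩
      sqrt v * sqrt v + z * z + z * (sqrt v + sqrt v)      ≈⟨ solve 2 (λ s z → s :* s :+ z :* z :+ z :* (s :+ s)
                                                                := (s :+ z) :* (s :+ z)) ≈-refl (sqrt v) z ⟩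
      (sqrt v + z) * (sqrt v + z)                          ∎)

  ⊓>0 : ∀ {p q} → 0ℚ ℚ.< p → 0ℚ ℚ.< q → 0ℚ ℚ.< p ℚ.⊓ q
  ⊓>0 {p} {q} p>0 q>0 with ℚ.⊓-sel p q
  ... | inj₁ eq = subst (0ℚ ℚ.<_) (sym eq) p>0
  ... | inj₂ eq = subst (0ℚ ℚ.<_) (sym eq) q>0

  -- Continuity over an abstract nearness relation, for points and for point-time pairs

  module Continuity (P : Set) (Near : ℚ → P → P → Set)
    (weaken : ∀ {δ η} p q → δ ℚ.≤ η → Near δ p q → Near η p q) where

    IsContinuous : (P → ℝ) → Set
    IsContinuous f = ∀ p ε → 0ℚ ℚ.< ε →
      ∃[ δ ] 0ℚ ℚ.< δ × (∀ q → Near δ p q → ∣ f p - f q ∣ < fromℚ ε)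

    private
      variable
        f g : P → ℝ

    both : IsContinuous f → IsContinuous g → ∀ p ε η → 0ℚ ℚ.< ε → 0ℚ ℚ.< η →
      ∃[ δ ] 0ℚ ℚ.< δ × (∀ q → Near δ p q → ∣ f p - f q ∣ < fromℚ ε × ∣ g p - g q ∣ < fromℚ η)
    both cf cg p ε η ε>0 η>0 =
      let γ , γ>0 , closeF = cf p ε ε>0
          δ , δ>0 , closeG = cg p η η>0
      in γ ℚ.⊓ δ , ⊓>0 γ>0 δ>0 , λ q c →
           closeF q (weaken p q (ℚ.p⊓q≤p γ δ) c) , closeG q (weaken p q (ℚ.p⊓q≤q γ δ) c)

    nonexpansive : (∀ p q → ∣ g p - g q ∣ ≤ ∣ f p - f q ∣) → IsContinuous f → IsContinuous g
    nonexpansive h cf p ε ε>0 =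
      let δ , δ>0 , close = cf p ε ε>0
      in δ , δ>0 , λ q c → ≤-<-trans (h p q) (close q c)

    const-continuous : ∀ c → IsContinuous λ _ → c
    const-continuous c p ε ε>0 = 1ℚ , ℚ.positive⁻¹ 1ℚ , λ q _ →
      ≤-<-trans (∣x-y∣≤ε (≈⇒≥ (ℝ-Ring.+-identityʳ c)) (≈⇒≥ (ℝ-Ring.+-identityʳ c))) (fromℚ-mono-< ε>0)

    +-continuous : IsContinuous f → IsContinuous g → IsContinuous λ p → f p + g p
    +-continuous {f} {g} cf cg p ε ε>0 =
      let δ , δ>0 , close = both cf cg p (½ ℚ.* ε) (½ ℚ.* ε) (half>0 ε>0) (half>0 ε>0)
      in δ , δ>0 , λ q c → begin-strict
        ∣ (f p + g p) - (f q + g q) ∣        ≈⟨ ∣-∣-cong (solve 4 (λ a b c d → (a :+ b) :+ :- (c :+ d)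
                                                  := (a :+ :- c) :+ (b :+ :- d)) ≈-refl (f p) (g p) (f q) (g q)) ⟩
        ∣ (f p - f q) + (g p - g q) ∣        ≤⟨ ∣x+y∣≤∣x∣+∣y∣ _ _ ⟩
        ∣ f p - f q ∣ + ∣ g p - g q ∣        <⟨ +-mono-<-≤ (proj₁ (close q c)) (<⇒≤ (proj₂ (close q c))) ⟩
        fromℚ (½ ℚ.* ε) + fromℚ (½ ℚ.* ε)    ≈⟨ fromℚ-+ _ _ ⟨
        fromℚ (½ ℚ.* ε ℚ.+ ½ ℚ.* ε)          ≡⟨ cong fromℚ (half+half ε) ⟩
        fromℚ ε                              ∎
      where
      open ≤-Reasoning

    neg-continuous : IsContinuous f → IsContinuous λ p → - f p
    neg-continuous {f} = nonexpansive λ p q → ≈⇒≤ (≈-trans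
      (∣-∣-cong (solve 2 (λ x y → :- x :+ :- :- y := :- (x :+ :- y)) ≈-refl (f p) (f q)))
      (∣-x∣≈∣x∣ _))

    ∣-∣-continuous : IsContinuous f → IsContinuous λ p → ∣ f p ∣
    ∣-∣-continuous = nonexpansive λ p q → ∣∣x∣-∣y∣∣≤∣x-y∣ _ _

    *-continuous : IsContinuous f → IsContinuous g → IsContinuous λ p → f p * g p
    *-continuous {f} {g} cf cg p ε ε>0 =
      let B , B>0 , a≤B = bounded (f p)
          C , C>0 , b≤C = bounded (g p)
          -- The difference of the products is a (b - b′) + (a - a′) b′. Capping the tolerance for
          -- `g` at 1 gives |b′| ≤ C + 1, so the whole is at most B η + η (C + 1) = D η.
          D             = B ℚ.+ (C ℚ.+ 1ℚ)
          D>0           = ℚ.+-mono-< B>0 (ℚ.+-mono-< C>0 (ℚ.positive⁻¹ 1ℚ))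
          η , η>0 , Dη  = divide D (½ ℚ.* ε) D>0 (half>0 ε>0)
          δ , δ>0 , close = both cf cg p η (η ℚ.⊓ 1ℚ) η>0 (⊓>0 η>0 (ℚ.positive⁻¹ 1ℚ))
      in δ , δ>0 , λ q c →
        let a = f p ; b = g p ; a′ = f q ; b′ = g q
            a-a′≤η = <⇒≤ (proj₁ (close q c))
            b-b′≤  = λ {r} (h : η ℚ.⊓ 1ℚ ℚ.≤ r) → ≤-trans (<⇒≤ (proj₂ (close q c))) (fromℚ-mono-≤ h)
            b′≤C+1 : ∣ b′ ∣ ≤ fromℚ (C ℚ.+ 1ℚ)
            b′≤C+1 = begin
              ∣ b′ ∣                   ≈⟨ ∣-∣-cong (solve 2 (λ b c → c := b :+ (c :+ :- b)) ≈-refl b b′) ⟩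
              ∣ b + (b′ - b) ∣         ≤⟨ ∣x+y∣≤∣x∣+∣y∣ b (b′ - b) ⟩
              ∣ b ∣ + ∣ b′ - b ∣       ≤⟨ +-mono-≤ b≤C (≤-trans (≈⇒≤ (∣x-y∣≈∣y-x∣ b′ b)) (b-b′≤ (ℚ.p⊓q≤q η 1ℚ))) ⟩
              fromℚ C + fromℚ 1ℚ       ≈⟨ fromℚ-+ C 1ℚ ⟨
              fromℚ (C ℚ.+ 1ℚ)         ∎
        in begin-strict
          ∣ a * b - a′ * b′ ∣            ≈⟨ ∣-∣-cong (solve 4 (λ a b c d → a :* b :+ :- (c :* d)
                                            := a :* (b :+ :- d) :+ (a :+ :- c) :* d) ≈-refl a b a′ b′) ⟩
          ∣ a * (b - b′) + (a - a′) * b′ ∣            ≤⟨ ∣x+y∣≤∣x∣+∣y∣ _ _ ⟩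
          ∣ a * (b - b′) ∣ + ∣ (a - a′) * b′ ∣        ≤⟨ +-mono-≤ (∣x*y∣≤∣x∣*∣y∣ _ _) (∣x*y∣≤∣x∣*∣y∣ _ _) ⟩
          ∣ a ∣ * ∣ b - b′ ∣ + ∣ a - a′ ∣ * ∣ b′ ∣    ≤⟨ +-mono-≤
            (*-mono-≤ (0≤∣x∣ a) a≤B (0≤∣x∣ _) (b-b′≤ (ℚ.p⊓q≤p η 1ℚ)))
            (*-mono-≤ (0≤∣x∣ _) a-a′≤η (0≤∣x∣ b′) b′≤C+1) ⟩
          fromℚ B * fromℚ η + fromℚ η * fromℚ (C ℚ.+ 1ℚ)
            ≈⟨ solve 3 (λ b e c → b :* e :+ e :* c := (b :+ c) :* e) ≈-refl (fromℚ B) (fromℚ η) (fromℚ (C ℚ.+ 1ℚ)) ⟩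
          (fromℚ B + fromℚ (C ℚ.+ 1ℚ)) * fromℚ η      ≈⟨ *-cong (fromℚ-+ B (C ℚ.+ 1ℚ)) ≈-refl ⟨
          fromℚ D * fromℚ η                           ≈⟨ fromℚ-* D η ⟨
          fromℚ (D ℚ.* η)                             ≡⟨ cong fromℚ Dη ⟩
          fromℚ (½ ℚ.* ε)                             <⟨ fromℚ-mono-< (half<whole ε>0) ⟩
          fromℚ ε                                     ∎
      where open ≤-Reasoning

    pos-continuous : IsContinuous f → IsContinuous λ p → pos (f p)
    pos-continuous cf = *-continuous (const-continuous (fromℚ ½)) (+-continuous cf (∣-∣-continuous cf))

    sqrt-continuous : IsContinuous f → IsContinuous λ p → sqrt (f p)
    sqrt-continuous {f} cf p ε ε>0 =
      let δ , δ>0 , close = cf p (h ℚ.* h) h²>0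
      in δ , δ>0 , λ q c → ≤-<-trans
        (sqrt-close (<⇒≤ (fromℚ-mono-< (half>0 ε>0)))
          (≤-trans (<⇒≤ (close q c)) (≈⇒≤ (fromℚ-* h h))))
        (fromℚ-mono-< (half<whole ε>0))
      where
      h : ℚ
      h = ½ ℚ.* ε
      h²>0 : 0ℚ ℚ.< h ℚ.* h
      h²>0 = subst (ℚ._< h ℚ.* h) (ℚ.*-zeroʳ h) (ℚ.*-monoʳ-<-pos h {{ℚ.positive (half>0 ε>0)}} (half>0 ε>0))

    uniform : ∀ {n} (F : Fin n → P → ℝ) → (∀ i → IsContinuous (F i)) → ∀ p ε → 0ℚ ℚ.< ε →
      ∃[ δ ] 0ℚ ℚ.< δ × (∀ q → Near δ p q → ∀ i → ∣ F i p - F i q ∣ < fromℚ ε)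
    uniform {ℕ.zero}  F cF p ε ε>0 = 1ℚ , ℚ.positive⁻¹ 1ℚ , λ _ _ ()
    uniform {ℕ.suc n} F cF p ε ε>0 =
      let γ , γ>0 , close₀ = cF zero p ε ε>0
          δ , δ>0 , close₁ = uniform (F ∘ suc) (cF ∘ suc) p ε ε>0
      in γ ℚ.⊓ δ , ⊓>0 γ>0 δ>0 , λ where
        q c zero    → close₀ q (weaken p q (ℚ.p⊓q≤p γ δ) c)
        q c (suc i) → close₁ q (weaken p q (ℚ.p⊓q≤q γ δ) c) i

-- Pairs of which one is zero, and differences of square roots

module HomotopyEquivalence where
  open import Defs using (ℝ; fromℚ; 0ℝ; 1ℝ; unitSphere; Space; Continuous; Interval; JointlyContinuous; IsSupport)
  import Defs as D
  import Algebra.Properties.CommutativeMonoid.Sum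
  open import Data.Fin.Subset.Properties using (nonempty?)
  open import Data.Integer.Base as ℤ using (+_)
  import Data.Integer.Properties as ℤ
  open import Data.Rational as ℚ using (ℚ; 0ℚ; 1ℚ)
  import Data.Rational.Properties as ℚ
  open import Data.Vec.Base using (tabulate)
  open import Data.Vec.Properties using ([]=⇒lookup; lookup⇒[]=; lookup∘tabulate)
  open import Relation.Nullary.Decidable using (dec-true; ¬¬-excluded-middle)

  open Combinatorics
  open Reals
  open ℝ-Solver using (solve; _:=_; _:+_; _:*_; :-_; con)
  open Algebra.Properties.CommutativeMonoid.Sum ℝ-Ring.+-commutativeMonoid
    using (sum; sum-cong-≋; sum-cong-≗; ∑-distrib-+)

  ≡⇒≈ : x ≡ y → x ≈ y
  ≡⇒≈ refl = ≈-refl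

  infix 4 _⊥_
  -- For a , b ≥ 0 this is a constructive form of a b = 0.
  _⊥_ : ℝ → ℝ → Set
  a ⊥ b = ¬ (0ℝ < a × 0ℝ < b)

  ⊥-sym : x ⊥ y → y ⊥ x
  ⊥-sym x⊥y (p , q) = x⊥y (q , p)

  ⊥-mono : x ≤ y → u ≤ v → y ⊥ v → x ⊥ u
  ⊥-mono x≤y u≤v y⊥v (p , q) = y⊥v (<-≤-trans p x≤y , <-≤-trans q u≤v)

  ⊥⇒≈0 : 0ℝ ≤ x → 0ℝ ≤ y → x ⊥ y → ¬ ¬ (x ≈ 0ℝ ⊎ y ≈ 0ℝ)
  ⊥⇒≈0 0≤x 0≤y x⊥y k = ≈0-or-positive 0≤x λ where
    (inj₁ x≈0) → k (inj₁ x≈0)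
    (inj₂ 0<x) → k (inj₂ (≮0⇒≈0 0≤y λ 0<y → x⊥y (0<x , 0<y)))

  ≈0⇒⊥ : x ≈ 0ℝ → x ⊥ y
  ≈0⇒⊥ x≈0 (0<x , _) = <⇒≱ 0<x (≈⇒≤ x≈0)

  +-⊥ : 0ℝ ≤ x → 0ℝ ≤ y → x ⊥ z → y ⊥ z → x + y ⊥ z
  +-⊥ {x} {y} 0≤x 0≤y x⊥z y⊥z (p , 0<z) = <⇒≱ p (≈⇒≤ (≈-trans
    (+-cong (≮0⇒≈0 0≤x λ 0<x → x⊥z (0<x , 0<z)) (≮0⇒≈0 0≤y λ 0<y → y⊥z (0<y , 0<z)))
    (+-identityˡ 0ℝ)))

  square-⊥ : 0ℝ ≤ x → 0ℝ ≤ y → x ⊥ y → x * x ⊥ y * y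
  square-⊥ {x} {y} 0≤x 0≤y x⊥y (p , q) = ⊥⇒≈0 0≤x 0≤y x⊥y λ where
    (inj₁ x≈0) → <⇒≱ p (≈⇒≤ (≈-trans (*-cong x≈0 ≈-refl) (ℝ-Ring.zeroˡ x)))
    (inj₂ y≈0) → <⇒≱ q (≈⇒≤ (≈-trans (*-cong y≈0 ≈-refl) (ℝ-Ring.zeroˡ y)))

  sqrt-0 : x ≈ 0ℝ → sqrt x ≈ 0ℝ
  sqrt-0 x≈0 = ≈-trans (sqrt-cong (≈-trans x≈0 (≈-sym (ℝ-Ring.zeroˡ 0ℝ)))) (sqrt-square ≤-refl)

  signed : Bool → ℝ → ℝ
  signed true  x = x
  signed false x = - x

  -- (a , b) ↦ √a − √b is inverse to x ↦ (x₊² , x₋²) on pairs of which one is zero.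
  sqrt-difference-pos : ∀ {a b} → 0ℝ ≤ a → 0ℝ ≤ b → a ⊥ b →
    pos (sqrt a - sqrt b) * pos (sqrt a - sqrt b) ≈ a
  sqrt-difference-pos {a} {b} 0≤a 0≤b a⊥b = ≈-stable λ k → ⊥⇒≈0 0≤a 0≤b a⊥b λ where
    (inj₁ a≈0) → let p≈0 = pos-nonPositive (≤-trans (≈⇒≤ (≈-trans (+-cong (sqrt-0 a≈0) ≈-refl) (+-identityˡ _)))
                                                    (-x≤0 (sqrt≥0 b)))
                 in k (≈-trans (*-cong p≈0 p≈0) (≈-trans (ℝ-Ring.zeroˡ 0ℝ) (≈-sym a≈0)))
    (inj₂ b≈0) → let d≈ = ≈-trans (+-cong ≈-refl (neg-cong (sqrt-0 b≈0)))
                            (solve 1 (λ s → s :+ :- con 0ℚ := s) ≈-refl (sqrt a))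
                     p≈ = ≈-trans (pos-cong d≈) (pos-nonNegative (sqrt≥0 a))
                 in k (≈-trans (*-cong p≈ p≈) (square-sqrt 0≤a))

  sqrt-difference-signed : ∀ {a : Bool → ℝ} → (∀ c → 0ℝ ≤ a c) → a true ⊥ a false → ∀ c →
    let p = pos (signed c (sqrt (a true) - sqrt (a false))) in p * p ≈ a c
  sqrt-difference-signed 0≤a a⊥b true  = sqrt-difference-pos (0≤a true) (0≤a false) a⊥b
  sqrt-difference-signed {a} 0≤a a⊥b false = ≈-trans (*-cong flip flip)
    (sqrt-difference-pos (0≤a false) (0≤a true) (⊥-sym a⊥b))
    where
    flip : pos (- (sqrt (a true) - sqrt (a false))) ≈ pos (sqrt (a false) - sqrt (a true))
    flip = pos-cong (solve 2 (λ s t → :- (s :+ :- t) := t :+ :- s) ≈-refl (sqrt (a true)) (sqrt (a false)))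

  square-pos-parts : ∀ x → pos x * pos x + pos (- x) * pos (- x) ≈ x * x
  square-pos-parts x = ≈-stable λ k → ≤-total 0ℝ x λ where
    (inj₁ 0≤x) → let p = pos-nonNegative 0≤x ; q = pos-nonPositive (-x≤0 0≤x) in
      k (≈-trans (+-cong (*-cong p p) (*-cong q q)) (solve 1 (λ x → x :* x :+ con 0ℚ :* con 0ℚ := x :* x) ≈-refl x))
    (inj₂ x≤0) → let p = pos-nonPositive x≤0 ; q = pos-nonNegative (0≤-x x≤0) in
      k (≈-trans (+-cong (*-cong p p) (*-cong q q))
        (solve 1 (λ x → con 0ℚ :* con 0ℚ :+ :- x :* :- x := x :* x) ≈-refl x))

  -- Sums over initial segments of ℕ, and the division into blocks of two

  Σ[<_] : ∀ n → (ℕ → ℝ) → ℝ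
  Σ[< n ] f = sum {n} (f ∘ toℕ)

  Σ-cong : ∀ n {f g : ℕ → ℝ} → (∀ i → f i ≈ g i) → Σ[< n ] f ≈ Σ[< n ] g
  Σ-cong n eq = sum-cong-≋ {n} (eq ∘ toℕ)

  Σ-zero : ∀ n {f : ℕ → ℝ} → (∀ i → f i ≈ 0ℝ) → Σ[< n ] f ≈ 0ℝ
  Σ-zero zero    z = ≈-refl
  Σ-zero (suc n) z = ≈-trans (+-cong (z 0) (Σ-zero n (z ∘ suc))) (+-identityˡ 0ℝ)

  Σ-extend : ∀ {n m} → n ℕ.≤ m → ∀ {f : ℕ → ℝ} → (∀ i → n ℕ.≤ i → f i ≈ 0ℝ) → Σ[< n ] f ≈ Σ[< m ] f
  Σ-extend {m = m} z≤n vanish = ≈-sym (Σ-zero m λ i → vanish i z≤n)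
  Σ-extend (s≤s n≤m) vanish = +-cong ≈-refl (Σ-extend n≤m λ i n≤i → vanish (suc i) (s≤s n≤i))

  Σ-pairs : ∀ k (f : ℕ → ℝ) → Σ[< k ℕ.* 2 ] f ≈ Σ[< k ] λ j → f (j ℕ.* 2) + f (suc (j ℕ.* 2))
  Σ-pairs zero    f = ≈-refl
  Σ-pairs (suc k) f = ≈-trans (≈-sym (+-assoc (f 0) (f 1) _)) (+-cong ≈-refl (Σ-pairs k λ i → f (suc (suc i))))

  Σ-nonNegative : ∀ n {f : ℕ → ℝ} → (∀ i → 0ℝ ≤ f i) → 0ℝ ≤ Σ[< n ] f
  Σ-nonNegative zero    _ = ≤-refl
  Σ-nonNegative (suc n) p = +-nonNegative (p 0) (Σ-nonNegative n (p ∘ suc))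

  term≤Σ : ∀ {n i} → i ℕ.< n → ∀ {f : ℕ → ℝ} → (∀ i → 0ℝ ≤ f i) → f i ≤ Σ[< n ] f
  term≤Σ {suc n} {zero}  _          p = x≤x+y (Σ-nonNegative n (p ∘ suc))
  term≤Σ {suc n} {suc i} (s≤s i<n)  p = ≤-trans (term≤Σ i<n (p ∘ suc)) (y≤x+y (p 0))

  -- Recursion by two steps matches `suc j ℕ.* 2`, which computes to two successors, and lets
  -- continuity of all entries be proved by the same recursion.
  spread : {X : Set} → (even odd : ℕ → X) → ℕ → X
  spread e o zero          = e 0
  spread e o (suc zero)    = o 0
  spread e o (suc (suc i)) = spread (e ∘ suc) (o ∘ suc) i

  spread-even : ∀ {X : Set} (e o : ℕ → X) j → spread e o (j ℕ.* 2) ≡ e j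
  spread-even e o zero    = refl
  spread-even e o (suc j) = spread-even (e ∘ suc) (o ∘ suc) j

  spread-odd : ∀ {X : Set} (e o : ℕ → X) j → spread e o (suc (j ℕ.* 2)) ≡ o j
  spread-odd e o zero    = refl
  spread-odd e o (suc j) = spread-odd (e ∘ suc) (o ∘ suc) j

  data Parity : ℕ → Set where
    even : ∀ j → Parity (j ℕ.* 2)
    odd  : ∀ j → Parity (suc (j ℕ.* 2))

  parity : ∀ i → Parity i
  parity zero       = even 0
  parity (suc zero) = odd 0
  parity (suc (suc i)) with parity i
  ... | even j = even (suc j)
  ... | odd  j = odd (suc j)

  half : ∀ {i} → Parity i → ℕ
  half (even j) = j
  half (odd j)  = j

  half-bounds : ∀ {i} (p : Parity i) → half p ℕ.* 2 ℕ.≤ i × i ℕ.≤ suc (half p ℕ.* 2)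
  half-bounds (even j) = ℕ.≤-refl , ℕ.n≤1+n _
  half-bounds (odd j)  = ℕ.n≤1+n _ , ℕ.≤-refl

  -- With h the half of `i`, the chain 2h + 2 ≤ i′ ≤ i + 1 ≤ 2h + 2 consists of equalities.
  -- Neighbours in different blocks are thus the odd index of one and the even index of the next.
  consecutive-blocks : ∀ {i i′} (p : Parity i) (q : Parity i′) → half p ℕ.< half q → i′ ℕ.≤ suc i →
    i ≡ suc (half p ℕ.* 2) × i′ ≡ suc (half p) ℕ.* 2
  consecutive-blocks p q hp<hq i′≤1+i =
      ℕ.≤-antisym (proj₂ (half-bounds p)) (ℕ.≤-pred (ℕ.≤-trans next≤i′ i′≤1+i))
    , ℕ.≤-antisym (ℕ.≤-trans i′≤1+i (s≤s (proj₂ (half-bounds p)))) next≤i′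
    where next≤i′ = ℕ.≤-trans (ℕ.*-monoˡ-≤ 2 hp<hq) (proj₁ (half-bounds q))

  -- Points of the complex as weights on direction and index

  Weight : Set
  Weight = Bool → ℕ → ℝ

  mass : Weight → Bool → ℕ → ℝ
  mass G b j = G b (j ℕ.* 2) + G b (suc (j ℕ.* 2))

  -- G b i stands for the barycentric coordinate at edgeOf b i; the k blocks are {2j , 2j+1}.
  record IsWeight (n k : ℕ) (G : Weight) : Set where
    field
      nonNegative : ∀ b i → 0ℝ ≤ G b i
      vanishing   : ∀ b i → n ℕ.≤ i → G b i ≈ 0ℝ
      total       : Σ[< k ] (λ j → mass G true j + mass G false j) ≈ 1ℝ
      disjoint    : ∀ i j → Close i j → G true i ⊥ G false j

    disjoint′ : ∀ b i j → Close i j → G b i ⊥ G (not b) j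
    disjoint′ true  i j c       = disjoint i j c
    disjoint′ false i j (p , q) = ⊥-sym (disjoint j i (q , p))

    mass-nonNegative : ∀ b j → 0ℝ ≤ mass G b j
    mass-nonNegative b j = +-nonNegative (nonNegative b _) (nonNegative b _)

    -- Any two indices in {2j , 2j+1} differ by at most 1, so all four pairs of opposite edges
    -- within a block conflict.
    mass-⊥ : ∀ j → mass G true j ⊥ mass G false j
    mass-⊥ j = +-⊥ (nonNegative true _) (nonNegative true _)
        (row m (up , up) (ℕ.m≤n⇒m≤1+n up , ℕ.≤-refl)) (row (suc m) (ℕ.≤-refl , ℕ.m≤n⇒m≤1+n up) (up , up))
      where
      m : ℕ
      m = j ℕ.* 2
      up : ∀ {m} → m ℕ.≤ suc m
      up = ℕ.n≤1+n _
      row : ∀ i → Close i m → Close i (suc m) → G true i ⊥ mass G false j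
      row i c d = ⊥-sym (+-⊥ (nonNegative false _) (nonNegative false _)
        (⊥-sym (disjoint i m c)) (⊥-sym (disjoint i (suc m) d)))

    ≤mass : ∀ b {i} (p : Parity i) → G b i ≤ mass G b (half p)
    ≤mass b (even j) = x≤x+y (nonNegative b _)
    ≤mass b (odd j)  = y≤x+y (nonNegative b _)

    mass≤1 : ∀ b j → j ℕ.< k → mass G b j ≤ 1ℝ
    mass≤1 b j j<k = ≤-trans (part b) (≤-trans
        (term≤Σ j<k λ j → +-nonNegative (mass-nonNegative true j) (mass-nonNegative false j)) (≈⇒≤ total))
      where
      part : ∀ b → mass G b j ≤ mass G true j + mass G false j
      part true  = x≤x+y (mass-nonNegative false j)
      part false = y≤x+y (mass-nonNegative true j)

  -- The maps to and from the sphere and the folding, on weights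

  module Blocks {n k : ℕ} (n≤2k : n ℕ.≤ k ℕ.* 2) (2k≤1+n : k ℕ.* 2 ℕ.≤ suc n) where

    -- 2k ≤ n + 1 ≤ 2j + 1. Hence each of the `k` blocks has its even edge, even where the last one
    -- lacks its odd edge.
    k≤half : ∀ j → n ℕ.≤ j ℕ.* 2 → k ℕ.≤ j
    k≤half j n≤2j = ℕ.≤-pred (ℕ.*-cancelʳ-< 2 k (suc j) (ℕ.≤-<-trans 2k≤1+n (s≤s (s≤s n≤2j))))

    half<k : ∀ {i} (p : Parity i) → i ℕ.< n → half p ℕ.< k
    half<k p i<n = ℕ.*-cancelʳ-< 2 (half p) k
      (ℕ.<-≤-trans (ℕ.≤-<-trans (proj₁ (half-bounds p)) i<n) n≤2k)

    -- The roots are taken of whole block masses, not of the coordinates at 2j alone: this composes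
    -- the retraction with the inverse of the homeomorphism.
    toSphere : Weight → ℕ → ℝ
    toSphere G j = sqrt (mass G true j) - sqrt (mass G false j)

    -- In each block the squared positive and negative parts of √a - √b recover the masses a and b,
    -- which are not both positive, and these squares add up to the square of √a - √b.
    toSphere-unit : ∀ {G} → IsWeight n k G → Σ[< k ] (λ j → toSphere G j * toSphere G j) ≈ 1ℝ
    toSphere-unit {G} w = ≈-trans (Σ-cong k square) total
      where
      open IsWeight w
      square : ∀ j → toSphere G j * toSphere G j ≈ mass G true j + mass G false j
      square j = ≈-trans (≈-sym (square-pos-parts (toSphere G j))) (+-cong (part true) (part false))
        where part = sqrt-difference-signed {λ b → mass G b j} (λ b → mass-nonNegative b j) (mass-⊥ j)

    peak : Bool → ℝ → ℝ
    peak b x = pos (signed b x) * pos (signed b x)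

    fromSphere : (ℕ → ℝ) → Weight
    fromSphere x b = spread (λ j → peak b (x j)) (λ _ → 0ℝ)

    0≤peak : ∀ b x → 0ℝ ≤ peak b x
    0≤peak b x = *-nonNegative (0≤pos _) (0≤pos _)

    peak-0 : ∀ b → x ≈ 0ℝ → peak b x ≈ 0ℝ
    peak-0 {x} b x≈0 = ≈-trans (*-cong (p b) (p b)) (ℝ-Ring.zeroˡ 0ℝ)
      where
      p : ∀ b → pos (signed b x) ≈ 0ℝ
      p true  = pos-nonPositive (≈⇒≤ x≈0)
      p false = pos-nonPositive (≈⇒≤ (≈-trans (neg-cong x≈0) (solve 0 (:- con 0ℚ := con 0ℚ) ≈-refl)))

    peak-⊥ : ∀ x → peak true x ⊥ peak false x
    peak-⊥ x = square-⊥ (0≤pos _) (0≤pos _) (pos*posneg x)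

    -- Only even indices carry weight, and two even indices at distance at most 1 coincide.
    -- Disjointness thus reduces to the positive and negative parts of one number.
    fromSphere-isWeight : ∀ {x} → (∀ j → k ℕ.≤ j → x j ≈ 0ℝ) → Σ[< k ] (λ j → x j * x j) ≈ 1ℝ →
      IsWeight n k (fromSphere x)
    fromSphere-isWeight {x} x-vanishes unit = record
      { nonNegative = λ b i → nonNegative b (parity i)
      ; vanishing   = λ b i → vanishing b (parity i)
      ; total       = ≈-trans (Σ-cong k λ j → ≈-trans (+-cong (≈-mass true j) (≈-mass false j))
                        (square-pos-parts (x j))) unit
      ; disjoint    = λ i i′ → disjoint (parity i) (parity i′)
      }
      where
      atEven : ∀ b j → fromSphere x b (j ℕ.* 2) ≡ peak b (x j)
      atEven b = spread-even _ _
      atOdd : ∀ b j → fromSphere x b (suc (j ℕ.* 2)) ≡ 0ℝ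
      atOdd b = spread-odd (λ j → peak b (x j)) _
      nonNegative : ∀ b {i} → Parity i → 0ℝ ≤ fromSphere x b i
      nonNegative b (even j) rewrite atEven b j = 0≤peak b (x j)
      nonNegative b (odd j)  rewrite atOdd b j  = ≤-refl
      vanishing : ∀ b {i} → Parity i → n ℕ.≤ i → fromSphere x b i ≈ 0ℝ
      vanishing b (even j) n≤i rewrite atEven b j = peak-0 b (x-vanishes j (k≤half j n≤i))
      vanishing b (odd j)  n≤i rewrite atOdd b j  = ≈-refl
      ≈-mass : ∀ b j → mass (fromSphere x) b j ≈ peak b (x j)
      ≈-mass b j rewrite atEven b j | atOdd b j = ℝ-Ring.+-identityʳ _
      disjoint : ∀ {i i′} → Parity i → Parity i′ → Close i i′ → fromSphere x true i ⊥ fromSphere x false i′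
      disjoint (odd j) _ _ rewrite atOdd true j = ≈0⇒⊥ ≈-refl
      disjoint (even j) (odd j′) _ rewrite atOdd false j′ = ⊥-sym (≈0⇒⊥ ≈-refl)
      disjoint (even j) (even j′) (p , q) rewrite atEven true j | atEven false j′ =
        subst (λ j′ → peak true (x j) ⊥ peak false (x j′)) j≡j′ (peak-⊥ (x j))
        where
        halve-≤ : ∀ {j j′} → j ℕ.* 2 ℕ.≤ suc (j′ ℕ.* 2) → j ℕ.≤ j′
        halve-≤ {j} {j′} h = ℕ.≤-pred (ℕ.*-cancelʳ-< 2 j (suc j′) (s≤s h))
        j≡j′ : j ≡ j′
        j≡j′ = ℕ.≤-antisym (halve-≤ p) (halve-≤ q)

    toSphere∘fromSphere : ∀ x j → toSphere (fromSphere x) j ≈ x j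
    toSphere∘fromSphere x j
      rewrite spread-even (λ j → peak true (x j)) (λ _ → 0ℝ) j | spread-odd (λ j → peak true (x j)) (λ _ → 0ℝ) j
            | spread-even (λ j → peak false (x j)) (λ _ → 0ℝ) j | spread-odd (λ j → peak false (x j)) (λ _ → 0ℝ) j =
      ≈-trans (+-cong (root true) (neg-cong (root false))) (pos-posneg (x j))
      where
      root : ∀ b → sqrt (peak b (x j) + 0ℝ) ≈ pos (signed b (x j))
      root b = ≈-trans (sqrt-cong (ℝ-Ring.+-identityʳ _)) (sqrt-square (0≤pos _))

    -- The part of the mass at 2j+1 exceeding max (u j) 0 stays there, the rest moves to 2j.
    residue : Weight → (ℕ → ℝ) → Bool → ℕ → ℝ
    residue G u b j = pos (G b (suc (j ℕ.* 2)) - pos (u j))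

    slide : Weight → (ℕ → ℝ) → Weight
    slide G u b = spread (λ j → mass G b j - residue G u b j) (residue G u b)

    module _ {G : Weight} (w : IsWeight n k G) (u : ℕ → ℝ) where
      open IsWeight w

      slide-even : ∀ b j → slide G u b (j ℕ.* 2) ≡ mass G b j - residue G u b j
      slide-even b = spread-even _ _

      slide-odd : ∀ b j → slide G u b (suc (j ℕ.* 2)) ≡ residue G u b j
      slide-odd b = spread-odd (λ j → mass G b j - residue G u b j) _

      residue≤ : ∀ b j → residue G u b j ≤ G b (suc (j ℕ.* 2))
      residue≤ b j = pos-≤ (nonNegative b _)
        (≤-resp-≈ ≈-refl (ℝ-Ring.+-identityʳ _) (+-monoʳ-≤ _ (-x≤0 (0≤pos (u j)))))

      residue≤mass : ∀ b j → residue G u b j ≤ mass G b j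
      residue≤mass b j = ≤-trans (residue≤ b j) (≤mass b (odd j))

      slide-nonNegative : ∀ b {i} → Parity i → 0ℝ ≤ slide G u b i
      slide-nonNegative b (even j) rewrite slide-even b j = x≤y⇒0≤y-x (residue≤mass b j)
      slide-nonNegative b (odd j)  rewrite slide-odd b j  = 0≤pos _

      slide-mass : ∀ b j → mass (slide G u) b j ≈ mass G b j
      slide-mass b j rewrite slide-even b j | slide-odd b j =
        solve 2 (λ m r → (m :+ :- r) :+ r := m) ≈-refl (mass G b j) (residue G u b j)

      -- However far a block has folded, its entries stay below the unchanged block mass, so
      -- `mass-⊥` settles every conflict inside a block.
      slide≤mass : ∀ b {i} (p : Parity i) → slide G u b i ≤ mass G b (half p)
      slide≤mass b (even j) rewrite slide-even b j = ≤-resp-≈ ≈-refl (ℝ-Ring.+-identityʳ _)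
        (+-monoʳ-≤ (mass G b j) (-x≤0 (0≤pos _)))
      slide≤mass b (odd j)  rewrite slide-odd b j = residue≤mass b j

      slide-vanishing : ∀ b {i} → Parity i → n ℕ.≤ i → slide G u b i ≈ 0ℝ
      slide-vanishing b {i} p@(even j) n≤i = ≤-antisym (≤-trans (slide≤mass b p) (≈⇒≤ (≈-trans
          (+-cong (vanishing b _ n≤i) (vanishing b _ (ℕ.m≤n⇒m≤1+n n≤i))) (+-identityˡ 0ℝ))))
        (slide-nonNegative b p)
      slide-vanishing b p@(odd j) n≤i = ≤-antisym
        (≤-trans (≈⇒≤ (≡⇒≈ (slide-odd b j))) (≤-trans (residue≤ b j) (≈⇒≤ (vanishing b _ n≤i))))
        (slide-nonNegative b p)

      -- The clipped threshold is 0, so the residue is all of the mass at 2j+1 and the block is as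
      -- in `G`.
      slide-moved : ∀ b j → u j ≤ 0ℝ → slide G u b (j ℕ.* 2) ≈ G b (j ℕ.* 2) × residue G u b j ≈ G b (suc (j ℕ.* 2))
      slide-moved b j u≤0 rewrite slide-even b j =
          ≈-trans (+-cong ≈-refl (neg-cong r≈)) (solve 2 (λ x y → (x :+ y) :+ :- y := x) ≈-refl _ _)
        , r≈
        where
        r≈ : residue G u b j ≈ G b (suc (j ℕ.* 2))
        r≈ = ≈-trans (pos-cong (≈-trans (+-cong ≈-refl (neg-cong (pos-nonPositive u≤0)))
            (solve 1 (λ x → x :+ :- con 0ℚ := x) ≈-refl _))) (pos-nonNegative (nonNegative b _))

      residue-0 : ∀ b j → G b (suc (j ℕ.* 2)) ≤ u j → residue G u b j ≈ 0ℝ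
      residue-0 b j G≤u = pos-nonPositive (≤-resp-≈ ≈-refl (ℝ-Ring.-‿inverseʳ (pos (u j)))
        (+-monoˡ-≤ (- pos (u j)) (≤-trans G≤u (x≤pos (u j)))))

      -- If mass remains at 2j+1 then u j < 1, so u (j+1) ≤ 0 and the block at 2j+2 has not moved yet.
      slide-consecutive : (∀ j → u (suc j) ≈ u j - 1ℝ) → ∀ b j →
        slide G u b (suc (j ℕ.* 2)) ⊥ slide G u (not b) (suc j ℕ.* 2)
      slide-consecutive step b j (p , q) with j ℕ.<? k
      ... | no j≮k = <⇒≱ p (≤-trans (≈⇒≤ (≡⇒≈ (slide-odd b j))) (≤-trans (residue≤ b j)
          (≈⇒≤ (vanishing b _ (ℕ.m≤n⇒m≤1+n (ℕ.≤-trans n≤2k (ℕ.*-monoˡ-≤ 2 (ℕ.≮⇒≥ j≮k))))))))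
      ... | yes j<k = ≤-total (u (suc j)) 0ℝ λ where
        (inj₁ u≤0) → disjoint′ b (suc (j ℕ.* 2)) (suc j ℕ.* 2) (ℕ.m≤n⇒m≤1+n (ℕ.n≤1+n _) , ℕ.≤-refl)
          ( <-≤-trans p (≤-trans (≈⇒≤ (≡⇒≈ (slide-odd b j))) (residue≤ b j))
          , <-resp-≈ʳ (proj₁ (slide-moved (not b) (suc j) u≤0)) q )
        (inj₂ 0≤u) → <⇒≱ (<-resp-≈ʳ (≡⇒≈ (slide-odd b j)) p) (≈⇒≤ (residue-0 b j
          (≤-trans (≤mass b (odd j)) (≤-trans (mass≤1 b j j<k)
            (0≤y-x⇒x≤y (≤-trans 0≤u (≈⇒≤ (step j))))))))

      -- Sliding preserves block masses, hence the total. Close indices in one block are covered by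
      -- the block masses; those in different blocks are 2j+1 and 2j+2, where the spacing of the
      -- thresholds decides.
      slide-isWeight : (∀ j → u (suc j) ≈ u j - 1ℝ) → IsWeight n k (slide G u)
      slide-isWeight step = record
        { nonNegative = λ b i → slide-nonNegative b (parity i)
        ; vanishing   = λ b i → slide-vanishing b (parity i)
        ; total       = ≈-trans (Σ-cong k λ j → +-cong (slide-mass true j) (slide-mass false j)) total
        ; disjoint    = λ i i′ → slide-disjoint (parity i) (parity i′)
        }
        where
        slide-disjoint : ∀ {i i′} (p : Parity i) (q : Parity i′) → Close i i′ → slide G u true i ⊥ slide G u false i′
        slide-disjoint p q (i≤1+i′ , i′≤1+i) with ℕ.<-cmp (half p) (half q)
        ... | tri≈ _ eq _ = ⊥-mono (slide≤mass true p)
            (subst (λ h → _ ≤ mass G false h) (sym eq) (slide≤mass false q)) (mass-⊥ (half p))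
        ... | tri< hp<hq _ _ = let i≡ , i′≡ = consecutive-blocks p q hp<hq i′≤1+i in
            subst₂ (λ i i′ → slide G u true i ⊥ slide G u false i′) (sym i≡) (sym i′≡)
              (slide-consecutive step true (half p))
        ... | tri> _ _ hq<hp = let i′≡ , i≡ = consecutive-blocks q p hq<hp i≤1+i′ in
            subst₂ (λ i i′ → slide G u true i ⊥ slide G u false i′) (sym i≡) (sym i′≡)
              (⊥-sym (slide-consecutive step false (half q)))

      slide-finish : (∀ j → u j ≤ 0ℝ) → ∀ b {i} → Parity i → slide G u b i ≈ G b i
      slide-finish u≤0 b (even j) = proj₁ (slide-moved b j (u≤0 j))
      slide-finish u≤0 b (odd j)  = ≈-trans (≡⇒≈ (slide-odd b j)) (proj₂ (slide-moved b j (u≤0 j)))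

      -- Below `k` block masses are at most 1, hence at most the threshold. So nothing is left at
      -- 2j+1, and 2j holds the block mass, which is the squared signed part of the difference of
      -- roots.
      slide-start : (∀ j → j ℕ.< k → 1ℝ ≤ u j) → ∀ b {i} → Parity i → i ℕ.< n →
        slide G u b i ≈ fromSphere (toSphere G) b i
      slide-start 1≤u b p i<n with half<k p i<n
      slide-start 1≤u b (even j) i<n | j<k
        rewrite slide-even b j | spread-even (λ j → peak b (toSphere G j)) (λ _ → 0ℝ) j =
        ≈-trans (+-cong ≈-refl (neg-cong (residue-0 b j (≤-trans (≤mass b (odd j)) (≤-trans (mass≤1 b j j<k) (1≤u j j<k))))))
          (≈-trans (solve 1 (λ x → x :+ :- con 0ℚ := x) ≈-refl _)
            (≈-sym (sqrt-difference-signed {λ b → mass G b j} (λ b → mass-nonNegative b j) (mass-⊥ j) b)))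
      slide-start 1≤u b (odd j) i<n | j<k
        rewrite slide-odd b j | spread-odd (λ j → peak b (toSphere G j)) (λ _ → 0ℝ) j =
        residue-0 b j (≤-trans (≤mass b (odd j)) (≤-trans (mass≤1 b j j<k) (1≤u j j<k)))

    -- Masses are at most 1, so at time s block j is folded while this is ≥ 1 and untouched once it is ≤ 0.
    threshold : ℝ → ℕ → ℝ
    threshold s j = fromℚ (fromℕ k) * (1ℝ - s) - fromℚ (fromℕ j)

    fromℕ-suc-ℝ : ∀ j → fromℚ (fromℕ (suc j)) ≈ fromℚ (fromℕ j) + 1ℝ
    fromℕ-suc-ℝ j = ≈-trans (≡⇒≈ (cong fromℚ (fromℕ-suc j))) (fromℚ-+ (fromℕ j) 1ℚ)

    threshold-step : ∀ s j → threshold s (suc j) ≈ threshold s j - 1ℝ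
    threshold-step s j = ≈-trans (+-cong ≈-refl (neg-cong (fromℕ-suc-ℝ j)))
      (solve 2 (λ a m → a :+ :- (m :+ con 1ℚ) := a :+ :- m :+ :- con 1ℚ) ≈-refl _ _)

    threshold-finish : ∀ {s} → s ≈ 1ℝ → ∀ j → threshold s j ≤ 0ℝ
    threshold-finish {s} s≈1 j = ≤-trans (≈⇒≤ (≈-trans
        (+-cong (*-cong ≈-refl (+-cong ≈-refl (neg-cong s≈1))) ≈-refl)
        (solve 2 (λ a m → a :* (con 1ℚ :+ :- con 1ℚ) :+ :- m := :- m) ≈-refl _ _)))
      (-x≤0 (fromℚ-mono-≤ (ℚ.nonNegative⁻¹ (fromℕ j))))

    threshold-start : ∀ {s} → s ≈ 0ℝ → ∀ j → j ℕ.< k → 1ℝ ≤ threshold s j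
    threshold-start {s} s≈0 j j<k = ≤-resp-≈ (solve 1 (λ m → (m :+ con 1ℚ) :+ :- m := con 1ℚ) ≈-refl _)
      (≈-sym (+-cong (≈-trans (*-cong ≈-refl (+-cong ≈-refl (neg-cong s≈0)))
        (solve 1 (λ a → a :* (con 1ℚ :+ :- con 0ℚ) := a) ≈-refl _)) ≈-refl))
      (+-monoˡ-≤ _ (≤-trans (≈⇒≥ (fromℕ-suc-ℝ j)) (fromℚ-mono-≤ (fromℕ-mono j<k))))
      where
      fromℕ-mono : ∀ {i j} → i ℕ.≤ j → fromℕ i ℚ.≤ fromℕ j
      fromℕ-mono {i} {j} i≤j = ℚ.*≤* (ℤ.*-monoʳ-≤-nonNeg (+ 1) (ℤ.+≤+ i≤j))

  -- Finite families extended by zero, and supports under double negation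

  extend : ∀ {n} → (Fin n → ℝ) → ℕ → ℝ
  extend {zero}  f i       = 0ℝ
  extend {suc n} f zero    = f zero
  extend {suc n} f (suc i) = extend (f ∘ suc) i

  extend-toℕ : ∀ {n} (f : Fin n → ℝ) i → extend f (toℕ i) ≡ f i
  extend-toℕ f zero    = refl
  extend-toℕ f (suc i) = extend-toℕ (f ∘ suc) i

  extend-beyond : ∀ {n} (f : Fin n → ℝ) i → n ℕ.≤ i → extend f i ≡ 0ℝ
  extend-beyond {zero}  f i       _         = refl
  extend-beyond {suc n} f (suc i) (s≤s n≤i) = extend-beyond (f ∘ suc) i n≤i

  extend-lift : (Q : ℝ → Set) → Q 0ℝ → ∀ {n} (f : Fin n → ℝ) → (∀ i → Q (f i)) → ∀ i → Q (extend f i)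
  extend-lift Q q {zero}  f p i       = q
  extend-lift Q q {suc n} f p zero    = p zero
  extend-lift Q q {suc n} f p (suc i) = extend-lift Q q (f ∘ suc) (p ∘ suc) i

  Σ-extend-sum : ∀ {n} (f : Fin n → ℝ) → Σ[< n ] (extend f) ≡ sum f
  Σ-extend-sum f = sum-cong-≗ (extend-toℕ f)

  sum-++ : ∀ m {n} (f : Fin (m ℕ.+ n) → ℝ) → sum f ≈ sum (λ i → f (i ↑ˡ n)) + sum (λ j → f (m ↑ʳ j))
  sum-++ zero    f = ≈-sym (+-identityˡ _)
  sum-++ (suc m) f = ≈-trans (+-cong ≈-refl (sum-++ m (f ∘ suc))) (≈-sym (+-assoc _ _ _))

  sum-nonPositive : ∀ {n} (f : Fin n → ℝ) → (∀ i → f i ≤ 0ℝ) → sum f ≤ 0ℝ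
  sum-nonPositive {zero}  f q = ≤-refl
  sum-nonPositive {suc n} f q = ≤-resp-≈ ≈-refl (+-identityˡ 0ℝ) (+-mono-≤ (q zero) (sum-nonPositive (f ∘ suc) (q ∘ suc)))

  -- Excluded middle holds under double negation at each index, and finitely many instances combine.
  -- This yields the support of a point wherever the goal is a negation.
  ¬¬-decide : ∀ m (Q : Fin m → Set) → ¬ ¬ (∀ i → Dec (Q i))
  ¬¬-decide zero    Q k = k λ ()
  ¬¬-decide (suc m) Q k = ¬¬-excluded-middle λ d → ¬¬-decide m (Q ∘ suc) λ ds →
    k λ { zero → d ; (suc i) → ds i }

  module _ {m : ℕ} {Q : Fin m → Set} (Q? : ∀ i → Dec (Q i)) where

    filterSubset : Subset m
    filterSubset = tabulate (does ∘ Q?)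

    ∈⇒ : ∀ i → i ∈ filterSubset → Q i
    ∈⇒ i i∈ with Q? i in eq
    ... | yes q = q
    ... | no _  = contradiction (trans (sym ([]=⇒lookup i∈)) (trans (lookup∘tabulate (does ∘ Q?) i) (cong does eq))) λ ()

    ⇒∈ : ∀ i → Q i → i ∈ filterSubset
    ⇒∈ i q = lookup⇒[]= i filterSubset (trans (lookup∘tabulate (does ∘ Q?) i) (dec-true (Q? i) q))

  -- Passage between the opaque relations and those of the statement

  opaque
    unfolding _≈_

    ≈⇒D : x ≈ y → x D.≈ y
    ≈⇒D x≈y = x≈y

    D⇒≈ : x D.≈ y → x ≈ y
    D⇒≈ x≈y = x≈y

    ≤⇒D : x ≤ y → x D.≤ y
    ≤⇒D x≤y = x≤y

    D⇒≤ : x D.≤ y → x ≤ y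
    D⇒≤ x≤y = x≤y

    <⇒D : x < y → x D.< y
    <⇒D x<y = x<y

    D⇒< : x D.< y → x < y
    D⇒< x<y = x<y

    near⇒D : ∣ x - y ∣ < z → D.∣ x D.- y ∣ D.< z
    near⇒D d = d

    D⇒near : D.∣ x D.- y ∣ D.< z → ∣ x - y ∣ < z
    D⇒near d = d

    sum≡D : ∀ {m} (t : Fin m → ℝ) → sum t ≡ D.sum t
    sum≡D t = refl

    unit⇒∈Sphere : ∀ m (x : Fin m → ℝ) → sum (λ i → x i * x i) ≈ 1ℝ → Space._∋_ (unitSphere m) x
    unit⇒∈Sphere m x eq = eq

    ∈Sphere⇒unit : ∀ m (q : Space.Point (unitSphere m)) →
      sum (λ i → Space.coord (unitSphere m) q i * Space.coord (unitSphere m) q i) ≈ 1ℝ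
    ∈Sphere⇒unit m q = proj₂ q

  -- Continuity of maps between spaces, coordinate by coordinate

  module SpaceContinuity (X : Space) where
    open Space X

    NearPoints : ℚ → Point → Point → Set
    NearPoints δ p q = ∀ i → ∣ coord p i - coord q i ∣ < fromℚ δ

    NearPairs : ℚ → Point × Interval → Point × Interval → Set
    NearPairs δ (p , s) (q , t) = NearPoints δ p q × ∣ proj₁ s - proj₁ t ∣ < fromℚ δ

    nearPoints-weaken : ∀ {δ η} p q → δ ℚ.≤ η → NearPoints δ p q → NearPoints η p q
    nearPoints-weaken p q δ≤η c i = <-≤-trans (c i) (fromℚ-mono-≤ δ≤η)

    nearPairs-weaken : ∀ {δ η} p q → δ ℚ.≤ η → NearPairs δ p q → NearPairs η p q
    nearPairs-weaken (p , _) (q , _) δ≤η (c , d) =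
      nearPoints-weaken p q δ≤η c , <-≤-trans d (fromℚ-mono-≤ δ≤η)

    module Single = Continuity Point NearPoints nearPoints-weaken
    module Joint = Continuity (Point × Interval) NearPairs nearPairs-weaken

    coord-continuous : ∀ i → Single.IsContinuous λ p → coord p i
    coord-continuous i p ε ε>0 = ε , ε>0 , λ q c → c i

    coord-jointly-continuous : ∀ i → Joint.IsContinuous λ ps → coord (proj₁ ps) i
    coord-jointly-continuous i p ε ε>0 = ε , ε>0 , λ q c → proj₁ c i

    time-continuous : Joint.IsContinuous λ ps → proj₁ (proj₂ ps)
    time-continuous p ε ε>0 = ε , ε>0 , λ q c → proj₂ c

    continuous : (Y : Space) (F : Point → Space.Point Y) →
      (∀ i → Single.IsContinuous λ p → Space.coord Y (F p) i) → Continuous X Y F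
    continuous Y F cF p ε ε>0 =
      let δ , δ>0 , close = Single.uniform (λ i p → Space.coord Y (F p) i) cF p ε ε>0
      in δ , δ>0 , λ q c i → near⇒D (close q (λ j → D⇒near (c j)) i)

    jointlyContinuous : (Y : Space) (F : Point → Interval → Space.Point Y) →
      (∀ i → Joint.IsContinuous λ ps → Space.coord Y (F (proj₁ ps) (proj₂ ps)) i) → JointlyContinuous X Y F
    jointlyContinuous Y F cF p s ε ε>0 =
      let δ , δ>0 , close = Joint.uniform (λ i ps → Space.coord Y (F (proj₁ ps) (proj₂ ps)) i) cF (p , s) ε ε>0
      in δ , δ>0 , λ q t c d i → near⇒D (close (q , t) ((λ j → D⇒near (c j)) , D⇒near d) i)

  -- Correspondence between points of the realization and weights

  module Realization {n k : ℕ} (n≤2k : n ℕ.≤ k ℕ.* 2) (2k≤1+n : k ℕ.* 2 ℕ.≤ suc n) where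
    open BidirectionalLinear n using (edgeOf; edgeOf-surjective; ConflictFree; multipath⇒conflictFree)
    open Blocks {n} {k} n≤2k 2k≤1+n

    X Y : Space
    X = ∣ MultipathComplex (BL n) ∣ᴳ
    Y = unitSphere k

    open Space X using () renaming (_∋_ to X∋_; Point to PointX; coord to coordX)
    open Space Y using () renaming (Point to PointY; coord to coordY)

    weight : (Fin (n ℕ.+ n) → ℝ) → Weight
    weight t b = extend (λ i → t (edgeOf b i))

    coords : Weight → Fin (n ℕ.+ n) → ℝ
    coords G e = [ (λ i → G true (toℕ i)) , (λ i → G false (toℕ i)) ]′ (splitAt n e)

    coords-edgeOf : ∀ G b i → coords G (edgeOf b i) ≡ G b (toℕ i)
    coords-edgeOf G true  i rewrite splitAt-↑ˡ n i n = refl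
    coords-edgeOf G false i rewrite splitAt-↑ʳ n n i = refl

    coords-lift : (Q : ℝ → Set) → ∀ G → (∀ b i → Q (G b i)) → ∀ e → Q (coords G e)
    coords-lift Q G p e with splitAt n e
    ... | inj₁ i = p true (toℕ i)
    ... | inj₂ i = p false (toℕ i)

    weight-toℕ : ∀ t b i → weight t b (toℕ i) ≡ t (edgeOf b i)
    weight-toℕ t b i = extend-toℕ (λ i → t (edgeOf b i)) i

    index<n : ∀ {i} → i ℕ.< n → ∃[ i′ ] toℕ {n} i′ ≡ i
    index<n i<n = fromℕ< i<n , toℕ-fromℕ< i<n

    -- `coords` keeps only the entries below `n`; vanishing from `n` on is what allows the others to
    -- be restored as zeros.
    weight-coords : ∀ {G} → (∀ b i → n ℕ.≤ i → G b i ≈ 0ℝ) → ∀ b i → weight (coords G) b i ≈ G b i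
    weight-coords {G} vanishing b i with ℕ.<-≤-connex i n
    ... | inj₂ n≤i = ≈-trans (≡⇒≈ (extend-beyond _ i n≤i)) (≈-sym (vanishing b i n≤i))
    ... | inj₁ i<n with index<n i<n
    ... | i′ , refl = ≡⇒≈ (trans (weight-toℕ (coords G) b i′) (coords-edgeOf G b i′))

    sum-edges : ∀ t → sum t ≈ Σ[< n ] (weight t true) + Σ[< n ] (weight t false)
    sum-edges t = ≈-trans (sum-++ n t) (≈-sym (+-cong (≡⇒≈ (Σ-extend-sum (λ i → t (edgeOf true i))))
                                                       (≡⇒≈ (Σ-extend-sum (λ i → t (edgeOf false i))))))

    Σ-blocks : ∀ {G} → (∀ b i → n ℕ.≤ i → G b i ≈ 0ℝ) →
      Σ[< n ] (G true) + Σ[< n ] (G false) ≈ Σ[< k ] (λ j → mass G true j + mass G false j)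
    Σ-blocks {G} vanishing = ≈-trans (+-cong (blocks true) (blocks false))
        (≈-sym (∑-distrib-+ {k} (mass G true ∘ toℕ) (mass G false ∘ toℕ)))
      where
      blocks : ∀ b → Σ[< n ] (G b) ≈ Σ[< k ] (mass G b)
      blocks b = ≈-trans (Σ-extend n≤2k (vanishing b)) (Σ-pairs k (G b))

    -- The point condition speaks of a support that cannot be exhibited. Since the goal is a
    -- negation, positivity of all coordinates may be decided first; the resulting subset is a
    -- support, hence a multipath.
    point-disjoint : ∀ t → (∀ A → IsSupport A t → MultipathComplex (BL n) A) →
      ∀ i j → Close (toℕ i) (toℕ j) → t (edgeOf true i) ⊥ t (edgeOf false j)
    point-disjoint t simplex i j c (0<i , 0<j) = ¬¬-decide (n ℕ.+ n) (λ e → 0ℝ D.< t e) λ dec →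
      multipath⇒conflictFree (filterSubset dec)
        (proj₂ (simplex (filterSubset dec) λ e → mk⇔ (∈⇒ dec e) (⇒∈ dec e)))
        i j (⇒∈ dec _ (<⇒D 0<i)) (⇒∈ dec _ (<⇒D 0<j)) c

    weight-vanishing : ∀ t b i → n ℕ.≤ i → weight t b i ≈ 0ℝ
    weight-vanishing t b i n≤i = ≡⇒≈ (extend-beyond (λ i → t (edgeOf b i)) i n≤i)

    weight-disjoint : ∀ t → (∀ i j → Close (toℕ i) (toℕ j) → t (edgeOf true i) ⊥ t (edgeOf false j)) →
      ∀ i j → Close i j → weight t true i ⊥ weight t false j
    weight-disjoint t d i j c with ℕ.<-≤-connex i n | ℕ.<-≤-connex j n
    ... | inj₂ n≤i | _        = ≈0⇒⊥ (weight-vanishing t true i n≤i)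
    ... | inj₁ _   | inj₂ n≤j = ⊥-sym (≈0⇒⊥ (weight-vanishing t false j n≤j))
    ... | inj₁ i<n | inj₁ j<n with index<n i<n | index<n j<n
    ... | i′ , refl | j′ , refl = subst₂ _⊥_ (sym (weight-toℕ t true i′)) (sym (weight-toℕ t false j′))
                                    (d i′ j′ c)

    edges-≈ : ∀ {s t : Fin (n ℕ.+ n) → ℝ} → (∀ b i → s (edgeOf b i) ≈ t (edgeOf b i)) → ∀ e → s e ≈ t e
    edges-≈ h e with edgeOf-surjective e
    ... | b , i , refl = h b i

    weight-isWeight : (p : PointX) → IsWeight n k (weight (coordX p))
    weight-isWeight (t , 0≤t , sum≈1 , simplex) = record
      { nonNegative = λ b → extend-lift (0ℝ ≤_) ≤-refl _ (λ i → D⇒≤ (0≤t (edgeOf b i)))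
      ; vanishing   = weight-vanishing t
      ; total       = ≈-trans (≈-sym (Σ-blocks (weight-vanishing t))) (≈-trans (≈-sym (sum-edges t))
                        (≈-trans (≡⇒≈ (sum≡D t)) (D⇒≈ sum≈1)))
      ; disjoint    = weight-disjoint t (point-disjoint t simplex)
      }

    -- A support without elements would make every coordinate ≤ 0, against the sum 1.
    -- Conflict-freeness of a support is `disjoint` read at two of its edges.
    coords-member : ∀ {G} → IsWeight n k G → X∋ coords G
    coords-member {G} w = (λ e → ≤⇒D (nonNeg e))
        , ≈⇒D (≈-trans (≈-sym (≡⇒≈ (sum≡D (coords G)))) sum≈1)
        , λ A supp → nonempty A supp , conflictFree⇒multipath n A (conflictFree A supp)
      where
      open IsWeight w
      nonNeg : ∀ e → 0ℝ ≤ coords G e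
      nonNeg = coords-lift (0ℝ ≤_) G nonNegative

      sum≈1 : sum (coords G) ≈ 1ℝ
      sum≈1 = ≈-trans (sum-edges (coords G)) (≈-trans
        (+-cong (Σ-cong n (weight-coords vanishing true)) (Σ-cong n (weight-coords vanishing false)))
        (≈-trans (Σ-blocks vanishing) total))

      nonempty : ∀ A → IsSupport A (coords G) → Nonempty A
      nonempty A supp with nonempty? A
      ... | yes ne = ne
      ... | no  ¬ne = contradiction (≤-trans (≈⇒≥ sum≈1) (sum-nonPositive (coords G) λ e →
              ≮⇒≥ λ 0<t → ¬ne (e , Equivalence.from (supp e) (<⇒D 0<t))))
            (<⇒≱ (fromℚ-mono-< (ℚ.positive⁻¹ 1ℚ)))

      conflictFree : ∀ A → IsSupport A (coords G) → ConflictFree A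
      conflictFree A supp i j i∈A j∈A c = disjoint (toℕ i) (toℕ j) c
        ( subst (0ℝ <_) (coords-edgeOf G true i) (D⇒< (Equivalence.to (supp _) i∈A))
        , subst (0ℝ <_) (coords-edgeOf G false j) (D⇒< (Equivalence.to (supp _) j∈A)) )

  -- The homotopy equivalence

  module _ {n k : ℕ} (n≤2k : n ℕ.≤ k ℕ.* 2) (2k≤1+n : k ℕ.* 2 ℕ.≤ suc n) where
    open BidirectionalLinear n using (edgeOf)
    open Blocks {n} {k} n≤2k 2k≤1+n
    open Realization {n} {k} n≤2k 2k≤1+n
    open Space X using () renaming (Point to PointX; coord to coordX; _≋_ to _≋X_)
    open Space Y using () renaming (Point to PointY; coord to coordY)

    module WeightContinuity (P : Set) (Near : ℚ → P → P → Set)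
      (weaken : ∀ {δ η} p q → δ ℚ.≤ η → Near δ p q → Near η p q) where
      open Continuity P Near weaken

      extend-continuous : ∀ {m} {f : P → Fin m → ℝ} → (∀ i → IsContinuous λ p → f p i) →
        ∀ i → IsContinuous λ p → extend (f p) i
      extend-continuous {zero}  cf i       = const-continuous 0ℝ
      extend-continuous {suc m} cf zero    = cf zero
      extend-continuous {suc m} cf (suc i) = extend-continuous (cf ∘ suc) i

      spread-continuous : ∀ {e o : P → ℕ → ℝ} → (∀ j → IsContinuous λ p → e p j) →
        (∀ j → IsContinuous λ p → o p j) → ∀ i → IsContinuous λ p → spread (e p) (o p) i
      spread-continuous ce co zero          = ce 0
      spread-continuous ce co (suc zero)    = co 0
      spread-continuous ce co (suc (suc i)) = spread-continuous (ce ∘ suc) (co ∘ suc) i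

      module _ {t : P → Fin (n ℕ.+ n) → ℝ} (ct : ∀ i → IsContinuous λ p → t p i) where

        weight-continuous : ∀ b i → IsContinuous λ p → weight (t p) b i
        weight-continuous b = extend-continuous λ i → ct (edgeOf b i)

      module _ {G : P → Weight} (cG : ∀ b i → IsContinuous λ p → G p b i) where

        mass-continuous : ∀ b j → IsContinuous λ p → mass (G p) b j
        mass-continuous b j = +-continuous (cG b _) (cG b _)

        toSphere-continuous : ∀ j → IsContinuous λ p → toSphere (G p) j
        toSphere-continuous j = +-continuous (sqrt-continuous (mass-continuous true j))
          (neg-continuous (sqrt-continuous (mass-continuous false j)))

        slide-continuous : ∀ {u : P → ℕ → ℝ} → (∀ j → IsContinuous λ p → u p j) →
          ∀ b i → IsContinuous λ p → slide (G p) (u p) b i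
        slide-continuous {u} cu b = spread-continuous
            (λ j → +-continuous (mass-continuous b j) (neg-continuous (residue-continuous j)))
            residue-continuous
          where
          residue-continuous : ∀ j → IsContinuous λ p → residue (G p) (u p) b j
          residue-continuous j = pos-continuous (+-continuous (cG b _) (neg-continuous (pos-continuous (cu j))))

        coords-continuous : ∀ e → IsContinuous λ p → coords (G p) e
        coords-continuous e with splitAt n e
        ... | inj₁ i = cG true (toℕ i)
        ... | inj₂ i = cG false (toℕ i)

      threshold-continuous : ∀ {s : P → ℝ} → IsContinuous s → ∀ j → IsContinuous λ p → threshold (s p) j
      threshold-continuous cs j = +-continuous
        (*-continuous (const-continuous _) (+-continuous (const-continuous _) (neg-continuous cs)))
        (const-continuous _)

      fromSphere-continuous : ∀ {x : P → ℕ → ℝ} → (∀ j → IsContinuous λ p → x p j) →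
        ∀ b i → IsContinuous λ p → fromSphere (x p) b i
      fromSphere-continuous {x} cx b = spread-continuous
          (λ j → let c = pos-continuous (signed-continuous b j) in *-continuous c c)
          (λ j → const-continuous 0ℝ)
        where
        signed-continuous : ∀ b j → IsContinuous λ p → signed b (x p j)
        signed-continuous true  j = cx j
        signed-continuous false j = neg-continuous (cx j)

    module CX = SpaceContinuity X
    module CY = SpaceContinuity Y
    module WX = WeightContinuity PointX CX.NearPoints CX.nearPoints-weaken
    module WXI = WeightContinuity (PointX × Interval) CX.NearPairs CX.nearPairs-weaken
    module WY = WeightContinuity PointY CY.NearPoints CY.nearPoints-weaken

    weightOf : PointX → Weight
    weightOf p = weight (coordX p)

    toCoords : PointX → Fin k → ℝ
    toCoords p i = toSphere (weightOf p) (toℕ i)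

    toCoords-unit : ∀ p → sum (λ i → toCoords p i * toCoords p i) ≈ 1ℝ
    toCoords-unit p = toSphere-unit (weight-isWeight p)

    to : PointX → PointY
    to p = toCoords p , unit⇒∈Sphere k (toCoords p) (toCoords-unit p)

    extended : PointY → ℕ → ℝ
    extended q = extend (coordY q)

    from-isWeight : ∀ q → IsWeight n k (fromSphere (extended q))
    from-isWeight q = fromSphere-isWeight (λ j k≤j → ≡⇒≈ (extend-beyond (coordY q) j k≤j))
      (≈-trans (≡⇒≈ (sum-square (coordY q))) (∈Sphere⇒unit k q))
      where
      sum-square : ∀ {m} (x : Fin m → ℝ) → Σ[< m ] (λ j → extend x j * extend x j) ≡ sum (λ i → x i * x i)
      sum-square x = sum-cong-≗ λ i → cong₂ _*_ (extend-toℕ x i) (extend-toℕ x i)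

    from : PointY → PointX
    from q = coords (fromSphere (extended q)) , coords-member (from-isWeight q)

    slideBy : PointX → ℝ → Weight
    slideBy p s = slide (weightOf p) (threshold s)

    homotopy : PointX → Interval → PointX
    homotopy p (s , _) = coords (slideBy p s)
      , coords-member (slide-isWeight (weight-isWeight p) (threshold s) (threshold-step s))

    homotopy-0 : ∀ p t → proj₁ t D.≈ 0ℝ → homotopy p t ≋X from (to p)
    homotopy-0 p t@(s , _) s≈0 = λ e → ≈⇒D (edges-≈ {coordX (homotopy p t)} {coordX (from (to p))} (λ b i → ≈-trans
      (≡⇒≈ (coords-edgeOf (slideBy p s) b i)) (≈-trans
      (slide-start (weight-isWeight p) (threshold s) (threshold-start (D⇒≈ s≈0)) b (parity (toℕ i)) (toℕ<n i))
      (≡⇒≈ (trans (sym (restrict b (parity (toℕ i)) (toℕ<n i)))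
        (sym (coords-edgeOf (fromSphere (extended (to p))) b i)))))) e)
      where
      -- `extended (to p)` is 0 from `k` on, where `toSphere` is still a difference of roots. The
      -- two are identified only below `k`, and `i < n` places the block of `i` there.
      restrict : ∀ b {i} → Parity i → i ℕ.< n →
        fromSphere (extended (to p)) b i ≡ fromSphere (toSphere (weightOf p)) b i
      restrict b (odd j)  i<n = trans (spread-odd (λ j → peak b (extended (to p) j)) (λ _ → 0ℝ) j)
        (sym (spread-odd (λ j → peak b (toSphere (weightOf p) j)) (λ _ → 0ℝ) j))
      restrict b (even j) i<n = trans (spread-even (λ j → peak b (extended (to p) j)) (λ _ → 0ℝ) j)
        (trans (cong (peak b) (agree (half<k (even j) i<n)))
          (sym (spread-even (λ j → peak b (toSphere (weightOf p) j)) (λ _ → 0ℝ) j)))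
        where
        agree : ∀ {j} → j ℕ.< k → extended (to p) j ≡ toSphere (weightOf p) j
        agree j<k = subst (λ j → extended (to p) j ≡ toSphere (weightOf p) j) (toℕ-fromℕ< j<k)
          (extend-toℕ (λ i → toSphere (weightOf p) (toℕ i)) (fromℕ< j<k))

    homotopy-1 : ∀ p t → proj₁ t D.≈ 1ℝ → homotopy p t ≋X p
    homotopy-1 p t@(s , _) s≈1 = λ e → ≈⇒D (edges-≈ {coordX (homotopy p t)} {coordX p} (λ b i → ≈-trans
      (≡⇒≈ (coords-edgeOf (slideBy p s) b i)) (≈-trans
      (slide-finish (weight-isWeight p) (threshold s) (threshold-finish (D⇒≈ s≈1)) b (parity (toℕ i)))
      (≡⇒≈ (weight-toℕ (coordX p) b i)))) e)

    to∘from-≈ : ∀ q i → coordY (to (from q)) i ≈ coordY q i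
    to∘from-≈ q i = ≈-trans (toSphere-cong (toℕ i) (weight-coords (IsWeight.vanishing (from-isWeight q))))
      (≈-trans (toSphere∘fromSphere (extended q) (toℕ i)) (≡⇒≈ (extend-toℕ (coordY q) i)))
      where
      toSphere-cong : ∀ {F G} j → (∀ b i → F b i ≈ G b i) → toSphere F j ≈ toSphere G j
      toSphere-cong j h = +-cong (sqrt-cong (+-cong (h true _) (h true _)))
        (neg-cong (sqrt-cong (+-cong (h false _) (h false _))))

    realization≃sphere : X ≃ Y
    realization≃sphere = record
      { to = to
      ; from = from
      ; to-continuous = CX.continuous Y to λ i →
          WX.toSphere-continuous (WX.weight-continuous CX.coord-continuous) (toℕ i)
      ; from-continuous = CY.continuous X from
          (WY.coords-continuous (WY.fromSphere-continuous
            (WY.extend-continuous CY.coord-continuous)))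
      ; from∘to = record
          { map = homotopy
          ; continuous = CX.jointlyContinuous X homotopy
              (WXI.coords-continuous (WXI.slide-continuous
                (WXI.weight-continuous CX.coord-jointly-continuous)
                (WXI.threshold-continuous CX.time-continuous)))
          ; at-0 = homotopy-0
          ; at-1 = homotopy-1
          }
      ; to∘from = record
          -- `to ∘ from` agrees with the identity up to `_≈_`, and the ends of a homotopy are
          -- compared up to `_≋_`, so the constant homotopy serves.
          { map = λ q _ → q
          ; continuous = CY.jointlyContinuous Y (λ q _ → q) CY.coord-jointly-continuous
          ; at-0 = λ q _ _ i → ≈⇒D (≈-sym (to∘from-≈ q i))
          ; at-1 = λ q _ _ i → ≈⇒D (≈-refl {coordY q i})
          }
      }

-- The number of blocks and the dimension of the sphere

open import Data.Integer.Base using (+_; 1ℤ; _-_; _/ℕ_)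

proposition2p2 : (n : ℕ) → ∣ MultipathComplex (BL n) ∣ᴳ ≃ Sphere ((+ n - 1ℤ) /ℕ 2)
-- The floor of -1/2 is -1, and `Sphere` takes this to the unit sphere of ℝ⁰, so there are no
-- blocks.
proposition2p2 zero    = HomotopyEquivalence.realization≃sphere {0} {0} z≤n z≤n
-- ⌊m/2⌋ + 1 blocks: half of `suc m` rounded up, and the dimension of the space around the sphere of
-- dimension ⌊m/2⌋.
proposition2p2 (suc m) = HomotopyEquivalence.realization≃sphere {suc m} {suc (m ℕ./ 2)} lower upper
  where
  open ℕ.≤-Reasoning
  lower : suc m ℕ.≤ suc (m ℕ./ 2) ℕ.* 2
  lower = s≤s (begin
    m                              ≡⟨ ℕ.m≡m%n+[m/n]*n m 2 ⟩
    m ℕ.% 2 ℕ.+ m ℕ./ 2 ℕ.* 2      ≤⟨ ℕ.+-monoˡ-≤ _ (ℕ.≤-pred (ℕ.m%n<n m 2)) ⟩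
    suc (m ℕ./ 2 ℕ.* 2)            ∎)
  upper : suc (m ℕ./ 2) ℕ.* 2 ℕ.≤ suc (suc m)
  upper = s≤s (s≤s (ℕ.m/n*n≤m m 2))
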